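{- Let $S$ be a source theory in the language $\mathcal L_S$ and $T$ a target theory in the language $\mathcal L_T$, and let a $T$-sound base interpretation of $S$ be given, with associated uniform interpretation $A\mapsto\langle A\rangle^{\boldsymbol a}_{\boldsymbol b}$. If $\Gamma(\boldsymbol x)\vdash_S A(\boldsymbol x)$ (where $\Gamma$ is a finite list of formulas and $\boldsymbol x$ are variables of types $\boldsymbol\sigma$), then there are tuples of closed witnessing terms $\boldsymbol s,\boldsymbol t$ such that $T$ proves: for all $\boldsymbol a$, $\boldsymbol d$ and all $\boldsymbol x^{\boldsymbol\sigma}$, $$\text{if } \forall \boldsymbol b\in \boldsymbol s\boldsymbol a\boldsymbol d\ \langle \Gamma(\boldsymbol x)\rangle^{\boldsymbol a}_{\boldsymbol b},\ \text{ then }\ \langle A(\boldsymbol x)\rangle^{\boldsymbol t\boldsymbol a}_{\boldsymbol d}.$$ In particular, every theorem of $S$ is $\mathcal U$-interpretable in $T$.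
   Context: Source. The finite-type language $\mathcal L_S$ has ground types and the types generated from them by $\sigma\to\tau$; a constant $e_X$ for each ground type $X$; combinators $\Pi,\Sigma$; possibly other constants; a logical equality symbol $\equiv_\sigma$ for each type $\sigma$; possibly other relation symbols. Formulas are built from atomic formulas and $\bot$ with $\wedge,\to,\forall x^\sigma,\exists x^\sigma$ (there is no disjunction). $S$ is a theory in intuitionistic logic (sequent calculus with cut) with axioms $\forall x(x\equiv_\sigma x)$; $\forall x,y(A\wedge x\equiv_\sigma y\to A')$ ($A$ quantifier-free, $A'$ obtained from $A$ by replacing one or more $x$ by $y$); $\Pi xy\equiv x$; $\Sigma xyz\equiv xz(yz)$; and further non-logical axioms. $\vdash_S$ is derivability in $S$. Target. The types and terms of $\mathcal L_T$ include those of $\mathcal L_S$. $\mathcal L_T$ also has ground witnessing types (new, or coinciding with ground types of $\mathcal L_S$); the witnessing types are generated from these by $\rho\to\tau$ and $\rho^*$ (the type of non-empty finite subsets of $\rho$). Terms of witnessing type are called witnessing terms; they include a constant $e_W$ for each ground witnessing type $W$, combinators for all witnessing types, and constants for singleton $\{q\}$ ($\sigma\to\sigma^*$), binary union $\cup$ ($\sigma^*\to\sigma^*\to\sigma^*$) and indexed union $\bigcup_{w\in t}qw$ ($\sigma^*\to(\sigma\to\tau^*)\to\tau^*$). There are membership relations $\in$ between $\sigma$ and $\sigma^*$. $T$ (intuitionistic or classical) treats equality as usual mathematical equality, satisfies the combinator equations and proves the usual set-theoretic properties of $\{\cdot\},\cup,\bigcup,\in$. Tuples. Boldface letters are (possibly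 empty) tuples; $\forall\boldsymbol b\in\boldsymbol B$ means $\forall b_1\in B_1\cdots\forall b_n\in B_n$; application of tuples is componentwise. Base interpretation. To each relation symbol $R(x_1,\dots,x_r)$ of the source language are assigned two (possibly empty) tuples of witnessing types $\boldsymbol\tau_R^+,\boldsymbol\tau_R^-$ and a relation $\langle R(x_1,\dots,x_r)\rangle^{\boldsymbol c}_{\boldsymbol d}$ expressed in $\mathcal L_T$, with $\boldsymbol c$ of types $\boldsymbol\tau^+_R$ and $\boldsymbol d$ of types $\boldsymbol\tau_R^-$. For $\equiv_\sigma$ both tuples are empty and $\langle x\equiv_\sigma y\rangle$ is $x=y$. $\mathcal U$-interpretation. It extends the base interpretation to all formulas: $\langle\bot\rangle:\equiv\bot$, and if $A,B$ have interpretations $\langle A\rangle^{\boldsymbol a}_{\boldsymbol b}$, $\langle B\rangle^{\boldsymbol c}_{\boldsymbol d}$, $$\begin{array}{lcl}\langle A\wedge B\rangle^{\boldsymbol a,\boldsymbol c}_{\boldsymbol b,\boldsymbol d}&:\equiv&\langle A\rangle^{\boldsymbol a}_{\boldsymbol b}\wedge\langle B\rangle^{\boldsymbol c}_{\boldsymbol d}\\ \langle A\to B\rangle^{\boldsymbol f,\boldsymbol g}_{\boldsymbol a,\boldsymbol d}&:\equiv&\forall\boldsymbol b\in\boldsymbol g\boldsymbol a\boldsymbol d\,\langle A\rangle^{\boldsymbol a}_{\boldsymbol b}\to\langle B\rangle^{\boldsymbol f\boldsymbol a}_{\boldsymbol d}\\ \langle\forall x^\sigma A(x)\rangle^{\boldsymbol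 a}_{\boldsymbol b}&:\equiv&\forall x^\sigma\langle A(x)\rangle^{\boldsymbol a}_{\boldsymbol b}\\ \langle\exists x^\sigma A(x)\rangle^{\boldsymbol a}_{\boldsymbol B}&:\equiv&\exists x^\sigma\forall\boldsymbol b\in\boldsymbol B\,\langle A(x)\rangle^{\boldsymbol a}_{\boldsymbol b}.\end{array}$$ A formula $A(\boldsymbol x)$ is $\mathcal U$-interpretable in $T$ if there are closed witnessing terms $\boldsymbol t$ such that $T$ proves $\forall\boldsymbol b\,\langle A(\boldsymbol x)\rangle^{\boldsymbol t}_{\boldsymbol b}$. The base interpretation is a $T$-sound interpretation of $S$ if every non-logical axiom of $S$ is $\mathcal U$-interpretable in $T$. If $\Gamma$ is $B_1,\dots,B_n$, then $\boldsymbol s=\boldsymbol s_1,\dots,\boldsymbol s_n$, $\boldsymbol a=\boldsymbol a_1,\dots,\boldsymbol a_n$, $\boldsymbol b=\boldsymbol b_1,\dots,\boldsymbol b_n$ and $\forall\boldsymbol b\in\boldsymbol s\boldsymbol a\boldsymbol d\,\langle\Gamma\rangle^{\boldsymbol a}_{\boldsymbol b}$ abbreviates $\bigwedge_{i=1}^n\forall\boldsymbol b_i\in\boldsymbol s_i\boldsymbol a\boldsymbol d\,\langle B_i\rangle^{\boldsymbol a_i}_{\boldsymbol b_i}$. -}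

module Defs where

open import Data.Bool.Base using (Bool; true)
open import Data.List.Base using (List; []; _∷_; _++_; map; concatMap)
open import Data.List.Membership.Propositional using (_∈_)
open import Data.List.Membership.Propositional.Properties using (∈-map⁺; ∈-++⁺ʳ)
open import Data.List.Relation.Unary.All as All using (All; []; _∷_)
open import Data.List.Relation.Unary.All.Properties using (map⁺; map⁻; ++⁺; ++⁻ˡ; ++⁻ʳ)
open import Data.List.Relation.Unary.Any using (here; there)
open import Data.Product.Base using (Σ-syntax; _×_)
open import Relation.Binary.PropositionalEquality using (_≡_; refl)

-- A context is the list of the types of the variables that may occur free; its head is
-- the variable bound last.

module Terms {Ty : Set} (_⇒_ : Ty → Ty → Ty) (Con : Ty → Set) where

  Ctx : Set
  Ctx = List Ty

  infixl 20 _·_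

  data Tm (Δ : Ctx) : Ty → Set where
    var : ∀ {σ} → σ ∈ Δ → Tm Δ σ
    con : ∀ {σ} → Con σ → Tm Δ σ
    _·_ : ∀ {σ τ} → Tm Δ (σ ⇒ τ) → Tm Δ σ → Tm Δ τ

  ren : ∀ {Δ Ξ} → (∀ {σ} → σ ∈ Δ → σ ∈ Ξ) → ∀ {σ} → Tm Δ σ → Tm Ξ σ
  ren r (var x) = var (r x)
  ren r (con c) = con c
  ren r (t · u) = ren r t · ren r u

  Sub : Ctx → Ctx → Set
  Sub Δ Ξ = All (Tm Ξ) Δ

  ids : ∀ {Δ} → Sub Δ Δ
  ids = All.tabulate var

  wk : ∀ {σ Δ} → Sub Δ (σ ∷ Δ)
  wk = All.map (ren there) ids

  lift : ∀ {σ Δ Ξ} → Sub Δ Ξ → Sub (σ ∷ Δ) (σ ∷ Ξ)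
  lift θ = var (here refl) ∷ All.map (ren there) θ

  sub : ∀ {Δ Ξ} → Sub Δ Ξ → ∀ {σ} → Tm Δ σ → Tm Ξ σ
  sub θ (var x) = All.lookup θ x
  sub θ (con c) = con c
  sub θ (t · u) = sub θ t · sub θ u

infixr 30 _⇒_
infix  35 _*

data SType (G : Set) : Set where
  ground : G → SType G
  _⇒_    : SType G → SType G → SType G

record SourceLanguage : Set₁ where
  field
    Ground     : Set
    OtherConst : SType Ground → Set
    -- relation symbols other than the equalities, by the types of their arguments
    Rel        : List (SType Ground) → Set

  data Const : SType Ground → Set where
    e     : ∀ X → Const (ground X)
    Πᶜ    : ∀ {σ τ} → Const (σ ⇒ τ ⇒ σ)
    Σᶜ    : ∀ {ρ σ τ} → Const ((ρ ⇒ σ ⇒ τ) ⇒ (ρ ⇒ σ) ⇒ ρ ⇒ τ)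
    other : ∀ {σ} → OtherConst σ → Const σ

module Source (L : SourceLanguage) where
  open SourceLanguage L
  open Terms {SType Ground} _⇒_ Const public

  infix  15 _≐_
  infixr 14 _∧̇_
  infixr 12 _⊃_

  data Fm (Δ : Ctx) : Set where
    rel  : ∀ {σs} → Rel σs → All (Tm Δ) σs → Fm Δ
    _≐_  : ∀ {σ} → Tm Δ σ → Tm Δ σ → Fm Δ
    ⊥̇    : Fm Δ
    _∧̇_  : Fm Δ → Fm Δ → Fm Δ
    _⊃_  : Fm Δ → Fm Δ → Fm Δ
    ∀̇ ∃̇  : ∀ σ → Fm (σ ∷ Δ) → Fm Δ

  subF : ∀ {Δ Ξ} → Sub Δ Ξ → Fm Δ → Fm Ξ
  subF θ (rel R ts) = rel R (All.map (sub θ) ts)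
  subF θ (s ≐ t)    = sub θ s ≐ sub θ t
  subF θ ⊥̇          = ⊥̇
  subF θ (A ∧̇ B)    = subF θ A ∧̇ subF θ B
  subF θ (A ⊃ B)    = subF θ A ⊃ subF θ B
  subF θ (∀̇ σ A)    = ∀̇ σ (subF (lift θ) A)
  subF θ (∃̇ σ A)    = ∃̇ σ (subF (lift θ) A)

  _[_] : ∀ {Δ σ} → Fm (σ ∷ Δ) → Tm Δ σ → Fm Δ
  A [ t ] = subF (t ∷ ids) A

  data QuantifierFree {Δ : Ctx} : Fm Δ → Set where
    rel : ∀ {σs} (R : Rel σs) ts → QuantifierFree (rel R ts)
    _≐_ : ∀ {σ} (s t : Tm Δ σ) → QuantifierFree (s ≐ t)
    ⊥̇   : QuantifierFree ⊥̇
    _∧̇_ : ∀ {A B} → QuantifierFree A → QuantifierFree B → QuantifierFree (A ∧̇ B)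
    _⊃_ : ∀ {A B} → QuantifierFree A → QuantifierFree B → QuantifierFree (A ⊃ B)

-- Non-logical axioms may have free variables; derivations may use all their
-- substitution instances.
record SourceTheory (L : SourceLanguage) : Set₁ where
  open Source L
  field
    Axiom : ∀ {Δ} → Fm Δ → Set

-- Single-succedent intuitionistic sequent calculus with cut.  The context Δ
-- lists the variables available in a derivation.  As every type has a closed
-- term (built from the e X and the combinators), fixing Δ throughout a
-- derivation loses nothing: further variables can be replaced by closed terms.
module SourceDerivation {L : SourceLanguage} (S : SourceTheory L) where
  open SourceLanguage L
  open Source L
  open SourceTheory S

  infix 4 _⊢_

  data _⊢_ {Δ : Ctx} : List (Fm Δ) → Fm Δ → Set where
    identity    : ∀ {A} → A ∷ [] ⊢ A
    weakening   : ∀ {Γ A C} → Γ ⊢ C → A ∷ Γ ⊢ C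
    contraction : ∀ {Γ A C} → A ∷ A ∷ Γ ⊢ C → A ∷ Γ ⊢ C
    exchange    : ∀ Γ {Γ′ A B C} → Γ ++ A ∷ B ∷ Γ′ ⊢ C → Γ ++ B ∷ A ∷ Γ′ ⊢ C
    cut         : ∀ {Γ A C} → Γ ⊢ A → A ∷ Γ ⊢ C → Γ ⊢ C

    ⊥L  : ∀ {Γ C} → ⊥̇ ∷ Γ ⊢ C
    ∧L₁ : ∀ {Γ A B C} → A ∷ Γ ⊢ C → A ∧̇ B ∷ Γ ⊢ C
    ∧L₂ : ∀ {Γ A B C} → B ∷ Γ ⊢ C → A ∧̇ B ∷ Γ ⊢ C
    ∧R  : ∀ {Γ A B} → Γ ⊢ A → Γ ⊢ B → Γ ⊢ A ∧̇ B
    ⊃L  : ∀ {Γ A B C} → Γ ⊢ A → B ∷ Γ ⊢ C → A ⊃ B ∷ Γ ⊢ C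
    ⊃R  : ∀ {Γ A B} → A ∷ Γ ⊢ B → Γ ⊢ A ⊃ B
    ∀L  : ∀ {Γ σ A C} (t : Tm Δ σ) → A [ t ] ∷ Γ ⊢ C → ∀̇ σ A ∷ Γ ⊢ C
    ∀R  : ∀ {Γ σ A} → map (subF wk) Γ ⊢ A → Γ ⊢ ∀̇ σ A
    ∃L  : ∀ {Γ σ A C} → A ∷ map (subF wk) Γ ⊢ subF wk C → ∃̇ σ A ∷ Γ ⊢ C
    ∃R  : ∀ {Γ σ A} (t : Tm Δ σ) → Γ ⊢ A [ t ] → Γ ⊢ ∃̇ σ A

    ≐-refl : ∀ {σ} → [] ⊢ ∀̇ σ (var (here refl) ≐ var (here refl))
    -- ∀x,y (A ∧ x ≐ y ⊃ A′).  The first variable of A marks the occurrences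
    -- of x that get replaced; the other two are y and x themselves, so that
    -- further occurrences of x may remain unreplaced.
    ≐-repl : ∀ {σ} {A : Fm (σ ∷ σ ∷ σ ∷ Δ)} → QuantifierFree A →
             let x = var (there (here refl)) ; y = var (here refl) in
             [] ⊢ ∀̇ σ (∀̇ σ (A [ x ] ∧̇ x ≐ y ⊃ A [ y ]))
    Π-eq   : ∀ {σ τ} (x : Tm Δ σ) (y : Tm Δ τ) → [] ⊢ con Πᶜ · x · y ≐ x
    Σ-eq   : ∀ {ρ σ τ} (x : Tm Δ (ρ ⇒ σ ⇒ τ)) (y : Tm Δ (ρ ⇒ σ)) (z : Tm Δ ρ) →
             [] ⊢ con Σᶜ · x · y · z ≐ x · z · (y · z)
    axiom  : ∀ {Ξ} {A : Fm Ξ} → Axiom A → (θ : Sub Ξ Δ) → [] ⊢ subF θ A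

data TType (G : Set) : Set where
  ground : G → TType G
  _⇒_    : TType G → TType G → TType G
  _*     : TType G → TType G

embed : ∀ {G H : Set} → (G → H) → SType G → TType H
embed i (ground X) = ground (i X)
embed i (σ ⇒ τ)    = embed i σ ⇒ embed i τ

mapGround : ∀ {G H : Set} → (G → H) → TType G → TType H
mapGround i (ground X) = ground (i X)
mapGround i (σ ⇒ τ)    = mapGround i σ ⇒ mapGround i τ
mapGround i (σ *)      = mapGround i σ *

-- The ground types of the target language comprise those of the source
-- language, the ground witnessing types (an element of Ground may be both)
-- and possibly others.  Types of L_T mixing these are available as sorts, but
-- nothing is assumed about them: the combinators and the set operations are
-- only required where displayed below.  Likewise a source constant and a
-- witnessing constant of a common type may or may not be the same.  The maps
-- srcGround, witGround and srcConst are the inclusions; their injectivity is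
-- not needed.
record TargetLanguage (L : SourceLanguage) : Set₁ where
  open SourceLanguage L using () renaming (Ground to Groundₛ; Const to Constₛ)

  field
    Ground        : Set
    WitnessGround : Set
    srcGround     : Groundₛ → Ground
    witGround     : WitnessGround → Ground

  SrcType : Set
  SrcType = SType Groundₛ

  WType : Set
  WType = TType WitnessGround

  Type : Set
  Type = TType Ground

  ⌈_⌉ˢ : SrcType → Type
  ⌈ σ ⌉ˢ = embed srcGround σ

  ⌈_⌉ : WType → Type
  ⌈ σ ⌉ = mapGround witGround σ

  field
    Const     : Type → Set
    Rel       : List Type → Set
    srcConst  : ∀ {σ} → Constₛ σ → Const ⌈ σ ⌉ˢ
    e         : ∀ W → Const ⌈ ground W ⌉
    Πᶜ        : ∀ σ τ → Const ⌈ σ ⇒ τ ⇒ σ ⌉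
    Σᶜ        : ∀ ρ σ τ → Const ⌈ (ρ ⇒ σ ⇒ τ) ⇒ (ρ ⇒ σ) ⇒ ρ ⇒ τ ⌉
    singleton : ∀ σ → Const ⌈ σ ⇒ σ * ⌉
    union     : ∀ σ → Const ⌈ σ * ⇒ σ * ⇒ σ * ⌉
    ⋃         : ∀ σ τ → Const ⌈ σ * ⇒ (σ ⇒ τ *) ⇒ τ * ⌉

module Target {L : SourceLanguage} (M : TargetLanguage L) where
  open TargetLanguage M
  open Terms {Type} _⇒_ Const public

  infix  15 _≐_ _ε_
  infixr 14 _∧̇_
  infixr 13 _∨̇_
  infixr 12 _⊃_

  data Fm (Δ : Ctx) : Set where
    rel          : ∀ {σs} → Rel σs → All (Tm Δ) σs → Fm Δ
    _≐_          : ∀ {σ} → Tm Δ σ → Tm Δ σ → Fm Δ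
    _ε_          : ∀ {σ} → Tm Δ ⌈ σ ⌉ → Tm Δ ⌈ σ * ⌉ → Fm Δ
    ⊥̇            : Fm Δ
    _∧̇_ _∨̇_ _⊃_  : Fm Δ → Fm Δ → Fm Δ
    ∀̇ ∃̇          : ∀ σ → Fm (σ ∷ Δ) → Fm Δ

  ⊤̇ : ∀ {Δ} → Fm Δ
  ⊤̇ = ⊥̇ ⊃ ⊥̇

  _⇔̇_ : ∀ {Δ} → Fm Δ → Fm Δ → Fm Δ
  A ⇔̇ B = (A ⊃ B) ∧̇ (B ⊃ A)

  subF : ∀ {Δ Ξ} → Sub Δ Ξ → Fm Δ → Fm Ξ
  subF θ (rel R ts)    = rel R (All.map (sub θ) ts)
  subF θ (s ≐ t)       = sub θ s ≐ sub θ t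
  subF θ (_ε_ {σ} s t) = _ε_ {σ = σ} (sub θ s) (sub θ t)
  subF θ ⊥̇             = ⊥̇
  subF θ (A ∧̇ B)       = subF θ A ∧̇ subF θ B
  subF θ (A ∨̇ B)       = subF θ A ∨̇ subF θ B
  subF θ (A ⊃ B)       = subF θ A ⊃ subF θ B
  subF θ (∀̇ σ A)       = ∀̇ σ (subF (lift θ) A)
  subF θ (∃̇ σ A)       = ∃̇ σ (subF (lift θ) A)

  _[_] : ∀ {Δ σ} → Fm (σ ∷ Δ) → Tm Δ σ → Fm Δ
  A [ t ] = subF (t ∷ ids) A

  -- Prefix of universal quantifiers, the head of Ξ being bound innermost.
  ∀* : ∀ Ξ {Δ} → Fm (Ξ ++ Δ) → Fm Δ
  ∀* []      A = A
  ∀* (σ ∷ Ξ) A = ∀* Ξ (∀̇ σ A)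

  closure : ∀ {Δ} → Fm Δ → Fm []
  closure {[]}    A = A
  closure {σ ∷ Δ} A = closure (∀̇ σ A)

  module Logic (classical : Bool) (Axiom : ∀ {Δ} → Fm Δ → Set) where

    infix 4 _⊢_

    data _⊢_ {Δ : Ctx} (Γ : List (Fm Δ)) : Fm Δ → Set where
      hyp    : ∀ {A} → A ∈ Γ → Γ ⊢ A
      axiom  : ∀ {Ξ} {A : Fm Ξ} → Axiom A → (θ : Sub Ξ Δ) → Γ ⊢ subF θ A
      ⊥E     : ∀ {A} → Γ ⊢ ⊥̇ → Γ ⊢ A
      dne    : ∀ {A} → classical ≡ true → Γ ⊢ (A ⊃ ⊥̇) ⊃ ⊥̇ → Γ ⊢ A
      ∧I     : ∀ {A B} → Γ ⊢ A → Γ ⊢ B → Γ ⊢ A ∧̇ B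
      ∧E₁    : ∀ {A B} → Γ ⊢ A ∧̇ B → Γ ⊢ A
      ∧E₂    : ∀ {A B} → Γ ⊢ A ∧̇ B → Γ ⊢ B
      ∨I₁    : ∀ {A B} → Γ ⊢ A → Γ ⊢ A ∨̇ B
      ∨I₂    : ∀ {A B} → Γ ⊢ B → Γ ⊢ A ∨̇ B
      ∨E     : ∀ {A B C} → Γ ⊢ A ∨̇ B → A ∷ Γ ⊢ C → B ∷ Γ ⊢ C → Γ ⊢ C
      ⊃I     : ∀ {A B} → A ∷ Γ ⊢ B → Γ ⊢ A ⊃ B
      ⊃E     : ∀ {A B} → Γ ⊢ A ⊃ B → Γ ⊢ A → Γ ⊢ B
      ∀I     : ∀ {σ A} → map (subF wk) Γ ⊢ A → Γ ⊢ ∀̇ σ A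
      ∀E     : ∀ {σ A} → Γ ⊢ ∀̇ σ A → (t : Tm Δ σ) → Γ ⊢ A [ t ]
      ∃I     : ∀ {σ A} (t : Tm Δ σ) → Γ ⊢ A [ t ] → Γ ⊢ ∃̇ σ A
      ∃E     : ∀ {σ A C} → Γ ⊢ ∃̇ σ A → A ∷ map (subF wk) Γ ⊢ subF wk C → Γ ⊢ C
      ≐-refl : ∀ {σ} {t : Tm Δ σ} → Γ ⊢ t ≐ t
      ≐-subst : ∀ {σ} (A : Fm (σ ∷ Δ)) {s t : Tm Δ σ} → Γ ⊢ s ≐ t → Γ ⊢ A [ s ] → Γ ⊢ A [ t ]

-- The fields after Axiom say what the theory proves about the combinators and
-- the set operations.  A theory may of course prove more about the types σ *
-- (non-emptiness, finiteness, extensionality), but none of this is required.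
record TargetTheory {L : SourceLanguage} (M : TargetLanguage L) : Set₁ where
  open SourceLanguage L using () renaming (Πᶜ to Πₛ; Σᶜ to Σₛ)
  open TargetLanguage M
  open Target M

  field
    classical : Bool
    Axiom     : ∀ {Δ} → Fm Δ → Set

  open Logic classical Axiom public

  field
    srcΠ-eq : ∀ {Δ} σ τ (x : Tm Δ ⌈ σ ⌉ˢ) (y : Tm Δ ⌈ τ ⌉ˢ) →
              [] ⊢ con (srcConst (Πₛ {σ} {τ})) · x · y ≐ x
    srcΣ-eq : ∀ {Δ} ρ σ τ (x : Tm Δ ⌈ ρ ⇒ σ ⇒ τ ⌉ˢ) (y : Tm Δ ⌈ ρ ⇒ σ ⌉ˢ) (z : Tm Δ ⌈ ρ ⌉ˢ) →
              [] ⊢ con (srcConst (Σₛ {ρ} {σ} {τ})) · x · y · z ≐ x · z · (y · z)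
    Π-eq    : ∀ {Δ} σ τ (x : Tm Δ ⌈ σ ⌉) (y : Tm Δ ⌈ τ ⌉) →
              [] ⊢ con (Πᶜ σ τ) · x · y ≐ x
    Σ-eq    : ∀ {Δ} ρ σ τ (x : Tm Δ ⌈ ρ ⇒ σ ⇒ τ ⌉) (y : Tm Δ ⌈ ρ ⇒ σ ⌉) (z : Tm Δ ⌈ ρ ⌉) →
              [] ⊢ con (Σᶜ ρ σ τ) · x · y · z ≐ x · z · (y · z)

    ε-singleton : ∀ {Δ} σ (x q : Tm Δ ⌈ σ ⌉) →
                  [] ⊢ (_ε_ {σ = σ} x (con (singleton σ) · q)) ⇔̇ (x ≐ q)
    ε-union     : ∀ {Δ} σ (x : Tm Δ ⌈ σ ⌉) (s t : Tm Δ ⌈ σ * ⌉) →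
                  [] ⊢ (_ε_ {σ = σ} x (con (union σ) · s · t)) ⇔̇
                       (_ε_ {σ = σ} x s ∨̇ _ε_ {σ = σ} x t)
    ε-⋃         : ∀ {Δ} σ τ (x : Tm Δ ⌈ τ ⌉) (t : Tm Δ ⌈ σ * ⌉) (q : Tm Δ ⌈ σ ⇒ τ * ⌉) →
                  [] ⊢ (_ε_ {σ = τ} x (con (⋃ σ τ) · t · q)) ⇔̇
                       ∃̇ ⌈ σ ⌉ (_ε_ {σ = σ} (var (here refl)) (ren there t) ∧̇
                                _ε_ {σ = τ} (ren there x) (ren there q · var (here refl)))

module Tuples {L : SourceLanguage} (M : TargetLanguage L) where
  open TargetLanguage M
  open Target M

  infixr 30 _⇒*_ _⇛_
  infix  35 _**

  _⇒*_ : List WType → WType → WType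
  []       ⇒* τ = τ
  (ρ ∷ ρs) ⇒* τ = ρ ⇒ (ρs ⇒* τ)

  _⇛_ : List WType → List WType → List WType
  ρs ⇛ τs = map (ρs ⇒*_) τs

  _** : List WType → List WType
  ρs ** = map _* ρs

  ⌈_⌉* : List WType → Ctx
  ⌈ ρs ⌉* = map ⌈_⌉ ρs

  Tms : Ctx → List WType → Set
  Tms Δ ρs = All (λ ρ → Tm Δ ⌈ ρ ⌉) ρs

  renT : ∀ {Δ Ξ} → (∀ {σ} → σ ∈ Δ → σ ∈ Ξ) → ∀ {ρs} → Tms Δ ρs → Tms Ξ ρs
  renT r ts = All.map (ren r) ts

  -- Closed terms, regarded as terms in any context.
  closed : ∀ {Δ ρs} → Tms [] ρs → Tms Δ ρs
  closed = renT (λ ())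

  apply : ∀ {Δ} ρs {τ} → Tm Δ ⌈ ρs ⇒* τ ⌉ → Tms Δ ρs → Tm Δ ⌈ τ ⌉
  apply []       f []       = f
  apply (ρ ∷ ρs) f (a ∷ as) = apply ρs (f · a) as

  -- Componentwise application: f₁a₁…aₙ , … , fₘa₁…aₙ.
  app : ∀ {Δ} ρs τs → Tms Δ (ρs ⇛ τs) → Tms Δ ρs → Tms Δ τs
  app ρs τs fs as = All.map (λ {τ} f → apply ρs {τ} f as) (map⁻ {xs = τs} fs)

  -- ∀b₁∈B₁ ⋯ ∀bₙ∈Bₙ A, with b₁ bound innermost (the bounds do not depend on
  -- the bound variables).
  ∀∈ : ∀ ρs {Δ} → Tms Δ (ρs **) → Fm (⌈ ρs ⌉* ++ Δ) → Fm Δ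
  ∀∈ []       []       A = A
  ∀∈ (ρ ∷ ρs) (B ∷ Bs) A =
    ∀∈ ρs Bs (∀̇ ⌈ ρ ⌉ (_ε_ {σ = ρ} (var (here refl)) (ren (λ x → there (∈-++⁺ʳ ⌈ ρs ⌉* x)) B) ⊃ A))

module Interpretations {L : SourceLanguage} (M : TargetLanguage L) where
  private
    module S = Source L
    module L = SourceLanguage L
  open TargetLanguage M
  open Target M
  open Tuples M

  -- The context consisting of b (of types N), a (of types P) and Δ.
  ext : List WType → List WType → Ctx → Ctx
  ext P N Δ = ⌈ N ⌉* ++ (⌈ P ⌉* ++ Δ)

  negVars : ∀ P N {Δ} → Tms (ext P N Δ) N
  negVars P N = map⁻ (++⁻ˡ ⌈ N ⌉* ids)

  posVars : ∀ P N {Δ} → Tms (ext P N Δ) P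
  posVars P N = map⁻ (++⁻ˡ ⌈ P ⌉* (++⁻ʳ ⌈ N ⌉* ids))

  baseVars : ∀ P N {Δ} → Sub Δ (ext P N Δ)
  baseVars P N = ++⁻ʳ ⌈ P ⌉* (++⁻ʳ ⌈ N ⌉* ids)

  -- An interpretation ⟨A⟩ᵃ_b of something with free variables Δ: the types pos
  -- of a, the types neg of b, and a formula in these variables.
  record Interp (Δ : Ctx) : Set where
    constructor interp
    field
      pos neg : List WType
      body    : Fm (ext pos neg Δ)

    -- ⟨A(xs)⟩ with as, bs for a, b
    at : ∀ {Ξ} → Sub Δ Ξ → Tms Ξ pos → Tms Ξ neg → Fm Ξ
    at xs as bs = subF (++⁺ (map⁺ bs) (++⁺ (map⁺ as) xs)) body

    -- ∀b∈Bs ⟨A(xs)⟩ with as for a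
    at∀∈ : ∀ {Ξ} → Sub Δ Ξ → Tms Ξ pos → Tms Ξ (neg **) → Fm Ξ
    at∀∈ xs as Bs = ∀∈ neg Bs
      (at (All.map (ren (∈-++⁺ʳ ⌈ neg ⌉*)) xs)
          (renT (∈-++⁺ʳ ⌈ neg ⌉*) as)
          (map⁻ (++⁻ˡ ⌈ neg ⌉* ids)))

  open Interp public

  substᴵ : ∀ {Δ Δ′} → Sub Δ Δ′ → Interp Δ → Interp Δ′
  substᴵ θ I = interp (pos I) (neg I)
    (at I (All.map (sub (baseVars (pos I) (neg I))) θ)
          (posVars (pos I) (neg I)) (negVars (pos I) (neg I)))

  pure : ∀ {Δ} → Fm Δ → Interp Δ
  pure A = interp [] [] A

  _∧ᴵ_ : ∀ {Δ} → Interp Δ → Interp Δ → Interp Δ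
  I ∧ᴵ J = interp P N
    (at I xs (++⁻ˡ (pos I) ac) (++⁻ˡ (neg I) bd) ∧̇
     at J xs (++⁻ʳ (pos I) ac) (++⁻ʳ (neg I) bd))
    where
    P  = pos I ++ pos J
    N  = neg I ++ neg J
    xs = baseVars P N
    ac = posVars P N
    bd = negVars P N

  _→ᴵ_ : ∀ {Δ} → Interp Δ → Interp Δ → Interp Δ
  _→ᴵ_ {Δ} I J = interp P N
    (at∀∈ I xs a (app (neg J) (neg I **) (app (pos I) (neg J ⇛ neg I **) g a) d) ⊃
     at J xs (app (pos I) (pos J) f a) d)
    where
    P  = (pos I ⇛ pos J) ++ (pos I ⇛ neg J ⇛ neg I **)
    N  = pos I ++ neg J
    xs = baseVars P N

    f : Tms (ext P N Δ) (pos I ⇛ pos J)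
    f = ++⁻ˡ (pos I ⇛ pos J) (posVars P N)

    g : Tms (ext P N Δ) (pos I ⇛ neg J ⇛ neg I **)
    g = ++⁻ʳ (pos I ⇛ pos J) (posVars P N)

    a : Tms (ext P N Δ) (pos I)
    a = ++⁻ˡ (pos I) (negVars P N)

    d : Tms (ext P N Δ) (neg J)
    d = ++⁻ʳ (pos I) (negVars P N)

  ∀ᴵ : ∀ {Δ} σ → Interp (σ ∷ Δ) → Interp Δ
  ∀ᴵ σ I = interp (pos I) (neg I)
    (∀̇ σ (at I (lift (baseVars (pos I) (neg I)))
               (renT there (posVars (pos I) (neg I)))
               (renT there (negVars (pos I) (neg I)))))

  ∃ᴵ : ∀ {Δ} σ → Interp (σ ∷ Δ) → Interp Δ
  ∃ᴵ σ I = interp (pos I) (neg I **)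
    (∃̇ σ (at∀∈ I (lift (baseVars (pos I) (neg I **)))
                 (renT there (posVars (pos I) (neg I **)))
                 (renT there (negVars (pos I) (neg I **)))))

  ⌈_⌉ᶜ : S.Ctx → Ctx
  ⌈ Δ ⌉ᶜ = map ⌈_⌉ˢ Δ

  ⌈_⌉ᵗ : ∀ {Δ σ} → S.Tm Δ σ → Tm ⌈ Δ ⌉ᶜ ⌈ σ ⌉ˢ
  ⌈ S.var x ⌉ᵗ = var (∈-map⁺ ⌈_⌉ˢ x)
  ⌈ S.con c ⌉ᵗ = con (srcConst c)
  ⌈ t S.· u ⌉ᵗ = ⌈ t ⌉ᵗ · ⌈ u ⌉ᵗ

  BaseInterpretation : Set
  BaseInterpretation = ∀ {σs} → L.Rel σs → Interp ⌈ σs ⌉ᶜ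

  module Uniform (base : BaseInterpretation) where

    ⟨_⟩ : ∀ {Δ} → S.Fm Δ → Interp ⌈ Δ ⌉ᶜ
    ⟨ S.rel R ts ⟩ = substᴵ (map⁺ (All.map ⌈_⌉ᵗ ts)) (base R)
    ⟨ s S.≐ t ⟩    = pure (⌈ s ⌉ᵗ ≐ ⌈ t ⌉ᵗ)
    ⟨ S.⊥̇ ⟩        = pure ⊥̇
    ⟨ A S.∧̇ B ⟩    = ⟨ A ⟩ ∧ᴵ ⟨ B ⟩
    ⟨ A S.⊃ B ⟩    = ⟨ A ⟩ →ᴵ ⟨ B ⟩
    ⟨ S.∀̇ σ A ⟩    = ∀ᴵ ⌈ σ ⌉ˢ ⟨ A ⟩
    ⟨ S.∃̇ σ A ⟩    = ∃ᴵ ⌈ σ ⌉ˢ ⟨ A ⟩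

    -- The types of a = a₁,…,aₙ for Γ = B₁,…,Bₙ.
    posᴸ : ∀ {Δ} → List (S.Fm Δ) → List WType
    posᴸ Γ = concatMap (λ B → pos ⟨ B ⟩) Γ

    -- The conjunction of the ∀bᵢ∈Sᵢ ⟨Bᵢ(xs)⟩ with asᵢ for aᵢ.
    premises : ∀ {Δ Ξ} → Sub ⌈ Δ ⌉ᶜ Ξ → (Γ : List (S.Fm Δ)) →
               Tms Ξ (posᴸ Γ) → All (λ B → Tms Ξ (neg ⟨ B ⟩ **)) Γ → Fm Ξ
    premises xs []      as []       = ⊤̇
    premises xs (B ∷ Γ) as (S ∷ Ss) =
      at∀∈ ⟨ B ⟩ xs (++⁻ˡ (pos ⟨ B ⟩) as) S ∧̇ premises xs Γ (++⁻ʳ (pos ⟨ B ⟩) as) Ss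

    module _ (T : TargetTheory M) where
      open TargetTheory T

      Interpretable : ∀ {Δ} → S.Fm Δ → Set
      Interpretable A =
        let I = ⟨ A ⟩ in
        Σ[ t ∈ Tms [] (pos I) ]
          [] ⊢ ∀* ⌈ neg I ⌉* (at I (++⁻ʳ ⌈ neg I ⌉* ids) (closed t) (map⁻ (++⁻ˡ ⌈ neg I ⌉* ids)))

      Sound : SourceTheory L → Set
      Sound S = ∀ {Δ} {A : S.Fm Δ} → SourceTheory.Axiom S A → Interpretable A

      -- For all x, a and d: if ∀b∈sad ⟨Γ(x)⟩ᵃ_b then ⟨A(x)⟩ᵗᵃ_d.
      SequentFormula : ∀ {Δ} (Γ : List (S.Fm Δ)) (A : S.Fm Δ) →
                       All (λ B → Tms [] (posᴸ Γ ⇛ neg ⟨ A ⟩ ⇛ neg ⟨ B ⟩ **)) Γ →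
                       Tms [] (posᴸ Γ ⇛ pos ⟨ A ⟩) → Fm []
      SequentFormula {Δ} Γ A s t =
        closure {⌈ Δ ⌉ᶜ} (∀* ⌈ P ⌉* (∀* ⌈ N ⌉*
          (premises xs Γ a (All.map (λ {B} sᵢ → bound B (closed sᵢ)) s) ⊃
           at ⟨ A ⟩ xs (app P (pos ⟨ A ⟩) (closed t) a) d)))
        where
        P = posᴸ Γ
        N = neg ⟨ A ⟩
        Ξ = ext P N ⌈ Δ ⌉ᶜ

        xs : Sub ⌈ Δ ⌉ᶜ Ξ
        xs = baseVars P N

        a : Tms Ξ P
        a = posVars P N

        d : Tms Ξ N
        d = negVars P N

        bound : ∀ B → Tms Ξ (P ⇛ N ⇛ neg ⟨ B ⟩ **) → Tms Ξ (neg ⟨ B ⟩ **)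
        bound B sᵢ = app N (neg ⟨ B ⟩ **) (app P (N ⇛ neg ⟨ B ⟩ **) sᵢ a) d

{-# OPTIONS --safe #-}

-- Interpretations of formulas in a fixed context form a category, with I ⊩ J given by witnesses
-- for J depending on those for I, together with finite sets of challenges to I that suffice to
-- answer a given challenge to J.  The Diller–Nahm style ∀b∈gad in the implication makes it behave
-- as a cartesian closed category, with ∀ᴵ and ∃ᴵ adjoint to weakening; composition needs ⋃,
-- pairing (that is, contraction) needs ∪, and projections (that is, weakening) need the inhabitants
-- built from the constants e.  As ⟨A[t]⟩ equals ⟨A⟩ under the corresponding substitution, every
-- rule of the sequent calculus becomes a composite of these operations.  Bracket abstraction turns
-- the resulting open witnessing terms into closed ones.

module Submission where

open import Defs
open import Data.List.Base using (List; []; _∷_; _++_; map; concatMap)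
open import Data.List.Membership.Propositional using (_∈_)
open import Data.List.Membership.Propositional.Properties using (∈-map⁺; ∈-++⁺ʳ)
import Data.List.Properties as List
open import Data.List.Relation.Binary.Subset.Propositional using (_⊆_)
import Data.List.Relation.Binary.Subset.Propositional.Properties as Subset
open import Data.List.Relation.Unary.All as All using (All; []; _∷_)
open import Data.List.Relation.Unary.All.Properties
  using (map⁺; map⁻; ++⁺; ++⁻ˡ; ++⁻ʳ; lookup-map; map-∘; map-cong; map-id)
open import Data.List.Relation.Unary.Any using (here; there)
open import Data.Product.Base using (Σ-syntax; _×_; _,_)
open import Relation.Binary.PropositionalEquality
  using (_≡_; refl; sym; trans; cong; cong₂; subst; subst₂; module ≡-Reasoning)

-- Realizers mention only witnesses and challenges, never the variables `xs` of the interpreted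
-- formula. Because of this uniformity the quantifier rules hardly touch the realizers, a realizer
-- of an axiom serves for all its substitution instances, and substitution preserves the tuple
-- types, so that it can be handled by equalities between interpretations. Two obstacles shape the
-- rest. T is not assumed to prove that its sets have members, so from a bounded statement about a
-- conjunction one half can be extracted only after a member of the bounds for the other half has
-- been exhibited; default challenges provide it. And the left rule for ∃ carries side formulas, for
-- which the adjunction `∃-elim` has no room; the exponential moves them to the other side and back.
-- Validity is phrased over all contexts and hypotheses, in Kripke style. Object-level quantifiers
-- are therefore met only in the introduction and elimination principles for `Holds` and `Holds∀∈`,
-- and the categorical operations compose at the meta-level.

-- Splitting, joining and mapping tuples.

module _ {A : Set} {P : A → Set} where

  lookup-ext : ∀ {xs} {p q : All P xs} → (∀ {x} (i : x ∈ xs) → All.lookup p i ≡ All.lookup q i) → p ≡ q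
  lookup-ext {p = []}    {[]}    h = refl
  lookup-ext {p = _ ∷ _} {_ ∷ _} h = cong₂ _∷_ (h (here refl)) (lookup-ext λ i → h (there i))

  lookup-tabulate : ∀ {xs} (f : ∀ {x} → x ∈ xs → P x) {x} (i : x ∈ xs) →
                    All.lookup (All.tabulate f) i ≡ f i
  lookup-tabulate f (here refl) = refl
  lookup-tabulate f (there i)   = lookup-tabulate (λ j → f (there j)) i

  lookup-++⁺ʳ : ∀ {xs ys} (p : All P xs) (q : All P ys) {x} (i : x ∈ ys) →
                All.lookup (++⁺ p q) (∈-++⁺ʳ xs i) ≡ All.lookup q i
  lookup-++⁺ʳ []      q i = refl
  lookup-++⁺ʳ (_ ∷ p) q i = lookup-++⁺ʳ p q i

  lookup-++⁻ʳ : ∀ xs {ys} (p : All P (xs ++ ys)) {x} (i : x ∈ ys) →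
                All.lookup (++⁻ʳ xs p) i ≡ All.lookup p (∈-++⁺ʳ xs i)
  lookup-++⁻ʳ []       p       i = refl
  lookup-++⁻ʳ (_ ∷ xs) (_ ∷ p) i = lookup-++⁻ʳ xs p i

  ++⁻ˡ-++⁺ : ∀ {xs ys} (p : All P xs) (q : All P ys) → ++⁻ˡ xs (++⁺ p q) ≡ p
  ++⁻ˡ-++⁺ []      q = refl
  ++⁻ˡ-++⁺ (_ ∷ p) q = cong (_ ∷_) (++⁻ˡ-++⁺ p q)

  ++⁻ʳ-++⁺ : ∀ {xs ys} (p : All P xs) (q : All P ys) → ++⁻ʳ xs (++⁺ p q) ≡ q
  ++⁻ʳ-++⁺ []      q = refl
  ++⁻ʳ-++⁺ (_ ∷ p) q = ++⁻ʳ-++⁺ p q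

module _ {A : Set} {P Q : A → Set} (f : ∀ {x} → P x → Q x) where

  map-++⁺ : ∀ {xs ys} (p : All P xs) (q : All P ys) →
            All.map f (++⁺ p q) ≡ ++⁺ (All.map f p) (All.map f q)
  map-++⁺ []      q = refl
  map-++⁺ (_ ∷ p) q = cong (_ ∷_) (map-++⁺ p q)

  map-++⁻ˡ : ∀ xs {ys} (p : All P (xs ++ ys)) → All.map f (++⁻ˡ xs p) ≡ ++⁻ˡ xs (All.map f p)
  map-++⁻ˡ []       p       = refl
  map-++⁻ˡ (_ ∷ xs) (_ ∷ p) = cong (_ ∷_) (map-++⁻ˡ xs p)

  map-++⁻ʳ : ∀ xs {ys} (p : All P (xs ++ ys)) → All.map f (++⁻ʳ xs p) ≡ ++⁻ʳ xs (All.map f p)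
  map-++⁻ʳ []       p       = refl
  map-++⁻ʳ (_ ∷ xs) (_ ∷ p) = map-++⁻ʳ xs p

  map-tabulate : ∀ {xs} (g : ∀ {x} → x ∈ xs → P x) →
                 All.map f (All.tabulate g) ≡ All.tabulate (λ i → f (g i))
  map-tabulate {[]}     g = refl
  map-tabulate {_ ∷ xs} g = cong (_ ∷_) (map-tabulate (λ i → g (there i)))

module _ {A B : Set} {P : A → Set} {h : B → A} where

  map⁻-map⁺ : ∀ {xs} (p : All (λ x → P (h x)) xs) → map⁻ (map⁺ {P = P} {f = h} p) ≡ p
  map⁻-map⁺ []      = refl
  map⁻-map⁺ (_ ∷ p) = cong (_ ∷_) (map⁻-map⁺ p)

  lookup-map⁺ : ∀ {xs} (p : All (λ x → P (h x)) xs) {x} (i : x ∈ xs) →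
                All.lookup (map⁺ {P = P} {f = h} p) (∈-map⁺ h i) ≡ All.lookup p i
  lookup-map⁺ (_ ∷ p) (here refl) = refl
  lookup-map⁺ (_ ∷ p) (there i)   = lookup-map⁺ p i

module _ {A B : Set} {P Q : A → Set} {h : B → A} (f : ∀ {x} → P x → Q x) where

  map-map⁺ : ∀ {xs} (p : All (λ x → P (h x)) xs) →
             All.map f (map⁺ {P = P} {f = h} p) ≡ map⁺ (All.map f p)
  map-map⁺ []      = refl
  map-map⁺ (_ ∷ p) = cong (_ ∷_) (map-map⁺ p)

  map-map⁻ : ∀ {xs} (p : All P (map h xs)) → All.map f (map⁻ {f = h} p) ≡ map⁻ (All.map f p)
  map-map⁻ {[]}     []      = refl
  map-map⁻ {_ ∷ xs} (_ ∷ p) = cong (_ ∷_) (map-map⁻ p)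

-- Renaming and substitution in terms, for both languages.

module TermLemmas {Ty : Set} (_⇒_ : Ty → Ty → Ty) (Con : Ty → Set) where
  open Terms _⇒_ Con

  lookup-ids : ∀ {Δ σ} (x : σ ∈ Δ) → All.lookup ids x ≡ var x
  lookup-ids = lookup-tabulate var

  wk≡tabulate : ∀ {σ Δ} → wk {σ} {Δ} ≡ All.tabulate (λ x → var (there x))
  wk≡tabulate = map-tabulate (ren there) var

  lookup-wk : ∀ {σ Δ τ} (x : τ ∈ Δ) → All.lookup (wk {σ}) x ≡ var (there x)
  lookup-wk x = trans (lookup-map ids x) (cong (ren there) (lookup-ids x))

  ren≡sub : ∀ {Δ Ξ} {r : ∀ {σ} → σ ∈ Δ → σ ∈ Ξ} {θ : Sub Δ Ξ} →
            (∀ {σ} (x : σ ∈ Δ) → All.lookup θ x ≡ var (r x)) → ∀ {σ} (t : Tm Δ σ) → ren r t ≡ sub θ t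
  ren≡sub h (var x) = sym (h x)
  ren≡sub h (con c) = refl
  ren≡sub h (t · u) = cong₂ _·_ (ren≡sub h t) (ren≡sub h u)

  ren-ren : ∀ {Δ Ξ Ψ} {r : ∀ {σ} → σ ∈ Δ → σ ∈ Ξ} {s : ∀ {σ} → σ ∈ Ξ → σ ∈ Ψ} {q : ∀ {σ} → σ ∈ Δ → σ ∈ Ψ} →
            (∀ {σ} (x : σ ∈ Δ) → s (r x) ≡ q x) → ∀ {σ} (t : Tm Δ σ) → ren s (ren r t) ≡ ren q t
  ren-ren h (var x) = cong var (h x)
  ren-ren h (con c) = refl
  ren-ren h (t · u) = cong₂ _·_ (ren-ren h t) (ren-ren h u)

  sub-ren : ∀ {Δ Ξ Ψ} {r : ∀ {σ} → σ ∈ Δ → σ ∈ Ξ} {θ : Sub Ξ Ψ} {η : Sub Δ Ψ} →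
            (∀ {σ} (x : σ ∈ Δ) → All.lookup θ (r x) ≡ All.lookup η x) →
            ∀ {σ} (t : Tm Δ σ) → sub θ (ren r t) ≡ sub η t
  sub-ren h (var x) = h x
  sub-ren h (con c) = refl
  sub-ren h (t · u) = cong₂ _·_ (sub-ren h t) (sub-ren h u)

  ren-sub : ∀ {Δ Ξ Ψ} (r : ∀ {σ} → σ ∈ Ξ → σ ∈ Ψ) (θ : Sub Δ Ξ) {σ} (t : Tm Δ σ) →
            ren r (sub θ t) ≡ sub (All.map (ren r) θ) t
  ren-sub r θ (var x) = sym (lookup-map θ x)
  ren-sub r θ (con c) = refl
  ren-sub r θ (t · u) = cong₂ _·_ (ren-sub r θ t) (ren-sub r θ u)

  sub-sub : ∀ {Δ Ξ Ψ} (θ : Sub Ξ Ψ) (η : Sub Δ Ξ) {σ} (t : Tm Δ σ) →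
            sub θ (sub η t) ≡ sub (All.map (sub θ) η) t
  sub-sub θ η (var x) = sym (lookup-map η x)
  sub-sub θ η (con c) = refl
  sub-sub θ η (t · u) = cong₂ _·_ (sub-sub θ η t) (sub-sub θ η u)

  sub-ids : ∀ {Δ σ} (t : Tm Δ σ) → sub ids t ≡ t
  sub-ids (var x) = lookup-ids x
  sub-ids (con c) = refl
  sub-ids (t · u) = cong₂ _·_ (sub-ids t) (sub-ids u)

  ren-wk : ∀ {Δ σ τ} (t : Tm Δ σ) → ren there t ≡ sub (wk {τ}) t
  ren-wk = ren≡sub lookup-wk

  ren-++ : ∀ Ξ {Δ σ} (t : Tm Δ σ) → ren (∈-++⁺ʳ Ξ) t ≡ sub (++⁻ʳ Ξ ids) t
  ren-++ Ξ = ren≡sub λ x → trans (lookup-++⁻ʳ Ξ ids x) (lookup-ids (∈-++⁺ʳ Ξ x))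

  sub-there : ∀ {Δ Ξ σ τ} (u : Tm Ξ τ) (θ : Sub Δ Ξ) (t : Tm Δ σ) → sub (u ∷ θ) (ren there t) ≡ sub θ t
  sub-there u θ = sub-ren λ x → refl

  sub-there-ids : ∀ {Δ σ τ} (u : Tm Δ τ) (t : Tm Δ σ) → sub (u ∷ ids) (ren there t) ≡ t
  sub-there-ids u t = trans (sub-there u ids t) (sub-ids t)

  sub-lift-there : ∀ {Δ Ξ σ τ} (θ : Sub Δ Ξ) (t : Tm Δ σ) →
                   sub (lift {τ} θ) (ren there t) ≡ ren there (sub θ t)
  sub-lift-there θ t = trans (sub-ren (λ x → refl) t) (sym (ren-sub there θ t))

  module _ {B : Set} {f : B → Ty} where

    map-sub-sub : ∀ {Δ Ξ Ψ} (θ : Sub Ξ Ψ) (η : Sub Δ Ξ) {bs} (ts : All (λ b → Tm Δ (f b)) bs) →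
                  All.map (sub θ) (All.map (sub η) ts) ≡ All.map (sub (All.map (sub θ) η)) ts
    map-sub-sub θ η ts = trans (map-∘ ts) (map-cong ts (sub-sub θ η))

    map-sub-ids : ∀ {Δ bs} (ts : All (λ b → Tm Δ (f b)) bs) → All.map (sub ids) ts ≡ ts
    map-sub-ids ts = trans (map-cong ts sub-ids) (map-id ts)

    map-sub-there : ∀ {Δ Ξ τ} (u : Tm Ξ τ) (θ : Sub Δ Ξ) {bs} (ts : All (λ b → Tm Δ (f b)) bs) →
                    All.map (sub (u ∷ θ)) (All.map (ren there) ts) ≡ All.map (sub θ) ts
    map-sub-there u θ ts = trans (map-∘ ts) (map-cong ts (sub-there u θ))

    map-sub-lift-there : ∀ {Δ Ξ τ} (θ : Sub Δ Ξ) {bs} (ts : All (λ b → Tm Δ (f b)) bs) →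
                         All.map (sub (lift {τ} θ)) (All.map (ren there) ts) ≡
                         All.map (ren there) (All.map (sub θ) ts)
    map-sub-lift-there θ ts = trans (map-∘ ts) (trans (map-cong ts (sub-lift-there θ)) (sym (map-∘ ts)))

    map-ren-sub : ∀ {Δ Ξ Ψ} (r : ∀ {σ} → σ ∈ Ξ → σ ∈ Ψ) (θ : Sub Δ Ξ) {bs} (ts : All (λ b → Tm Δ (f b)) bs) →
                  All.map (ren r) (All.map (sub θ) ts) ≡ All.map (sub (All.map (ren r) θ)) ts
    map-ren-sub r θ ts = trans (map-∘ ts) (map-cong ts (ren-sub r θ))

    map-ren-wk : ∀ {Δ τ bs} (ts : All (λ b → Tm Δ (f b)) bs) →
                 All.map (ren there) ts ≡ All.map (sub (wk {τ})) ts
    map-ren-wk ts = map-cong ts ren-wk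

    map-ren-++ : ∀ Ξ {Δ bs} (ts : All (λ b → Tm Δ (f b)) bs) →
                 All.map (ren (∈-++⁺ʳ Ξ)) ts ≡ All.map (sub (++⁻ʳ Ξ ids)) ts
    map-ren-++ Ξ ts = map-cong ts (ren-++ Ξ)

  map-ids : ∀ {Δ Ξ} (θ : Sub Δ Ξ) → All.map (sub θ) ids ≡ θ
  map-ids θ = lookup-ext λ x → trans (lookup-map ids x) (cong (sub θ) (lookup-ids x))

  map-wk : ∀ {Δ Ξ σ} (u : Tm Ξ σ) (θ : Sub Δ Ξ) → All.map (sub (u ∷ θ)) wk ≡ θ
  map-wk u θ = trans (map-sub-there u θ ids) (map-ids θ)

  lift-ids : ∀ {Δ σ} → lift {σ} (ids {Δ}) ≡ ids
  lift-ids = cong (_ ∷_) wk≡tabulate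

  lift-∘ : ∀ {Δ Ξ Ψ σ} (θ : Sub Ξ Ψ) (η : Sub Δ Ξ) →
           All.map (sub (lift {σ} θ)) (lift η) ≡ lift (All.map (sub θ) η)
  lift-∘ θ η = cong (_ ∷_) (map-sub-lift-there θ η)

  liftN : ∀ Φ {Δ Ξ} → Sub Δ Ξ → Sub (Φ ++ Δ) (Φ ++ Ξ)
  liftN []      θ = θ
  liftN (σ ∷ Φ) θ = lift (liftN Φ θ)

  liftN-left : ∀ Φ {Δ Ξ} (θ : Sub Δ Ξ) → ++⁻ˡ Φ (liftN Φ θ) ≡ ++⁻ˡ Φ ids
  liftN-left []      θ = refl
  liftN-left (σ ∷ Φ) θ = cong (_ ∷_) (begin
    ++⁻ˡ Φ (All.map (ren there) (liftN Φ θ)) ≡⟨ map-++⁻ˡ (ren there) Φ (liftN Φ θ) ⟨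
    All.map (ren there) (++⁻ˡ Φ (liftN Φ θ)) ≡⟨ cong (All.map (ren there)) (liftN-left Φ θ) ⟩
    All.map (ren there) (++⁻ˡ Φ ids)         ≡⟨ map-++⁻ˡ (ren there) Φ ids ⟩
    ++⁻ˡ Φ wk                                ≡⟨ cong (++⁻ˡ Φ) wk≡tabulate ⟩
    ++⁻ˡ Φ (All.tabulate (λ x → var (there x))) ∎)
    where open ≡-Reasoning

  sub-liftN-++ : ∀ Φ {Δ Ξ} (θ : Sub Δ Ξ) {σ} (t : Tm Δ σ) →
                 sub (liftN Φ θ) (ren (∈-++⁺ʳ Φ) t) ≡ ren (∈-++⁺ʳ Φ) (sub θ t)
  sub-liftN-++ Φ θ t = trans (sub-ren (λ x → trans (eq Φ x) (sym (lookup-map θ x))) t) (sym (ren-sub (∈-++⁺ʳ Φ) θ t))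
    where
    eq : ∀ Φ {σ} (x : σ ∈ _) → All.lookup (liftN Φ θ) (∈-++⁺ʳ Φ x) ≡ ren (∈-++⁺ʳ Φ) (All.lookup θ x)
    eq []      x = trans (sym (sub-ids (All.lookup θ x))) (sym (ren≡sub lookup-ids (All.lookup θ x)))
    eq (σ ∷ Φ) x = trans (lookup-map (liftN Φ θ) (∈-++⁺ʳ Φ x))
      (trans (cong (ren there) (eq Φ x)) (ren-ren (λ y → refl) (All.lookup θ x)))

  sub-++ : ∀ {Φ Δ Ξ} (η : Sub Φ Ξ) (θ : Sub Δ Ξ) {σ} (t : Tm Δ σ) →
           sub (++⁺ η θ) (ren (∈-++⁺ʳ Φ) t) ≡ sub θ t
  sub-++ η θ = sub-ren (lookup-++⁺ʳ η θ)

  map-sub-++ : ∀ {B : Set} {f : B → Ty} {Φ Δ Ξ} (η : Sub Φ Ξ) (θ : Sub Δ Ξ) {bs} (ts : All (λ b → Tm Δ (f b)) bs) →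
               All.map (sub (++⁺ η θ)) (All.map (ren (∈-++⁺ʳ Φ)) ts) ≡ All.map (sub θ) ts
  map-sub-++ η θ ts = trans (map-∘ ts) (map-cong ts (sub-++ η θ))

-- Substitution in target formulas and in interpretations.

module InterpretationLemmas {L : SourceLanguage} (M : TargetLanguage L) where
  open TargetLanguage M
  open Target M
  open Tuples M
  open Interpretations M
  open TermLemmas {Type} _⇒_ Const

  subF-∘ : ∀ {Δ Ξ Ψ} (θ : Sub Ξ Ψ) (η : Sub Δ Ξ) (A : Fm Δ) →
           subF θ (subF η A) ≡ subF (All.map (sub θ) η) A
  subF-∘ θ η (rel R ts)    = cong (rel R) (map-sub-sub θ η ts)
  subF-∘ θ η (s ≐ t)       = cong₂ _≐_ (sub-sub θ η s) (sub-sub θ η t)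
  subF-∘ θ η (_ε_ {σ} s t) = cong₂ (_ε_ {σ = σ}) (sub-sub θ η s) (sub-sub θ η t)
  subF-∘ θ η ⊥̇             = refl
  subF-∘ θ η (A ∧̇ B)       = cong₂ _∧̇_ (subF-∘ θ η A) (subF-∘ θ η B)
  subF-∘ θ η (A ∨̇ B)       = cong₂ _∨̇_ (subF-∘ θ η A) (subF-∘ θ η B)
  subF-∘ θ η (A ⊃ B)       = cong₂ _⊃_ (subF-∘ θ η A) (subF-∘ θ η B)
  subF-∘ θ η (∀̇ σ A)       = cong (∀̇ σ) (trans (subF-∘ (lift θ) (lift η) A) (cong (λ ζ → subF ζ A) (lift-∘ θ η)))
  subF-∘ θ η (∃̇ σ A)       = cong (∃̇ σ) (trans (subF-∘ (lift θ) (lift η) A) (cong (λ ζ → subF ζ A) (lift-∘ θ η)))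

  subF-ids : ∀ {Δ} (A : Fm Δ) → subF ids A ≡ A
  subF-ids (rel R ts)    = cong (rel R) (map-sub-ids ts)
  subF-ids (s ≐ t)       = cong₂ _≐_ (sub-ids s) (sub-ids t)
  subF-ids (_ε_ {σ} s t) = cong₂ (_ε_ {σ = σ}) (sub-ids s) (sub-ids t)
  subF-ids ⊥̇             = refl
  subF-ids (A ∧̇ B)       = cong₂ _∧̇_ (subF-ids A) (subF-ids B)
  subF-ids (A ∨̇ B)       = cong₂ _∨̇_ (subF-ids A) (subF-ids B)
  subF-ids (A ⊃ B)       = cong₂ _⊃_ (subF-ids A) (subF-ids B)
  subF-ids (∀̇ σ A)       = cong (∀̇ σ) (trans (cong (λ ζ → subF ζ A) lift-ids) (subF-ids A))
  subF-ids (∃̇ σ A)       = cong (∃̇ σ) (trans (cong (λ ζ → subF ζ A) lift-ids) (subF-ids A))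

  subF-∷-lift : ∀ {Δ Ξ Ψ σ} (t : Tm Ψ σ) (η : Sub Ξ Ψ) (θ : Sub Δ Ξ) (A : Fm (σ ∷ Δ)) →
                subF (t ∷ η) (subF (lift θ) A) ≡ subF (t ∷ All.map (sub η) θ) A
  subF-∷-lift t η θ A = trans (subF-∘ (t ∷ η) (lift θ) A) (cong (λ ζ → subF (t ∷ ζ) A) (map-sub-there t η θ))

  subF-lift-[] : ∀ {Δ Ξ σ} (θ : Sub Δ Ξ) (A : Fm (σ ∷ Δ)) (t : Tm Ξ σ) →
                 subF (lift θ) A [ t ] ≡ subF (t ∷ θ) A
  subF-lift-[] θ A t = trans (subF-∷-lift t ids θ A) (cong (λ ζ → subF (t ∷ ζ) A) (map-sub-ids θ))

  subF-[] : ∀ {Δ Ξ σ} (θ : Sub Δ Ξ) (A : Fm (σ ∷ Δ)) (t : Tm Δ σ) →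
            subF θ (A [ t ]) ≡ subF (lift θ) A [ sub θ t ]
  subF-[] θ A t = trans (subF-∘ θ (t ∷ ids) A)
    (trans (cong (λ ζ → subF (sub θ t ∷ ζ) A) (map-ids θ)) (sym (subF-lift-[] θ A (sub θ t))))

  subF-lift-wk : ∀ {Δ Ξ σ} (θ : Sub Δ Ξ) (A : Fm Δ) → subF (lift {σ} θ) (subF wk A) ≡ subF wk (subF θ A)
  subF-lift-wk θ A = trans (subF-∘ (lift θ) wk A)
    (trans (cong (λ ζ → subF ζ A) (trans (map-wk _ (All.map (ren there) θ)) (map-ren-wk θ))) (sym (subF-∘ wk θ A)))

  subT : ∀ {Δ Ξ} → Sub Δ Ξ → ∀ {ρs} → Tms Δ ρs → Tms Ξ ρs
  subT θ ts = All.map (sub θ) ts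

  vars : ∀ ρs {Δ} → Tms (⌈ ρs ⌉* ++ Δ) ρs
  vars ρs = map⁻ (++⁻ˡ ⌈ ρs ⌉* ids)

  wkN : ∀ Φ {Δ} → Sub Δ (Φ ++ Δ)
  wkN Φ = ++⁻ʳ Φ ids

  subT-vars : ∀ ρs {Δ Ξ} (θ : Sub (⌈ ρs ⌉* ++ Δ) Ξ) → subT θ (vars ρs) ≡ map⁻ (++⁻ˡ ⌈ ρs ⌉* θ)
  subT-vars ρs θ = trans (map-map⁻ (sub θ) (++⁻ˡ ⌈ ρs ⌉* ids))
    (cong map⁻ (trans (map-++⁻ˡ (sub θ) ⌈ ρs ⌉* ids) (cong (++⁻ˡ ⌈ ρs ⌉*) (map-ids θ))))

  wkN-∷ : ∀ {Δ} σ Φ → All.map (sub wk) (wkN Φ {Δ}) ≡ wkN (σ ∷ Φ)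
  wkN-∷ σ Φ = trans (sym (map-ren-wk (wkN Φ))) (trans (map-++⁻ʳ (ren there) Φ ids) (cong (++⁻ʳ Φ) wk≡tabulate))

  vars-∷ : ∀ {Δ} ρ ρs → subT wk (vars ρs {Δ}) ≡ All.tail (vars (ρ ∷ ρs))
  vars-∷ ρ ρs = trans (subT-vars ρs wk) (cong (λ θ → map⁻ (++⁻ˡ ⌈ ρs ⌉* θ)) wk≡tabulate)

  subT-vars-++ : ∀ ρs {Δ Ξ} (bs : Tms Ξ ρs) (θ : Sub Δ Ξ) → subT (++⁺ (map⁺ bs) θ) (vars ρs) ≡ bs
  subT-vars-++ ρs bs θ = trans (subT-vars ρs _) (trans (cong map⁻ (++⁻ˡ-++⁺ (map⁺ bs) θ)) (map⁻-map⁺ bs))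

  map-wkN : ∀ {Φ Δ Ξ} (η : Sub Φ Ξ) (θ : Sub Δ Ξ) → All.map (sub (++⁺ η θ)) (wkN Φ) ≡ θ
  map-wkN {Φ} η θ = trans (map-++⁻ʳ _ Φ ids) (trans (cong (++⁻ʳ Φ) (map-ids (++⁺ η θ))) (++⁻ʳ-++⁺ η θ))

  module _ {Δ Ξ : Ctx} (P N : List WType) (bs : Tms Ξ N) (as : Tms Ξ P) (xs : Sub Δ Ξ) where
    private
      θ : Sub (ext P N Δ) Ξ
      θ = ++⁺ (map⁺ bs) (++⁺ (map⁺ as) xs)

      right : All.map (sub θ) (++⁻ʳ ⌈ N ⌉* ids) ≡ ++⁺ (map⁺ as) xs
      right = map-wkN (map⁺ bs) (++⁺ (map⁺ as) xs)

    sub-negVars : subT θ (negVars P N) ≡ bs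
    sub-negVars = subT-vars-++ N bs (++⁺ (map⁺ as) xs)

    sub-posVars : subT θ (posVars P N) ≡ as
    sub-posVars = trans (map-map⁻ (sub θ) (++⁻ˡ ⌈ P ⌉* (++⁻ʳ ⌈ N ⌉* ids)))
      (trans (cong map⁻ (trans (map-++⁻ˡ (sub θ) ⌈ P ⌉* (++⁻ʳ ⌈ N ⌉* ids))
        (trans (cong (++⁻ˡ ⌈ P ⌉*) right) (++⁻ˡ-++⁺ (map⁺ as) xs))))
        (map⁻-map⁺ as))

    sub-baseVars : All.map (sub θ) (baseVars P N) ≡ xs
    sub-baseVars = trans (map-++⁻ʳ (sub θ) ⌈ P ⌉* (++⁻ʳ ⌈ N ⌉* ids))
      (trans (cong (++⁻ʳ ⌈ P ⌉*) right) (++⁻ʳ-++⁺ (map⁺ as) xs))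

  subF-∀∈ : ∀ ρs {Δ Ξ} (θ : Sub Δ Ξ) (Bs : Tms Δ (ρs **)) (A : Fm (⌈ ρs ⌉* ++ Δ)) →
            subF θ (∀∈ ρs Bs A) ≡ ∀∈ ρs (subT θ Bs) (subF (liftN ⌈ ρs ⌉* θ) A)
  subF-∀∈ []       θ []       A = refl
  subF-∀∈ (ρ ∷ ρs) θ (B ∷ Bs) A = trans (subF-∀∈ ρs θ Bs _)
    -- Only the bound of the innermost quantifier needs work. Its renaming past the whole block is
    -- split into `there` and the rest, which commute with `lift` and `liftN` separately.
    (cong (λ C → ∀∈ ρs (subT θ Bs) (∀̇ ⌈ ρ ⌉ (_ε_ {σ = ρ} (var (here refl)) C ⊃ subF (lift (liftN ⌈ ρs ⌉* θ)) A)))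
      (begin
        sub (lift (liftN ⌈ ρs ⌉* θ)) (ren (λ x → there (∈-++⁺ʳ ⌈ ρs ⌉* x)) B)
          ≡⟨ cong (sub _) (ren-ren (λ x → refl) B) ⟨
        sub (lift (liftN ⌈ ρs ⌉* θ)) (ren there (ren (∈-++⁺ʳ ⌈ ρs ⌉*) B))
          ≡⟨ sub-lift-there (liftN ⌈ ρs ⌉* θ) (ren (∈-++⁺ʳ ⌈ ρs ⌉*) B) ⟩
        ren there (sub (liftN ⌈ ρs ⌉* θ) (ren (∈-++⁺ʳ ⌈ ρs ⌉*) B))
          ≡⟨ cong (ren there) (sub-liftN-++ ⌈ ρs ⌉* θ B) ⟩
        ren there (ren (∈-++⁺ʳ ⌈ ρs ⌉*) (sub θ B))
          ≡⟨ ren-ren (λ x → refl) (sub θ B) ⟩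
        ren (λ x → there (∈-++⁺ʳ ⌈ ρs ⌉* x)) (sub θ B) ∎))
    where open ≡-Reasoning

  module _ {Δ : Ctx} (I : Interp Δ) where

    at-cong : ∀ {Ξ} {xs xs′ : Sub Δ Ξ} {as as′ : Tms Ξ (pos I)} {bs bs′ : Tms Ξ (neg I)} →
              xs ≡ xs′ → as ≡ as′ → bs ≡ bs′ → at I xs as bs ≡ at I xs′ as′ bs′
    at-cong refl refl refl = refl

    at∀∈-cong : ∀ {Ξ} {xs xs′ : Sub Δ Ξ} {as as′ : Tms Ξ (pos I)} {Bs Bs′ : Tms Ξ (neg I **)} →
                xs ≡ xs′ → as ≡ as′ → Bs ≡ Bs′ → at∀∈ I xs as Bs ≡ at∀∈ I xs′ as′ Bs′
    at∀∈-cong refl refl refl = refl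

    subF-at : ∀ {Ξ Ψ} (θ : Sub Ξ Ψ) (xs : Sub Δ Ξ) (as : Tms Ξ (pos I)) (bs : Tms Ξ (neg I)) →
              subF θ (at I xs as bs) ≡ at I (All.map (sub θ) xs) (subT θ as) (subT θ bs)
    subF-at θ xs as bs = trans (subF-∘ θ _ (body I)) (cong (λ η → subF η (body I))
      (trans (map-++⁺ (sub θ) (map⁺ bs) (++⁺ (map⁺ as) xs))
        (cong₂ ++⁺ (map-map⁺ (sub θ) bs)
          (trans (map-++⁺ (sub θ) (map⁺ as) xs) (cong (λ η → ++⁺ η (All.map (sub θ) xs)) (map-map⁺ (sub θ) as))))))

    subF-at∀∈ : ∀ {Ξ Ψ} (θ : Sub Ξ Ψ) (xs : Sub Δ Ξ) (as : Tms Ξ (pos I)) (Bs : Tms Ξ (neg I **)) →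
                subF θ (at∀∈ I xs as Bs) ≡ at∀∈ I (All.map (sub θ) xs) (subT θ as) (subT θ Bs)
    subF-at∀∈ θ xs as Bs = trans (subF-∀∈ (neg I) θ Bs _) (cong (∀∈ (neg I) (subT θ Bs))
      (trans (subF-at (liftN N θ) (All.map (ren (∈-++⁺ʳ N)) xs) (renT (∈-++⁺ʳ N) as) (vars (neg I)))
        (at-cong (commute xs) (commute as)
        (trans (subT-vars (neg I) (liftN N θ)) (cong map⁻ (liftN-left N θ))))))
      where
      N = ⌈ neg I ⌉*
      commute : ∀ {B : Set} {f : B → Type} {bs} (ts : All (λ b → Tm _ (f b)) bs) →
                All.map (sub (liftN N θ)) (All.map (ren (∈-++⁺ʳ N)) ts)
                  ≡ All.map (ren (∈-++⁺ʳ N)) (All.map (sub θ) ts)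
      commute ts = trans (map-∘ ts) (trans (map-cong ts (sub-liftN-++ N θ)) (sym (map-∘ ts)))

    at-substᴵ : ∀ {Δ′ Ξ} (θ : Sub Δ Δ′) (xs : Sub Δ′ Ξ) (as : Tms Ξ (pos I)) (bs : Tms Ξ (neg I)) →
                at (substᴵ θ I) xs as bs ≡ at I (All.map (sub xs) θ) as bs
    at-substᴵ θ xs as bs = trans (subF-at _ (All.map (sub (baseVars (pos I) (neg I))) θ)
      (posVars (pos I) (neg I)) (negVars (pos I) (neg I))) (at-cong
      (trans (map-sub-sub _ _ θ) (cong (λ η → All.map (sub η) θ) (sub-baseVars (pos I) (neg I) bs as xs)))
      (sub-posVars (pos I) (neg I) bs as xs) (sub-negVars (pos I) (neg I) bs as xs))

    at∀∈-substᴵ : ∀ {Δ′ Ξ} (θ : Sub Δ Δ′) (xs : Sub Δ′ Ξ) (as : Tms Ξ (pos I)) (Bs : Tms Ξ (neg I **)) →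
                  at∀∈ (substᴵ θ I) xs as Bs ≡ at∀∈ I (All.map (sub xs) θ) as Bs
    at∀∈-substᴵ θ xs as Bs = cong (∀∈ (neg I) Bs) (trans
      (at-substᴵ θ (All.map (ren (∈-++⁺ʳ ⌈ neg I ⌉*)) xs) (renT (∈-++⁺ʳ ⌈ neg I ⌉*) as) (vars (neg I)))
      (cong (λ η → at I η (renT (∈-++⁺ʳ ⌈ neg I ⌉*) as) (vars (neg I))) (sym (map-ren-sub (∈-++⁺ʳ ⌈ neg I ⌉*) xs θ))))

  sub-apply : ∀ {Δ Ξ} (θ : Sub Δ Ξ) ρs {τ} (f : Tm Δ ⌈ ρs ⇒* τ ⌉) (as : Tms Δ ρs) →
              sub θ (apply ρs {τ} f as) ≡ apply ρs {τ} (sub θ f) (subT θ as)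
  sub-apply θ []       f []       = refl
  sub-apply θ (ρ ∷ ρs) {τ} f (a ∷ as) = sub-apply θ ρs {τ} (f · a) as

  subT-app : ∀ {Δ Ξ} (θ : Sub Δ Ξ) ρs τs (fs : Tms Δ (ρs ⇛ τs)) (as : Tms Δ ρs) →
             subT θ (app ρs τs fs as) ≡ app ρs τs (subT θ fs) (subT θ as)
  subT-app θ ρs []       []       as = refl
  subT-app θ ρs (τ ∷ τs) (f ∷ fs) as = cong₂ _∷_ (sub-apply θ ρs {τ} f as) (subT-app θ ρs τs fs as)

  module _ {Δ Ξ : Ctx} (I J : Interp Δ) (xs : Sub Δ Ξ) where

    -- `_∧ᴵ_` is defined at generic tuples of variables only; substituting for these recovers the
    -- clause at arbitrary tuples. As `xs` is arbitrary too, `substᴵ-∧` becomes a special case. The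
    -- clauses for the other connectives follow the same pattern.
    at-∧ : (as : Tms Ξ (pos I ++ pos J)) (bs : Tms Ξ (neg I ++ neg J)) →
           at (I ∧ᴵ J) xs as bs ≡
             at I xs (++⁻ˡ (pos I) as) (++⁻ˡ (neg I) bs) ∧̇
             at J xs (++⁻ʳ (pos I) as) (++⁻ʳ (neg I) bs)
    at-∧ as bs = cong₂ _∧̇_
      (trans (subF-at I θ (baseVars P N) (++⁻ˡ (pos I) (posVars P N)) (++⁻ˡ (neg I) (negVars P N))) (at-cong I x
        (trans (map-++⁻ˡ (sub θ) (pos I) (posVars P N)) (cong (++⁻ˡ (pos I)) p))
        (trans (map-++⁻ˡ (sub θ) (neg I) (negVars P N)) (cong (++⁻ˡ (neg I)) n))))
      (trans (subF-at J θ (baseVars P N) (++⁻ʳ (pos I) (posVars P N)) (++⁻ʳ (neg I) (negVars P N))) (at-cong J x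
        (trans (map-++⁻ʳ (sub θ) (pos I) (posVars P N)) (cong (++⁻ʳ (pos I)) p))
        (trans (map-++⁻ʳ (sub θ) (neg I) (negVars P N)) (cong (++⁻ʳ (neg I)) n))))
      where
      P = pos I ++ pos J
      N = neg I ++ neg J
      θ : Sub (ext P N Δ) Ξ
      θ = ++⁺ (map⁺ bs) (++⁺ (map⁺ as) xs)
      x = sub-baseVars P N bs as xs
      p = sub-posVars P N bs as xs
      n = sub-negVars P N bs as xs

    at-→ : (fg : Tms Ξ ((pos I ⇛ pos J) ++ (pos I ⇛ neg J ⇛ neg I **))) (ad : Tms Ξ (pos I ++ neg J)) →
           let f = ++⁻ˡ (pos I ⇛ pos J) fg
               g = ++⁻ʳ (pos I ⇛ pos J) fg
               a = ++⁻ˡ (pos I) ad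
               d = ++⁻ʳ (pos I) ad in
           at (I →ᴵ J) xs fg ad ≡
             at∀∈ I xs a (app (neg J) (neg I **) (app (pos I) (neg J ⇛ neg I **) g a) d) ⊃
             at J xs (app (pos I) (pos J) f a) d
    at-→ fg ad = cong₂ _⊃_
      (trans (subF-at∀∈ I θ (baseVars P N) a (app (neg J) (neg I **) (app (pos I) (neg J ⇛ neg I **) g a) d))
        (at∀∈-cong I x a≡ (trans (subT-app θ (neg J) (neg I **) (app (pos I) (neg J ⇛ neg I **) g a) d)
          (cong₂ (app (neg J) (neg I **))
            (trans (subT-app θ (pos I) (neg J ⇛ neg I **) g a) (cong₂ (app (pos I) (neg J ⇛ neg I **)) g≡ a≡)) d≡))))
      (trans (subF-at J θ (baseVars P N) (app (pos I) (pos J) f a) d)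
        (at-cong J x (trans (subT-app θ (pos I) (pos J) f a) (cong₂ (app (pos I) (pos J)) f≡ a≡)) d≡))
      where
      P = (pos I ⇛ pos J) ++ (pos I ⇛ neg J ⇛ neg I **)
      N = pos I ++ neg J
      θ : Sub (ext P N Δ) Ξ
      θ = ++⁺ (map⁺ ad) (++⁺ (map⁺ fg) xs)
      f = ++⁻ˡ (pos I ⇛ pos J) (posVars P N {Δ})
      g = ++⁻ʳ (pos I ⇛ pos J) (posVars P N {Δ})
      a = ++⁻ˡ (pos I) (negVars P N {Δ})
      d = ++⁻ʳ (pos I) (negVars P N {Δ})
      x = sub-baseVars P N ad fg xs
      f≡ = trans (map-++⁻ˡ (sub θ) (pos I ⇛ pos J) (posVars P N))
        (cong (++⁻ˡ (pos I ⇛ pos J)) (sub-posVars P N ad fg xs))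
      g≡ = trans (map-++⁻ʳ (sub θ) (pos I ⇛ pos J) (posVars P N))
        (cong (++⁻ʳ (pos I ⇛ pos J)) (sub-posVars P N ad fg xs))
      a≡ = trans (map-++⁻ˡ (sub θ) (pos I) (negVars P N)) (cong (++⁻ˡ (pos I)) (sub-negVars P N ad fg xs))
      d≡ = trans (map-++⁻ʳ (sub θ) (pos I) (negVars P N)) (cong (++⁻ʳ (pos I)) (sub-negVars P N ad fg xs))

  module _ {Δ Ξ : Ctx} {σ : Type} (I : Interp (σ ∷ Δ)) (xs : Sub Δ Ξ) (as : Tms Ξ (pos I)) where

    at-∀ : (bs : Tms Ξ (neg I)) → at (∀ᴵ σ I) xs as bs ≡ ∀̇ σ (at I (lift xs) (renT there as) (renT there bs))
    at-∀ bs = cong (∀̇ σ) (trans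
      (subF-at I (lift θ) (lift (baseVars P N)) (renT there (posVars P N)) (renT there (negVars P N)))
      (at-cong I
        (trans (lift-∘ θ (baseVars P N)) (cong lift (sub-baseVars P N bs as xs)))
        (trans (map-sub-lift-there θ (posVars P N)) (cong (renT there) (sub-posVars P N bs as xs)))
        (trans (map-sub-lift-there θ (negVars P N)) (cong (renT there) (sub-negVars P N bs as xs)))))
      where
      P = pos I
      N = neg I
      θ : Sub (ext P N Δ) Ξ
      θ = ++⁺ (map⁺ bs) (++⁺ (map⁺ as) xs)

    at-∃ : (Bs : Tms Ξ (neg I **)) → at (∃ᴵ σ I) xs as Bs ≡ ∃̇ σ (at∀∈ I (lift xs) (renT there as) (renT there Bs))
    at-∃ Bs = cong (∃̇ σ) (trans
      (subF-at∀∈ I (lift θ) (lift (baseVars P N)) (renT there (posVars P N)) (renT there (negVars P N)))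
      (at∀∈-cong I
        (trans (lift-∘ θ (baseVars P N)) (cong lift (sub-baseVars P N Bs as xs)))
        (trans (map-sub-lift-there θ (posVars P N)) (cong (renT there) (sub-posVars P N Bs as xs)))
        (trans (map-sub-lift-there θ (negVars P N)) (cong (renT there) (sub-negVars P N Bs as xs)))))
      where
      P = pos I
      N = neg I **
      θ : Sub (ext P N Δ) Ξ
      θ = ++⁺ (map⁺ Bs) (++⁺ (map⁺ as) xs)

  substᴵ-∘ : ∀ {Δ Δ′ Δ″} (θ : Sub Δ′ Δ″) (η : Sub Δ Δ′) (I : Interp Δ) →
             substᴵ θ (substᴵ η I) ≡ substᴵ (All.map (sub θ) η) I
  substᴵ-∘ θ η I = cong (interp P N) (trans
    (at-substᴵ I η (All.map (sub (baseVars P N)) θ) (posVars P N) (negVars P N))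
    (cong (λ ζ → at I ζ (posVars P N) (negVars P N)) (sym (map-sub-sub (baseVars P N) θ η))))
    where
    P = pos I
    N = neg I

  module _ {Δ Δ′ : Ctx} (θ : Sub Δ Δ′) where
    private
      θ′ : ∀ P N → Sub Δ (ext P N Δ′)
      θ′ P N = All.map (sub (baseVars P N)) θ

    -- `substᴵ` leaves `pos` and `neg` unchanged, so both sides have the same tuple types by
    -- definition and only the bodies have to be compared.
    substᴵ-∧ : (I J : Interp Δ) → substᴵ θ (I ∧ᴵ J) ≡ substᴵ θ I ∧ᴵ substᴵ θ J
    substᴵ-∧ I J = cong (interp P N) (trans (at-∧ I J (θ′ P N) (posVars P N) (negVars P N)) (sym (cong₂ _∧̇_
      (at-substᴵ I θ (baseVars P N) (++⁻ˡ (pos I) (posVars P N)) (++⁻ˡ (neg I) (negVars P N)))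
      (at-substᴵ J θ (baseVars P N) (++⁻ʳ (pos I) (posVars P N)) (++⁻ʳ (neg I) (negVars P N))))))
      where
      P = pos I ++ pos J
      N = neg I ++ neg J

    substᴵ-→ : (I J : Interp Δ) → substᴵ θ (I →ᴵ J) ≡ substᴵ θ I →ᴵ substᴵ θ J
    substᴵ-→ I J = cong (interp P N) (trans (at-→ I J (θ′ P N) (posVars P N) (negVars P N)) (sym (cong₂ _⊃_
      (at∀∈-substᴵ I θ (baseVars P N) a (app (neg J) (neg I **) (app (pos I) (neg J ⇛ neg I **) g a) d))
      (at-substᴵ J θ (baseVars P N) (app (pos I) (pos J) f a) d))))
      where
      P = (pos I ⇛ pos J) ++ (pos I ⇛ neg J ⇛ neg I **)
      N = pos I ++ neg J
      f = ++⁻ˡ (pos I ⇛ pos J) (posVars P N {Δ′})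
      g = ++⁻ʳ (pos I ⇛ pos J) (posVars P N {Δ′})
      a = ++⁻ˡ (pos I) (negVars P N {Δ′})
      d = ++⁻ʳ (pos I) (negVars P N {Δ′})

    substᴵ-∀ : ∀ {σ} (I : Interp (σ ∷ Δ)) → substᴵ θ (∀ᴵ σ I) ≡ ∀ᴵ σ (substᴵ (lift θ) I)
    substᴵ-∀ {σ} I = cong (interp P N) (trans (at-∀ I (θ′ P N) (posVars P N) (negVars P N)) (cong (∀̇ σ) (sym
      (trans (at-substᴵ I (lift θ) (lift (baseVars P N)) (renT there (posVars P N)) (renT there (negVars P N)))
        (cong (λ ζ → at I ζ (renT there (posVars P N)) (renT there (negVars P N))) (lift-∘ (baseVars P N) θ))))))
      where
      P = pos I
      N = neg I

    substᴵ-∃ : ∀ {σ} (I : Interp (σ ∷ Δ)) → substᴵ θ (∃ᴵ σ I) ≡ ∃ᴵ σ (substᴵ (lift θ) I)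
    substᴵ-∃ {σ} I = cong (interp P N) (trans (at-∃ I (θ′ P N) (posVars P N) (negVars P N)) (cong (∃̇ σ) (sym
      (trans (at∀∈-substᴵ I (lift θ) (lift (baseVars P N)) (renT there (posVars P N)) (renT there (negVars P N)))
        (at∀∈-cong I (lift-∘ (baseVars P N) θ) refl refl)))))
      where
      P = pos I
      N = neg I **

    substᴵ-pure : (A : Fm Δ) → substᴵ θ (pure A) ≡ pure (subF θ A)
    substᴵ-pure A = cong (λ η → pure (subF η A)) (map-sub-ids θ)

-- Derivations in T: structural lemmas, equality of tuples, bounded quantifiers.

module TargetLogic {L : SourceLanguage} {M : TargetLanguage L} (T : TargetTheory M) where
  open TargetLanguage M
  open Target M
  open Tuples M
  open Interpretations M
  open TargetTheory T
  open TermLemmas {Type} _⇒_ Const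
  open InterpretationLemmas M

  weaken : ∀ {Δ} {H H′ : List (Fm Δ)} {A} → H ⊆ H′ → H ⊢ A → H′ ⊢ A
  weaken s (hyp x)         = hyp (s x)
  weaken s (axiom a θ)     = axiom a θ
  weaken s (⊥E d)          = ⊥E (weaken s d)
  weaken s (dne c d)       = dne c (weaken s d)
  weaken s (∧I d e)        = ∧I (weaken s d) (weaken s e)
  weaken s (∧E₁ d)         = ∧E₁ (weaken s d)
  weaken s (∧E₂ d)         = ∧E₂ (weaken s d)
  weaken s (∨I₁ d)         = ∨I₁ (weaken s d)
  weaken s (∨I₂ d)         = ∨I₂ (weaken s d)
  weaken s (∨E d e f)      = ∨E (weaken s d) (weaken (Subset.∷⁺ʳ _ s) e) (weaken (Subset.∷⁺ʳ _ s) f)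
  weaken s (⊃I d)          = ⊃I (weaken (Subset.∷⁺ʳ _ s) d)
  weaken s (⊃E d e)        = ⊃E (weaken s d) (weaken s e)
  weaken s (∀I d)          = ∀I (weaken (Subset.map⁺ (subF wk) s) d)
  weaken s (∀E d t)        = ∀E (weaken s d) t
  weaken s (∃I t d)        = ∃I t (weaken s d)
  weaken s (∃E d e)        = ∃E (weaken s d) (weaken (Subset.∷⁺ʳ _ (Subset.map⁺ (subF wk) s)) e)
  weaken s ≐-refl          = ≐-refl
  weaken s (≐-subst A e d) = ≐-subst A (weaken s e) (weaken s d)

  weaken-[] : ∀ {Δ} {H : List (Fm Δ)} {A} → [] ⊢ A → H ⊢ A
  weaken-[] = weaken λ ()

  conv : ∀ {Δ} {H : List (Fm Δ)} {A B} → A ≡ B → H ⊢ A → H ⊢ B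
  conv = subst (_ ⊢_)

  map-subF-lift-wk : ∀ {Δ Ξ σ} (θ : Sub Δ Ξ) (H : List (Fm Δ)) →
                     map (subF (lift {σ} θ)) (map (subF wk) H) ≡ map (subF wk) (map (subF θ) H)
  map-subF-lift-wk θ H = trans (sym (List.map-∘ H)) (trans (List.map-cong (subF-lift-wk θ) H) (List.map-∘ H))

  ⊢-sub : ∀ {Δ Ξ} (θ : Sub Δ Ξ) {H : List (Fm Δ)} {A} → H ⊢ A → map (subF θ) H ⊢ subF θ A
  ⊢-sub θ (hyp x)             = hyp (∈-map⁺ (subF θ) x)
  ⊢-sub θ (axiom {A = A} a η) = conv (sym (subF-∘ θ η A)) (axiom a (All.map (sub θ) η))
  ⊢-sub θ (⊥E d)              = ⊥E (⊢-sub θ d)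
  ⊢-sub θ (dne c d)           = dne c (⊢-sub θ d)
  ⊢-sub θ (∧I d e)            = ∧I (⊢-sub θ d) (⊢-sub θ e)
  ⊢-sub θ (∧E₁ d)             = ∧E₁ (⊢-sub θ d)
  ⊢-sub θ (∧E₂ d)             = ∧E₂ (⊢-sub θ d)
  ⊢-sub θ (∨I₁ d)             = ∨I₁ (⊢-sub θ d)
  ⊢-sub θ (∨I₂ d)             = ∨I₂ (⊢-sub θ d)
  ⊢-sub θ (∨E d e f)          = ∨E (⊢-sub θ d) (⊢-sub θ e) (⊢-sub θ f)
  ⊢-sub θ (⊃I d)              = ⊃I (⊢-sub θ d)
  ⊢-sub θ (⊃E d e)            = ⊃E (⊢-sub θ d) (⊢-sub θ e)
  ⊢-sub θ {H} (∀I d)          = ∀I (subst (_⊢ _) (map-subF-lift-wk θ H) (⊢-sub (lift θ) d))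
  ⊢-sub θ (∀E {A = A} d t)    = conv (sym (subF-[] θ A t)) (∀E (⊢-sub θ d) (sub θ t))
  ⊢-sub θ (∃I {A = A} t d)    = ∃I (sub θ t) (conv (subF-[] θ A t) (⊢-sub θ d))
  ⊢-sub θ {H} (∃E {A = A} {C = C} d e) = ∃E (⊢-sub θ d)
    (subst₂ (λ H′ C′ → subF (lift θ) A ∷ H′ ⊢ C′) (map-subF-lift-wk θ H) (subF-lift-wk θ C) (⊢-sub (lift θ) e))
  ⊢-sub θ ≐-refl              = ≐-refl
  ⊢-sub θ (≐-subst A {s} {t} e d) = conv (sym (subF-[] θ A t))
    (≐-subst (subF (lift θ) A) (⊢-sub θ e) (conv (subF-[] θ A s) (⊢-sub θ d)))

  infix 3 _⟶_

  record _⟶_ {Δ Ξ} (H : List (Fm Δ)) (H′ : List (Fm Ξ)) : Set where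
    field
      θ  : Sub Δ Ξ
      up : ∀ {A} → H ⊢ A → H′ ⊢ subF θ A

  open _⟶_

  infix 30 _⟪_⟫

  _⟪_⟫ : ∀ {Δ Ξ} {H : List (Fm Δ)} {H′ : List (Fm Ξ)} {B : Set} {f : B → Type} {bs} →
         All (λ b → Tm Δ (f b)) bs → H ⟶ H′ → All (λ b → Tm Ξ (f b)) bs
  ts ⟪ w ⟫ = All.map (sub (θ w)) ts

  ⟶-wk : ∀ {Δ σ} {H : List (Fm Δ)} → H ⟶ map (subF (wk {σ})) H
  ⟶-wk = record { θ = wk ; up = ⊢-sub wk }

  ⟶-wk-∷ : ∀ {Δ σ} {H : List (Fm Δ)} {A} → H ⟶ A ∷ map (subF (wk {σ})) H
  ⟶-wk-∷ = record { θ = wk ; up = λ d → weaken there (⊢-sub wk d) }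

  module _ {Δ} {H : List (Fm Δ)} where

    ≐-sym : ∀ {σ} {s t : Tm Δ σ} → H ⊢ s ≐ t → H ⊢ t ≐ s
    ≐-sym {s = s} {t} e = conv (cong (t ≐_) (sub-there-ids t s))
      (≐-subst (var (here refl) ≐ ren there s) e (conv (cong (s ≐_) (sym (sub-there-ids s s))) ≐-refl))

    ≐-trans : ∀ {σ} {s t u : Tm Δ σ} → H ⊢ s ≐ t → H ⊢ t ≐ u → H ⊢ s ≐ u
    ≐-trans {s = s} {t} {u} d e = conv (cong (_≐ u) (sub-there-ids u s))
      (≐-subst (ren there s ≐ var (here refl)) e (conv (cong (_≐ t) (sym (sub-there-ids t s))) d))

    ≐-reflexive : ∀ {σ} {s t : Tm Δ σ} → s ≡ t → H ⊢ s ≐ t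
    ≐-reflexive refl = ≐-refl

    ·-congˡ : ∀ {σ τ} {f g : Tm Δ (σ ⇒ τ)} (a : Tm Δ σ) → H ⊢ f ≐ g → H ⊢ f · a ≐ g · a
    ·-congˡ {f = f} {g} a e = conv (cong₂ (λ h b → h ≐ g · b) (sub-there-ids g (f · a)) (sub-there-ids g a))
      (≐-subst (ren there (f · a) ≐ var (here refl) · ren there a) e
        (conv (sym (cong₂ (λ h b → h ≐ f · b) (sub-there-ids f (f · a)) (sub-there-ids f a))) ≐-refl))

    ·-congʳ : ∀ {σ τ} (f : Tm Δ (σ ⇒ τ)) {a b : Tm Δ σ} → H ⊢ a ≐ b → H ⊢ f · a ≐ f · b
    ·-congʳ f {a} {b} e = conv (cong₂ (λ h k → h ≐ k · b) (sub-there-ids b (f · a)) (sub-there-ids b f))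
      (≐-subst (ren there (f · a) ≐ ren there f · var (here refl)) e
        (conv (sym (cong₂ (λ h k → h ≐ k · a) (sub-there-ids a (f · a)) (sub-there-ids a f))) ≐-refl))

    ε-cong : ∀ {ρ} {b : Tm Δ ⌈ ρ ⌉} {B C : Tm Δ ⌈ ρ * ⌉} → H ⊢ B ≐ C → H ⊢ _ε_ {σ = ρ} b B → H ⊢ _ε_ {σ = ρ} b C
    ε-cong {ρ} {b} {B} {C} e d = conv (cong (λ c → _ε_ {σ = ρ} c C) (sub-there-ids C b))
      (≐-subst (_ε_ {σ = ρ} (ren there b) (var (here refl))) e
        (conv (cong (λ c → _ε_ {σ = ρ} c B) (sym (sub-there-ids B b))) d))

  infix 4 _⊢_≋_

  -- Equality provable in T, as opposed to identity of terms: bracket abstraction satisfies its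
  -- equations only in this sense.
  data _⊢_≋_ {Δ} (H : List (Fm Δ)) {B : Set} {f : B → Type} :
             ∀ {bs} → All (λ b → Tm Δ (f b)) bs → All (λ b → Tm Δ (f b)) bs → Set where
    []  : H ⊢ [] ≋ []
    _∷_ : ∀ {b bs} {t u : Tm Δ (f b)} {ts us : All (λ b → Tm Δ (f b)) bs} →
          H ⊢ t ≐ u → H ⊢ ts ≋ us → H ⊢ t ∷ ts ≋ u ∷ us

  module _ {Δ} {H : List (Fm Δ)} where

    module _ {B : Set} {f : B → Type} where

      ≋-refl : ∀ {bs} {ts : All (λ b → Tm Δ (f b)) bs} → H ⊢ ts ≋ ts
      ≋-refl {ts = []}    = []
      ≋-refl {ts = _ ∷ _} = ≐-refl ∷ ≋-refl

      ≋-reflexive : ∀ {bs} {ts us : All (λ b → Tm Δ (f b)) bs} → ts ≡ us → H ⊢ ts ≋ us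
      ≋-reflexive refl = ≋-refl

      ≋-sym : ∀ {bs} {ts us : All (λ b → Tm Δ (f b)) bs} → H ⊢ ts ≋ us → H ⊢ us ≋ ts
      ≋-sym []       = []
      ≋-sym (e ∷ es) = ≐-sym e ∷ ≋-sym es

      ≋-trans : ∀ {bs} {ts us vs : All (λ b → Tm Δ (f b)) bs} → H ⊢ ts ≋ us → H ⊢ us ≋ vs → H ⊢ ts ≋ vs
      ≋-trans []       []       = []
      ≋-trans (d ∷ ds) (e ∷ es) = ≐-trans d e ∷ ≋-trans ds es

      ≋-++⁺ : ∀ {bs cs} {ts ts′ : All (λ b → Tm Δ (f b)) bs} {us us′ : All (λ b → Tm Δ (f b)) cs} →
              H ⊢ ts ≋ ts′ → H ⊢ us ≋ us′ → H ⊢ ++⁺ ts us ≋ ++⁺ ts′ us′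
      ≋-++⁺ []       ds = ds
      ≋-++⁺ (e ∷ es) ds = e ∷ ≋-++⁺ es ds

    ≋-map⁺ : ∀ {ρs} {ts us : Tms Δ ρs} → H ⊢ ts ≋ us → H ⊢ map⁺ {P = Tm Δ} {f = ⌈_⌉} ts ≋ map⁺ us
    ≋-map⁺ []       = []
    ≋-map⁺ (e ∷ es) = e ∷ ≋-map⁺ es

    -- `≐-subst` exchanges one term at a time. The formula is therefore moved into the context
    -- `Φ ++ Δ`: once the head term has been exchanged, the new term, which lives in `Δ`, is
    -- substituted for its variable, and the induction goes on with the remaining variables.
    subF-≋ : ∀ {Φ} {θ η : Sub Φ Δ} → H ⊢ θ ≋ η → (A : Fm Φ) → H ⊢ subF θ A → H ⊢ subF η A
    subF-≋ {Φ} {θ} {η} es A d = conv (eq η) (main es (subF (++⁻ˡ Φ ids) A) (conv (sym (eq θ)) d))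
      where
      eq : ∀ (ζ : Sub Φ Δ) → subF (++⁺ ζ ids) (subF (++⁻ˡ Φ ids) A) ≡ subF ζ A
      eq ζ = trans (subF-∘ (++⁺ ζ ids) (++⁻ˡ Φ ids) A) (cong (λ ξ → subF ξ A)
        (trans (map-++⁻ˡ (sub (++⁺ ζ ids)) Φ ids) (trans (cong (++⁻ˡ Φ) (map-ids (++⁺ ζ ids))) (++⁻ˡ-++⁺ ζ ids))))

      main : ∀ {Φ} {θ η : Sub Φ Δ} → H ⊢ θ ≋ η → (B : Fm (Φ ++ Δ)) → H ⊢ subF (++⁺ θ ids) B → H ⊢ subF (++⁺ η ids) B
      main [] B d = d
      main {σ ∷ Φ} {t ∷ θ} {u ∷ η} (e ∷ es) B d =
        conv (move η) (main es (subF (ren (∈-++⁺ʳ Φ) u ∷ ids) B) (conv (sym (move θ))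
          (conv (subF-lift-[] (++⁺ θ ids) B u)
            (≐-subst (subF (lift (++⁺ θ ids)) B) e (conv (sym (subF-lift-[] (++⁺ θ ids) B t)) d)))))
        where
        move : ∀ (ζ : Sub Φ Δ) → subF (++⁺ ζ ids) (subF (ren (∈-++⁺ʳ Φ) u ∷ ids) B) ≡ subF (u ∷ ++⁺ ζ ids) B
        move ζ = trans (subF-∘ (++⁺ ζ ids) (ren (∈-++⁺ʳ Φ) u ∷ ids) B)
          (cong₂ (λ v ξ → subF (v ∷ ξ) B) (trans (sub-++ ζ ids u) (sub-ids u)) (map-ids (++⁺ ζ ids)))

  data Mem {Δ} (H : List (Fm Δ)) : ∀ {ρs} → Tms Δ ρs → Tms Δ (ρs **) → Set where
    []  : Mem H [] []
    _∷_ : ∀ {ρ ρs} {b : Tm Δ ⌈ ρ ⌉} {B : Tm Δ ⌈ ρ * ⌉} {bs : Tms Δ ρs} {Bs : Tms Δ (ρs **)} →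
          H ⊢ _ε_ {σ = ρ} b B → Mem H bs Bs → Mem H {ρ ∷ ρs} (b ∷ bs) (B ∷ Bs)

  Mem-up : ∀ {Δ Ξ} {H : List (Fm Δ)} {H′ : List (Fm Ξ)} (w : H ⟶ H′) {ρs} {bs : Tms Δ ρs} {Bs} →
           Mem H bs Bs → Mem H′ (bs ⟪ w ⟫) (Bs ⟪ w ⟫)
  Mem-up w []       = []
  Mem-up w (m ∷ ms) = up w m ∷ Mem-up w ms

  Mem-≋ : ∀ {Δ} {H : List (Fm Δ)} {ρs} {bs : Tms Δ ρs} {Bs Cs} → H ⊢ Bs ≋ Cs → Mem H bs Bs → Mem H bs Cs
  Mem-≋ []       []                 = []
  Mem-≋ (e ∷ es) (_∷_ {ρ = ρ} m ms) = ε-cong {ρ = ρ} e m ∷ Mem-≋ es ms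

  infix 4 _⊢_⊑_

  -- Inclusion is read over all later worlds instead of as a formula of T, so that it applies
  -- directly to the variables bound by `∀∈`.
  _⊢_⊑_ : ∀ {Δ} (H : List (Fm Δ)) {ρs} → Tms Δ (ρs **) → Tms Δ (ρs **) → Set
  _⊢_⊑_ H Bs Cs = ∀ {Ξ} {H′ : List (Fm Ξ)} (w : H ⟶ H′) {bs} → Mem H′ bs (Bs ⟪ w ⟫) → Mem H′ bs (Cs ⟪ w ⟫)

  module _ {Δ} {H : List (Fm Δ)} where

    -- The hypotheses in force in the scope of `∀∈ ρs Bs`. The recursion follows that of `∀∈`, so
    -- that `∀∈-I` is nothing but iterated `⊃I` and `∀I`.
    bounded : ∀ ρs → Tms Δ (ρs **) → List (Fm (⌈ ρs ⌉* ++ Δ))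
    bounded []       []       = H
    bounded (ρ ∷ ρs) (B ∷ Bs) =
      _ε_ {σ = ρ} (var (here refl)) (ren (λ x → there (∈-++⁺ʳ ⌈ ρs ⌉* x)) B) ∷ map (subF wk) (bounded ρs Bs)

    bounded-up : ∀ ρs (Bs : Tms Δ (ρs **)) {A} → H ⊢ A → bounded ρs Bs ⊢ subF (wkN ⌈ ρs ⌉*) A
    bounded-up []       []       {A} d = conv (sym (subF-ids A)) d
    bounded-up (ρ ∷ ρs) (B ∷ Bs) {A} d =
      conv (trans (subF-∘ wk (wkN ⌈ ρs ⌉*) A) (cong (λ θ → subF θ A) (wkN-∷ ⌈ ρ ⌉ ⌈ ρs ⌉*)))
        (up ⟶-wk-∷ (bounded-up ρs Bs d))

    ⟶-bounded : ∀ ρs (Bs : Tms Δ (ρs **)) → H ⟶ bounded ρs Bs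
    ⟶-bounded ρs Bs = record { θ = wkN ⌈ ρs ⌉* ; up = bounded-up ρs Bs }

    bounded-Mem : ∀ ρs (Bs : Tms Δ (ρs **)) → Mem (bounded ρs Bs) (vars ρs) (subT (wkN ⌈ ρs ⌉*) Bs)
    bounded-Mem []       []       = []
    bounded-Mem (ρ ∷ ρs) (B ∷ Bs) =
      conv (cong (_ε_ {σ = ρ} (var (here refl))) (ren-++ ⌈ ρ ∷ ρs ⌉* B)) (hyp (here refl)) ∷
      subst₂ (Mem (bounded (ρ ∷ ρs) (B ∷ Bs))) (vars-∷ ρ ρs)
        (trans (map-sub-sub wk (wkN ⌈ ρs ⌉*) Bs) (cong (λ θ → subT θ Bs) (wkN-∷ ⌈ ρ ⌉ ⌈ ρs ⌉*)))
        (Mem-up ⟶-wk-∷ (bounded-Mem ρs Bs))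

    ≋-up : ∀ {Ξ} {H′ : List (Fm Ξ)} (w : H ⟶ H′) {B : Set} {f : B → Type} {bs} {ts us : All (λ b → Tm Δ (f b)) bs} →
           H ⊢ ts ≋ us → H′ ⊢ ts ⟪ w ⟫ ≋ us ⟪ w ⟫
    ≋-up w []       = []
    ≋-up w (e ∷ es) = up w e ∷ ≋-up w es

    ∀∈-I : ∀ ρs (Bs : Tms Δ (ρs **)) {A} → bounded ρs Bs ⊢ A → H ⊢ ∀∈ ρs Bs A
    ∀∈-I []       []       d = d
    ∀∈-I (ρ ∷ ρs) (B ∷ Bs) d = ∀∈-I ρs Bs (∀I (⊃I d))

    ∀∈-E : ∀ ρs {Bs : Tms Δ (ρs **)} A {bs} → H ⊢ ∀∈ ρs Bs A → Mem H bs Bs → H ⊢ subF (++⁺ (map⁺ bs) ids) A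
    ∀∈-E []       {[]}     A {[]}     d []       = conv (sym (subF-ids A)) d
    ∀∈-E (ρ ∷ ρs) {B ∷ Bs} A {b ∷ bs} d (m ∷ ms) =
      ⊃E (conv (trans (subF-lift-[] (++⁺ (map⁺ bs) ids) A′ b)
                 (cong (λ C → _ε_ {σ = ρ} b C ⊃ subF (++⁺ (map⁺ (b ∷ bs)) ids) A)
                   (trans (sub-++ (map⁺ {P = Tm Δ} {f = ⌈_⌉} (b ∷ bs)) ids B) (sub-ids B))))
               (∀E (∀∈-E ρs (∀̇ ⌈ ρ ⌉ A′) d ms) b)) m
      where
      A′ = _ε_ {σ = ρ} (var (here refl)) (ren (λ x → there (∈-++⁺ʳ ⌈ ρs ⌉* x)) B) ⊃ A

  -- Validity of an interpretation at given witnesses and challenges.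

  -- Records rather than definitions: I, xs, as and bs cannot be inferred from the unfolding of at.
  module _ {Φ Δ : Ctx} (H : List (Fm Δ)) (I : Interp Φ) (xs : Sub Φ Δ) (as : Tms Δ (pos I)) where

    record Holds (bs : Tms Δ (neg I)) : Set where
      constructor holds
      field derivation : H ⊢ at I xs as bs

    record Holds∀∈ (Bs : Tms Δ (neg I **)) : Set where
      constructor holds∀∈
      field derivation : H ⊢ at∀∈ I xs as Bs

  module _ {Φ : Ctx} {I : Interp Φ} {Δ : Ctx} {H : List (Fm Δ)} {xs : Sub Φ Δ} where

    Holds-≋ : ∀ {xs′ as as′ bs bs′} → H ⊢ xs ≋ xs′ → H ⊢ as ≋ as′ → H ⊢ bs ≋ bs′ →
              Holds H I xs as bs → Holds H I xs′ as′ bs′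
    Holds-≋ cs ds es (holds d) = holds (subF-≋ (≋-++⁺ (≋-map⁺ es) (≋-++⁺ (≋-map⁺ ds) cs)) (body I) d)

    Holds∀∈-up : ∀ {as Bs} {Ξ} {H′ : List (Fm Ξ)} (w : H ⟶ H′) →
                 Holds∀∈ H I xs as Bs → Holds∀∈ H′ I (xs ⟪ w ⟫) (as ⟪ w ⟫) (Bs ⟪ w ⟫)
    Holds∀∈-up {as} {Bs} w (holds∀∈ d) = holds∀∈ (conv (subF-at∀∈ I (θ w) xs as Bs) (up w d))

    -- Although the premise speaks of all later worlds, one instance is decisive: the world whose
    -- new variables are the bound ones, with their memberships as hypotheses.
    Holds∀∈-I : ∀ {as Bs} →
                (∀ {Ξ} {H′ : List (Fm Ξ)} (w : H ⟶ H′) {bs} → Mem H′ bs (Bs ⟪ w ⟫) →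
                 Holds H′ I (xs ⟪ w ⟫) (as ⟪ w ⟫) bs) →
                Holds∀∈ H I xs as Bs
    Holds∀∈-I {as} {Bs} h = holds∀∈ (∀∈-I (neg I) Bs
      (conv (cong₂ (λ ys cs → at I ys cs (vars (neg I))) (sym (map-ren-++ ⌈ neg I ⌉* xs))
        (sym (map-ren-++ ⌈ neg I ⌉* as)))
        (Holds.derivation (h (⟶-bounded (neg I) Bs) (bounded-Mem {H = H} (neg I) Bs)))))

    Holds∀∈-E : ∀ {as Bs bs} → Holds∀∈ H I xs as Bs → Mem H bs Bs → Holds H I xs as bs
    Holds∀∈-E {as} {Bs} {bs} (holds∀∈ d) ms = holds (conv
      (trans (subF-at I (++⁺ (map⁺ bs) ids) (All.map (ren (∈-++⁺ʳ ⌈ neg I ⌉*)) xs)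
        (renT (∈-++⁺ʳ ⌈ neg I ⌉*) as) (vars (neg I)))
        (at-cong I (trans (map-sub-++ (map⁺ bs) ids xs) (map-sub-ids xs))
          (trans (map-sub-++ (map⁺ bs) ids as) (map-sub-ids as))
          (subT-vars-++ (neg I) bs ids)))
      (∀∈-E (neg I) _ d ms))

  module _ {Φ : Ctx} {I : Interp Φ} {Δ : Ctx} {H : List (Fm Δ)} {xs : Sub Φ Δ} where

    Holds∀∈-mono : ∀ {as Bs Cs} → H ⊢ Bs ⊑ Cs → Holds∀∈ H I xs as Cs → Holds∀∈ H I xs as Bs
    Holds∀∈-mono h p = Holds∀∈-I λ w ms → Holds∀∈-E (Holds∀∈-up w p) (h w ms)

    Holds∀∈-≋ : ∀ {as Bs Cs} → H ⊢ Bs ≋ Cs → Holds∀∈ H I xs as Cs → Holds∀∈ H I xs as Bs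
    Holds∀∈-≋ es = Holds∀∈-mono λ w → Mem-≋ (≋-up w es)

  module _ {Φ : Ctx} {I : Interp Φ} {Δ Ψ : Ctx} {H : List (Fm Δ)} {η : Sub Φ Ψ} {xs : Sub Ψ Δ}
    {as : Tms Δ (pos I)} where

    substᴵ-I : ∀ {bs} → Holds H I (All.map (sub xs) η) as bs → Holds H (substᴵ η I) xs as bs
    substᴵ-I {bs} (holds d) = holds (conv (sym (at-substᴵ I η xs as bs)) d)

    substᴵ-E : ∀ {bs} → Holds H (substᴵ η I) xs as bs → Holds H I (All.map (sub xs) η) as bs
    substᴵ-E {bs} (holds d) = holds (conv (at-substᴵ I η xs as bs) d)

    substᴵ-∀∈-I : ∀ {Bs} → Holds∀∈ H I (All.map (sub xs) η) as Bs → Holds∀∈ H (substᴵ η I) xs as Bs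
    substᴵ-∀∈-I {Bs} (holds∀∈ d) = holds∀∈ (conv (sym (at∀∈-substᴵ I η xs as Bs)) d)

    substᴵ-∀∈-E : ∀ {Bs} → Holds∀∈ H (substᴵ η I) xs as Bs → Holds∀∈ H I (All.map (sub xs) η) as Bs
    substᴵ-∀∈-E {Bs} (holds∀∈ d) = holds∀∈ (conv (at∀∈-substᴵ I η xs as Bs) d)

  module _ {Φ : Ctx} {σ : Type} {I : Interp (σ ∷ Φ)} {Δ : Ctx} {H : List (Fm Δ)} {xs : Sub Φ Δ}
    {as : Tms Δ (pos I)} where

    ∀ᴵ-I : ∀ {bs} →
           (∀ {Ξ} {H′ : List (Fm Ξ)} (w : H ⟶ H′) t → Holds H′ I (t ∷ xs ⟪ w ⟫) (as ⟪ w ⟫) (bs ⟪ w ⟫)) →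
           Holds H (∀ᴵ σ I) xs as bs
    ∀ᴵ-I {bs} h = holds (conv (sym (at-∀ I xs as bs)) (∀I (conv
      (sym (at-cong I (cong (var (here refl) ∷_) (map-ren-wk xs)) (map-ren-wk as) (map-ren-wk bs)))
      (Holds.derivation (h ⟶-wk (var (here refl)))))))

    ∀ᴵ-E : ∀ {bs} → Holds H (∀ᴵ σ I) xs as bs → ∀ t → Holds H I (t ∷ xs) as bs
    ∀ᴵ-E {bs} (holds d) t = holds (conv
      (trans (subF-at I (t ∷ ids) (lift xs) (renT there as) (renT there bs))
        (at-cong I (cong (t ∷_) (trans (map-sub-there t ids xs) (map-sub-ids xs)))
          (trans (map-sub-there t ids as) (map-sub-ids as)) (trans (map-sub-there t ids bs) (map-sub-ids bs))))
      (∀E (conv (at-∀ I xs as bs) d) t))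

    ∃ᴵ-I : ∀ {Bs} t → Holds∀∈ H I (t ∷ xs) as Bs → Holds H (∃ᴵ σ I) xs as Bs
    ∃ᴵ-I {Bs} t (holds∀∈ d) = holds (conv (sym (at-∃ I xs as Bs)) (∃I t (conv (sym
      (trans (subF-at∀∈ I (t ∷ ids) (lift xs) (renT there as) (renT there Bs))
        (at∀∈-cong I (cong (t ∷_) (trans (map-sub-there t ids xs) (map-sub-ids xs)))
          (trans (map-sub-there t ids as) (map-sub-ids as)) (trans (map-sub-there t ids Bs) (map-sub-ids Bs))))) d)))

    ∃ᴵ-E : ∀ {Bs C} → Holds H (∃ᴵ σ I) xs as Bs →
           (∀ {Ξ} {H′ : List (Fm Ξ)} (w : H ⟶ H′) t →
            Holds∀∈ H′ I (t ∷ xs ⟪ w ⟫) (as ⟪ w ⟫) (Bs ⟪ w ⟫) → H′ ⊢ subF (θ w) C) →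
           H ⊢ C
    ∃ᴵ-E {Bs} (holds d) h = ∃E (conv (at-∃ I xs as Bs) d) (h ⟶-wk-∷ (var (here refl)) (holds∀∈ (conv
      (at∀∈-cong I (cong (var (here refl) ∷_) (map-ren-wk xs)) (map-ren-wk as) (map-ren-wk Bs)) (hyp (here refl)))))

  module _ {Φ : Ctx} {I J : Interp Φ} {Δ : Ctx} {H : List (Fm Δ)} {xs : Sub Φ Δ} where

    ∧ᴵ-I : ∀ {as bs} →
           Holds H I xs (++⁻ˡ (pos I) as) (++⁻ˡ (neg I) bs) →
           Holds H J xs (++⁻ʳ (pos I) as) (++⁻ʳ (neg I) bs) →
           Holds H (I ∧ᴵ J) xs as bs
    ∧ᴵ-I {as} {bs} (holds d) (holds e) = holds (conv (sym (at-∧ I J xs as bs)) (∧I d e))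

    ∧ᴵ-E₁ : ∀ {as bs} → Holds H (I ∧ᴵ J) xs as bs → Holds H I xs (++⁻ˡ (pos I) as) (++⁻ˡ (neg I) bs)
    ∧ᴵ-E₁ {as} {bs} (holds d) = holds (∧E₁ (conv (at-∧ I J xs as bs) d))

    ∧ᴵ-E₂ : ∀ {as bs} → Holds H (I ∧ᴵ J) xs as bs → Holds H J xs (++⁻ʳ (pos I) as) (++⁻ʳ (neg I) bs)
    ∧ᴵ-E₂ {as} {bs} (holds d) = holds (∧E₂ (conv (at-∧ I J xs as bs) d))

    →ᴵ-I : ∀ {fg ad} →
           let f = ++⁻ˡ (pos I ⇛ pos J) fg
               g = ++⁻ʳ (pos I ⇛ pos J) fg
               a = ++⁻ˡ (pos I) ad
               d = ++⁻ʳ (pos I) ad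
               H′ = at∀∈ I xs a (app (neg J) (neg I **) (app (pos I) (neg J ⇛ neg I **) g a) d) ∷ H in
           (Holds∀∈ H′ I xs a (app (neg J) (neg I **) (app (pos I) (neg J ⇛ neg I **) g a) d) →
            Holds H′ J xs (app (pos I) (pos J) f a) d) →
           Holds H (I →ᴵ J) xs fg ad
    →ᴵ-I {fg} {ad} h = holds (conv (sym (at-→ I J xs fg ad)) (⊃I (Holds.derivation (h (holds∀∈ (hyp (here refl)))))))

    →ᴵ-E : ∀ {fg ad} →
           let f = ++⁻ˡ (pos I ⇛ pos J) fg
               g = ++⁻ʳ (pos I ⇛ pos J) fg
               a = ++⁻ˡ (pos I) ad
               d = ++⁻ʳ (pos I) ad in
           Holds H (I →ᴵ J) xs fg ad →
           Holds∀∈ H I xs a (app (neg J) (neg I **) (app (pos I) (neg J ⇛ neg I **) g a) d) →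
           Holds H J xs (app (pos I) (pos J) f a) d
    →ᴵ-E {fg} {ad} (holds d) (holds∀∈ e) = holds (⊃E (conv (at-→ I J xs fg ad) d) e)

-- Witnessing terms and bracket abstraction.

module Witnesses {L : SourceLanguage} {M : TargetLanguage L} (T : TargetTheory M) where
  open TargetLanguage M
  open Target M
  open Tuples M
  open Interpretations M
  open TargetTheory T
  open TermLemmas {Type} _⇒_ Const
  open InterpretationLemmas M
  open TargetLogic T
  open _⟶_

  -- Every closed target term of witnessing type serves as a constant, so that the realizers of
  -- the axioms of S, which are arbitrary closed witnessing terms, are included.
  module W = Terms {WType} _⇒_ (λ σ → Tm [] ⌈ σ ⌉)

  WTms : List WType → List WType → Set
  WTms Q ρs = All (W.Tm Q) ρs

  closed₁ : ∀ {Δ σ} → Tm [] σ → Tm Δ σ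
  closed₁ = ren (λ ())

  -- A target term of witnessing type may have subterms of other types, for which T need not have
  -- combinators. In `W.Tm` every application is between witnessing types, so `lam` can recurse over
  -- it; `ev` returns to the target language.
  ev : ∀ {Δ Q} → Tms Δ Q → ∀ {σ} → W.Tm Q σ → Tm Δ ⌈ σ ⌉
  ev η (W.var x) = All.lookup η x
  ev η (W.con c) = closed₁ c
  ev η (t W.· u) = ev η t · ev η u

  evT : ∀ {Δ Q} → Tms Δ Q → ∀ {ρs} → WTms Q ρs → Tms Δ ρs
  evT η = All.map (ev η)

  sub-closed₁ : ∀ {Δ Ξ σ} (θ : Sub Δ Ξ) (c : Tm [] σ) → sub θ (closed₁ c) ≡ closed₁ c
  sub-closed₁ θ c = trans (sub-ren {η = []} (λ ()) c) (sym (ren≡sub (λ ()) c))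

  sub-ev : ∀ {Δ Ξ Q} (θ : Sub Δ Ξ) (η : Tms Δ Q) {σ} (t : W.Tm Q σ) → sub θ (ev η t) ≡ ev (subT θ η) t
  sub-ev θ η (W.var x) = sym (lookup-map η x)
  sub-ev θ η (W.con c) = sub-closed₁ θ c
  sub-ev θ η (t W.· u) = cong₂ _·_ (sub-ev θ η t) (sub-ev θ η u)

  subT-evT : ∀ {Δ Ξ Q} (θ : Sub Δ Ξ) (η : Tms Δ Q) {ρs} (ts : WTms Q ρs) → subT θ (evT η ts) ≡ evT (subT θ η) ts
  subT-evT θ η ts = trans (map-∘ ts) (map-cong ts (sub-ev θ η))

  infixl 25 _[_]ʷ

  _[_]ʷ : ∀ {Q R ρs} → WTms Q ρs → WTms R Q → WTms R ρs
  ts [ us ]ʷ = All.map (W.sub us) ts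

  module _ {Δ : Ctx} {R : List WType} (η : Tms Δ R) where

    ev-sub : ∀ {Q} (us : WTms R Q) {σ} (t : W.Tm Q σ) → ev η (W.sub us t) ≡ ev (evT η us) t
    ev-sub us (W.var x) = sym (lookup-map us x)
    ev-sub us (W.con c) = refl
    ev-sub us (t W.· u) = cong₂ _·_ (ev-sub us t) (ev-sub us u)

    evT-[] : ∀ {Q} (us : WTms R Q) {ρs} (ts : WTms Q ρs) → evT η (ts [ us ]ʷ) ≡ evT (evT η us) ts
    evT-[] us ts = trans (map-∘ ts) (map-cong ts (ev-sub us))

    evT-ids : evT η W.ids ≡ η
    evT-ids = lookup-ext λ x → trans (lookup-map W.ids x) (cong (ev η) (lookup-tabulate W.var x))

  varsˡ : ∀ N {P} → WTms (N ++ P) N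
  varsˡ N = ++⁻ˡ N W.ids

  varsʳ : ∀ N {P} → WTms (N ++ P) P
  varsʳ N = ++⁻ʳ N W.ids

  evT-varsˡ : ∀ {Δ N P} (ds : Tms Δ N) (as : Tms Δ P) → evT (++⁺ ds as) (varsˡ N) ≡ ds
  evT-varsˡ {N = N} ds as = trans (map-++⁻ˡ _ N W.ids) (trans (cong (++⁻ˡ N) (evT-ids (++⁺ ds as))) (++⁻ˡ-++⁺ ds as))

  evT-varsʳ : ∀ {Δ N P} (ds : Tms Δ N) (as : Tms Δ P) → evT (++⁺ ds as) (varsʳ N) ≡ as
  evT-varsʳ {N = N} ds as = trans (map-++⁻ʳ _ N W.ids) (trans (cong (++⁻ʳ N) (evT-ids (++⁺ ds as))) (++⁻ʳ-++⁺ ds as))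

  Kʷ : ∀ {Q} σ τ → W.Tm Q (σ ⇒ τ ⇒ σ)
  Kʷ σ τ = W.con (con (Πᶜ σ τ))

  Sʷ : ∀ {Q} ρ σ τ → W.Tm Q ((ρ ⇒ σ ⇒ τ) ⇒ (ρ ⇒ σ) ⇒ ρ ⇒ τ)
  Sʷ ρ σ τ = W.con (con (Σᶜ ρ σ τ))

  lam : ∀ {Q ρ τ} → W.Tm (ρ ∷ Q) τ → W.Tm Q (ρ ⇒ τ)
  lam {ρ = ρ}         (W.var (here refl))    = Sʷ ρ (ρ ⇒ ρ) ρ W.· Kʷ ρ (ρ ⇒ ρ) W.· Kʷ ρ ρ
  lam {ρ = ρ} {τ}     (W.var (there x))      = Kʷ τ ρ W.· W.var x
  lam {ρ = ρ} {τ}     (W.con c)              = Kʷ τ ρ W.· W.con c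
  lam {ρ = ρ} {τ}     (W._·_ {σ = σ} t u)    = Sʷ ρ σ τ W.· lam t W.· lam u

  -- This is weak β: the combinator equations give no congruence under `lam`. Later computations
  -- respect this by rewriting only the head of an application, as in `app-cong`, and contracting
  -- one block of abstractions after the other.
  β : ∀ {Δ} {H : List (Fm Δ)} {Q ρ τ} (η : Tms Δ Q) (a : Tm Δ ⌈ ρ ⌉) (t : W.Tm (ρ ∷ Q) τ) →
      H ⊢ ev η (lam t) · a ≐ ev (a ∷ η) t
  β {ρ = ρ}     η a (W.var (here refl)) =
    ≐-trans (weaken-[] (Σ-eq ρ (ρ ⇒ ρ) ρ _ _ a)) (weaken-[] (Π-eq ρ (ρ ⇒ ρ) a _))
  β {ρ = ρ} {τ} η a (W.var (there x))   = weaken-[] (Π-eq τ ρ _ a)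
  β {ρ = ρ} {τ} η a (W.con c)           = weaken-[] (Π-eq τ ρ _ a)
  β {ρ = ρ} {τ} η a (W._·_ {σ = σ} t u) = ≐-trans (weaken-[] (Σ-eq ρ σ τ _ _ a))
    (≐-trans (·-congˡ _ (β η a t)) (·-congʳ _ (β η a u)))

  apply-cong : ∀ {Δ} {H : List (Fm Δ)} ρs {τ} {f g : Tm Δ ⌈ ρs ⇒* τ ⌉} (as : Tms Δ ρs) →
               H ⊢ f ≐ g → H ⊢ apply ρs {τ} f as ≐ apply ρs {τ} g as
  apply-cong []       []       e = e
  apply-cong (ρ ∷ ρs) {τ} (a ∷ as) e = apply-cong ρs {τ} as (·-congˡ a e)

  app-cong : ∀ {Δ} {H : List (Fm Δ)} ρs τs {fs gs : Tms Δ (ρs ⇛ τs)} (as : Tms Δ ρs) →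
             H ⊢ fs ≋ gs → H ⊢ app ρs τs fs as ≋ app ρs τs gs as
  app-cong ρs []       as []       = []
  app-cong ρs (τ ∷ τs) as (e ∷ es) = apply-cong ρs {τ} as e ∷ app-cong ρs τs as es

  -- The first argument has to be abstracted outermost, although its variable stands in front. The
  -- substitution moves that variable behind those of types `ρs`, which the recursion then
  -- abstracts.
  lam* : ∀ ρs {Q τ} → W.Tm (ρs ++ Q) τ → W.Tm Q (ρs ⇒* τ)
  lam* []       t = t
  lam* (ρ ∷ ρs) t = lam (lam* ρs (W.sub (W.var (∈-++⁺ʳ ρs (here refl)) ∷ ++⁺ (varsˡ ρs) (All.tail (varsʳ ρs))) t))

  β* : ∀ {Δ} {H : List (Fm Δ)} ρs {Q τ} (η : Tms Δ Q) (as : Tms Δ ρs) (t : W.Tm (ρs ++ Q) τ) →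
       H ⊢ apply ρs {τ} (ev η (lam* ρs t)) as ≐ ev (++⁺ as η) t
  β* []           η []       t = ≐-refl
  β* (ρ ∷ ρs) {Q} {τ} η (a ∷ as) t = ≐-trans (apply-cong ρs {τ} as (β η a (lam* ρs t′)))
    (≐-trans (β* ρs (a ∷ η) as t′) (≐-reflexive (trans (ev-sub (++⁺ as (a ∷ η)) π t) (cong (λ ζ → ev ζ t) eq))))
    where
    π : WTms (ρs ++ ρ ∷ Q) (ρ ∷ ρs ++ Q)
    π = W.var (∈-++⁺ʳ ρs (here refl)) ∷ ++⁺ (varsˡ ρs) (All.tail (varsʳ ρs))

    t′ = W.sub π t

    map-tail : ∀ {Δ R ρ ρs} (η : Tms Δ R) (ts : WTms R (ρ ∷ ρs)) → evT η (All.tail ts) ≡ All.tail (evT η ts)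
    map-tail η (_ ∷ _) = refl

    eq : evT (++⁺ as (a ∷ η)) π ≡ a ∷ ++⁺ as η
    eq = cong₂ _∷_ (lookup-++⁺ʳ as (a ∷ η) (here refl))
      (trans (map-++⁺ (ev (++⁺ as (a ∷ η))) (varsˡ ρs) (All.tail (varsʳ ρs)))
        (cong₂ ++⁺ (evT-varsˡ as (a ∷ η)) (trans (map-tail (++⁺ as (a ∷ η)) (varsʳ ρs))
          (cong All.tail (evT-varsʳ as (a ∷ η))))))

  lamT : ∀ ρs τs {Q} → WTms (ρs ++ Q) τs → WTms Q (ρs ⇛ τs)
  lamT ρs []       []       = []
  lamT ρs (τ ∷ τs) (t ∷ ts) = lam* ρs t ∷ lamT ρs τs ts

  βT : ∀ {Δ} {H : List (Fm Δ)} ρs τs {Q} (η : Tms Δ Q) (as : Tms Δ ρs) (ts : WTms (ρs ++ Q) τs) →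
       H ⊢ app ρs τs (evT η (lamT ρs τs ts)) as ≋ evT (++⁺ as η) ts
  βT ρs []       η as []       = []
  βT ρs (τ ∷ τs) η as (t ∷ ts) = β* ρs η as t ∷ βT ρs τs η as ts

  applyʷ : ∀ {Q} ρs {τ} → W.Tm Q (ρs ⇒* τ) → WTms Q ρs → W.Tm Q τ
  applyʷ []       f []       = f
  applyʷ (ρ ∷ ρs) f (a ∷ as) = applyʷ ρs (f W.· a) as

  appʷ : ∀ {Q} ρs τs → WTms Q (ρs ⇛ τs) → WTms Q ρs → WTms Q τs
  appʷ ρs []       []       as = []
  appʷ ρs (τ ∷ τs) (f ∷ fs) as = applyʷ ρs f as ∷ appʷ ρs τs fs as

  ev-applyʷ : ∀ {Δ Q} (η : Tms Δ Q) ρs {τ} (f : W.Tm Q (ρs ⇒* τ)) (as : WTms Q ρs) →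
              ev η (applyʷ ρs f as) ≡ apply ρs {τ} (ev η f) (evT η as)
  ev-applyʷ η []       f []       = refl
  ev-applyʷ η (ρ ∷ ρs) f (a ∷ as) = ev-applyʷ η ρs (f W.· a) as

  evT-appʷ : ∀ {Δ Q} (η : Tms Δ Q) ρs τs (fs : WTms Q (ρs ⇛ τs)) (as : WTms Q ρs) →
             evT η (appʷ ρs τs fs as) ≡ app ρs τs (evT η fs) (evT η as)
  evT-appʷ η ρs []       []       as = refl
  evT-appʷ η ρs (τ ∷ τs) (f ∷ fs) as = cong₂ _∷_ (ev-applyʷ η ρs f as) (evT-appʷ η ρs τs fs as)

  -- Default elements and set operations on tuples.

  default : ∀ {Q} ρ → W.Tm Q ρ
  default (ground X) = W.con (con (e X))
  default (ρ ⇒ τ)    = Kʷ τ ρ W.· default τ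
  default (ρ *)      = W.con (con (singleton ρ)) W.· default ρ

  defaults : ∀ {Q} ρs → WTms Q ρs
  defaults ρs = All.universal default ρs

  singles : ∀ {Q ρs} → WTms Q ρs → WTms Q (ρs **)
  singles []                 = []
  singles (_∷_ {x = ρ} t ts) = (W.con (con (singleton ρ)) W.· t) ∷ singles ts

  unions : ∀ {Q} ρs → WTms Q (ρs **) → WTms Q (ρs **) → WTms Q (ρs **)
  unions []       []       []       = []
  unions (ρ ∷ ρs) (B ∷ Bs) (C ∷ Cs) = (W.con (con (union ρ)) W.· B W.· C) ∷ unions ρs Bs Cs

  -- The unions are nested in the order of `∀∈`, the first index innermost. A bound does not depend
  -- on the other indices, so it is only weakened past them.
  ⋃* : ∀ {Q} ρs τ → WTms Q (ρs **) → W.Tm (ρs ++ Q) (τ *) → W.Tm Q (τ *)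
  ⋃* []       τ []       q = q
  ⋃* (ρ ∷ ρs) τ (B ∷ Bs) q = ⋃* ρs τ Bs (W.con (con (⋃ ρ τ)) W.· W.sub (varsʳ ρs) B W.· lam q)

  ⋃s : ∀ {Q} ρs τs → WTms Q (ρs **) → WTms (ρs ++ Q) (τs **) → WTms Q (τs **)
  ⋃s ρs []       Bs []       = []
  ⋃s ρs (τ ∷ τs) Bs (q ∷ qs) = ⋃* ρs τ Bs q ∷ ⋃s ρs τs Bs qs

  module _ {Δ : Ctx} {H : List (Fm Δ)} where

    Mem-singles : ∀ {Q ρs} (η : Tms Δ Q) (ts : WTms Q ρs) → Mem H (evT η ts) (evT η (singles ts))
    Mem-singles η []                 = []
    Mem-singles η (_∷_ {x = ρ} t ts) = ⊃E (∧E₂ (weaken-[] (ε-singleton ρ _ _))) ≐-refl ∷ Mem-singles η ts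

    Mem-unionsˡ : ∀ {Q} ρs (η : Tms Δ Q) (Bs Cs : WTms Q (ρs **)) {bs} →
                  Mem H bs (evT η Bs) → Mem H bs (evT η (unions ρs Bs Cs))
    Mem-unionsˡ []       η []       []       []       = []
    Mem-unionsˡ (ρ ∷ ρs) η (B ∷ Bs) (C ∷ Cs) (m ∷ ms) =
      ⊃E (∧E₂ (weaken-[] (ε-union ρ _ _ _))) (∨I₁ m) ∷ Mem-unionsˡ ρs η Bs Cs ms

    Mem-unionsʳ : ∀ {Q} ρs (η : Tms Δ Q) (Bs Cs : WTms Q (ρs **)) {bs} →
                  Mem H bs (evT η Cs) → Mem H bs (evT η (unions ρs Bs Cs))
    Mem-unionsʳ []       η []       []       []       = []
    Mem-unionsʳ (ρ ∷ ρs) η (B ∷ Bs) (C ∷ Cs) (m ∷ ms) =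
      ⊃E (∧E₂ (weaken-[] (ε-union ρ _ _ _))) (∨I₂ m) ∷ Mem-unionsʳ ρs η Bs Cs ms

    ε-⋃* : ∀ {Q} ρs τ (η : Tms Δ Q) (Bs : WTms Q (ρs **)) (q : W.Tm (ρs ++ Q) (τ *)) {bs x} →
           Mem H bs (evT η Bs) → H ⊢ _ε_ {σ = τ} x (ev (++⁺ bs η) q) → H ⊢ _ε_ {σ = τ} x (ev η (⋃* ρs τ Bs q))
    ε-⋃* []       τ η []       q []                d = d
    ε-⋃* (ρ ∷ ρs) τ η (B ∷ Bs) q {b ∷ bs} {x} (m ∷ ms) d = ε-⋃* ρs τ η Bs _ ms
      -- The index `b` witnesses membership in the union, and `β` turns `q` at `b` into `lam q`
      -- applied to `b`.
      (⊃E (∧E₂ (weaken-[] (ε-⋃ ρ τ x _ _))) (∃I b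
        (conv (sym (cong₂ _∧̇_
            (cong (_ε_ {σ = ρ} b) (trans (sub-there-ids b _)
              (trans (ev-sub (++⁺ bs η) (varsʳ ρs) B) (cong (λ ζ → ev ζ B) (evT-varsʳ bs η)))))
            (cong₂ (λ y f → _ε_ {σ = τ} y (f · b)) (sub-there-ids b x) (sub-there-ids b (ev (++⁺ bs η) (lam q))))))
          (∧I m (ε-cong {ρ = τ} (≐-sym (β (++⁺ bs η) b q)) d)))))

    Mem-⋃s : ∀ {Q} ρs τs (η : Tms Δ Q) (Bs : WTms Q (ρs **)) (qs : WTms (ρs ++ Q) (τs **)) {bs xs} →
             Mem H bs (evT η Bs) → Mem H xs (evT (++⁺ bs η) qs) → Mem H xs (evT η (⋃s ρs τs Bs qs))
    Mem-⋃s ρs []       η Bs []       ms []       = []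
    Mem-⋃s ρs (τ ∷ τs) η Bs (q ∷ qs) ms (k ∷ ks) = ε-⋃* ρs τ η Bs q ms k ∷ Mem-⋃s ρs τs η Bs qs ms ks

  module _ {Δ : Ctx} {H : List (Fm Δ)} {Q : List WType} (η : Tms Δ Q) where

    ⊑-unionsˡ : ∀ ρs (Bs Cs : WTms Q (ρs **)) → H ⊢ evT η Bs ⊑ evT η (unions ρs Bs Cs)
    ⊑-unionsˡ ρs Bs Cs w m = subst (Mem _ _) (sym (subT-evT (θ w) η (unions ρs Bs Cs)))
      (Mem-unionsˡ ρs (η ⟪ w ⟫) Bs Cs (subst (Mem _ _) (subT-evT (θ w) η Bs) m))

    ⊑-unionsʳ : ∀ ρs (Bs Cs : WTms Q (ρs **)) → H ⊢ evT η Cs ⊑ evT η (unions ρs Bs Cs)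
    ⊑-unionsʳ ρs Bs Cs w m = subst (Mem _ _) (sym (subT-evT (θ w) η (unions ρs Bs Cs)))
      (Mem-unionsʳ ρs (η ⟪ w ⟫) Bs Cs (subst (Mem _ _) (subT-evT (θ w) η Cs) m))

    ⊑-⋃s : ∀ ρs τs (Bs : WTms Q (ρs **)) (qs : WTms (ρs ++ Q) (τs **)) {bs} →
           Mem H bs (evT η Bs) → H ⊢ evT (++⁺ bs η) qs ⊑ evT η (⋃s ρs τs Bs qs)
    ⊑-⋃s ρs τs Bs qs {bs} ms w k = subst (Mem _ _) (sym (subT-evT (θ w) η (⋃s ρs τs Bs qs)))
      (Mem-⋃s ρs τs (η ⟪ w ⟫) Bs qs (subst (Mem _ _) (subT-evT (θ w) η Bs) (Mem-up w ms))
        (subst (Mem _ _) (trans (subT-evT (θ w) (++⁺ bs η) qs) (cong (λ ζ → evT ζ qs) (map-++⁺ (sub (θ w)) bs η))) k))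

  module _ {P : WType → Set} where

    -- `(ρs ++ τs) **` is not definitionally `ρs ** ++ τs **`, so tuples of sets get joining and
    -- splitting operations of their own instead of transports along that equation.
    pair** : ∀ ρs {τs} → All P (ρs **) → All P (τs **) → All P ((ρs ++ τs) **)
    pair** []       []       Cs = Cs
    pair** (ρ ∷ ρs) (B ∷ Bs) Cs = B ∷ pair** ρs Bs Cs

    left** : ∀ ρs {τs} → All P ((ρs ++ τs) **) → All P (ρs **)
    left** []       Bs       = []
    left** (ρ ∷ ρs) (B ∷ Bs) = B ∷ left** ρs Bs

    right** : ∀ ρs {τs} → All P ((ρs ++ τs) **) → All P (τs **)
    right** []       Bs       = Bs
    right** (ρ ∷ ρs) (B ∷ Bs) = right** ρs Bs

    left**-pair** : ∀ ρs {τs} (Bs : All P (ρs **)) (Cs : All P (τs **)) → left** ρs (pair** ρs Bs Cs) ≡ Bs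
    left**-pair** []       []       Cs = refl
    left**-pair** (ρ ∷ ρs) (B ∷ Bs) Cs = cong (B ∷_) (left**-pair** ρs Bs Cs)

    right**-pair** : ∀ ρs {τs} (Bs : All P (ρs **)) (Cs : All P (τs **)) → right** ρs (pair** ρs Bs Cs) ≡ Cs
    right**-pair** []       []       Cs = refl
    right**-pair** (ρ ∷ ρs) (B ∷ Bs) Cs = right**-pair** ρs Bs Cs

  module _ {P P′ : WType → Set} (f : ∀ {ρ} → P ρ → P′ ρ) where

    map-left** : ∀ ρs {τs} (Bs : All P ((ρs ++ τs) **)) → All.map f (left** ρs Bs) ≡ left** ρs (All.map f Bs)
    map-left** []       Bs       = refl
    map-left** (ρ ∷ ρs) (B ∷ Bs) = cong (f B ∷_) (map-left** ρs Bs)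

    map-right** : ∀ ρs {τs} (Bs : All P ((ρs ++ τs) **)) → All.map f (right** ρs Bs) ≡ right** ρs (All.map f Bs)
    map-right** []       Bs       = refl
    map-right** (ρ ∷ ρs) (B ∷ Bs) = map-right** ρs Bs

  module _ {Δ : Ctx} {H : List (Fm Δ)} where

    Mem-left : ∀ ρs {τs} {bs : Tms Δ (ρs ++ τs)} {Bs} → Mem H bs Bs → Mem H (++⁻ˡ ρs bs) (left** ρs Bs)
    Mem-left []       ms       = []
    Mem-left (ρ ∷ ρs) (m ∷ ms) = m ∷ Mem-left ρs ms

    Mem-right : ∀ ρs {τs} {bs : Tms Δ (ρs ++ τs)} {Bs} → Mem H bs Bs → Mem H (++⁻ʳ ρs bs) (right** ρs Bs)
    Mem-right []       ms       = ms
    Mem-right (ρ ∷ ρs) (m ∷ ms) = Mem-right ρs ms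

    Mem-++ : ∀ ρs {τs} {bs : Tms Δ ρs} {cs : Tms Δ τs} (Bs : Tms Δ ((ρs ++ τs) **)) →
             Mem H bs (left** ρs Bs) → Mem H cs (right** ρs Bs) → Mem H (++⁺ bs cs) Bs
    Mem-++ []       Bs       []       ks = ks
    Mem-++ (ρ ∷ ρs) (B ∷ Bs) (m ∷ ms) ks = m ∷ Mem-++ ρs Bs ms ks

-- The category of interpretations and its logical structure.

module Entailment {L : SourceLanguage} {M : TargetLanguage L} (T : TargetTheory M) where
  open TargetLanguage M
  open Target M
  open Tuples M
  open Interpretations M
  open TargetTheory T
  open TermLemmas {Type} _⇒_ Const
  open InterpretationLemmas M
  open TargetLogic T
  open Witnesses T
  open _⟶_

  module _ {Φ : Ctx} {I : Interp Φ} {Δ : Ctx} {H : List (Fm Δ)} where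

    Holds-cast : ∀ {xs xs′ as as′ bs bs′} → xs ≡ xs′ → as ≡ as′ → bs ≡ bs′ →
                 Holds H I xs as bs → Holds H I xs′ as′ bs′
    Holds-cast refl refl refl p = p

    Holds∀∈-cast : ∀ {xs xs′ as as′ Bs Bs′} → xs ≡ xs′ → as ≡ as′ → Bs ≡ Bs′ →
                   Holds∀∈ H I xs as Bs → Holds∀∈ H I xs′ as′ Bs′
    Holds∀∈-cast refl refl refl p = p

    Holds∀∈-weaken : ∀ {H′ xs as Bs} → H ⊆ H′ → Holds∀∈ H I xs as Bs → Holds∀∈ H′ I xs as Bs
    Holds∀∈-weaken s (holds∀∈ d) = holds∀∈ (weaken s d)

  ⊑-cast : ∀ {Δ} {H : List (Fm Δ)} {ρs} {Bs Bs′ Cs Cs′ : Tms Δ (ρs **)} →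
           Bs ≡ Bs′ → Cs ≡ Cs′ → H ⊢ Bs ⊑ Cs → H ⊢ Bs′ ⊑ Cs′
  ⊑-cast refl refl s = s

  Mem-cast : ∀ {Δ} {H : List (Fm Δ)} {ρs} {bs bs′ : Tms Δ ρs} {Bs Bs′} →
             bs ≡ bs′ → Bs ≡ Bs′ → Mem H bs Bs → Mem H bs′ Bs′
  Mem-cast refl refl m = m

  module _ {Φ Δ : Ctx} {A : Fm Φ} {H : List (Fm Δ)} {xs : Sub Φ Δ} where

    pure-I : ∀ {as bs} → H ⊢ subF xs A → Holds H (pure A) xs as bs
    pure-I {[]} {[]} d = holds d

    pure-E : ∀ {as bs} → Holds H (pure A) xs as bs → H ⊢ subF xs A
    pure-E {[]} {[]} (holds d) = d

    pure-∀∈-I : ∀ {as Bs} → H ⊢ subF xs A → Holds∀∈ H (pure A) xs as Bs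
    pure-∀∈-I {[]} {[]} d = holds∀∈ (conv (cong₂ (λ ys cs → at (pure A) ys cs [])
      (sym (trans (map-ren-++ [] xs) (map-sub-ids xs))) refl) d)

    pure-∀∈-E : ∀ {as Bs} → Holds∀∈ H (pure A) xs as Bs → H ⊢ subF xs A
    pure-∀∈-E {[]} {[]} p = pure-E (Holds∀∈-E p [])

  module _ {Φ : Ctx} {I J : Interp Φ} {Δ : Ctx} {H : List (Fm Δ)} {xs : Sub Φ Δ} where

    ∧ᴵ-∀∈-I : ∀ {as} Bs → Holds∀∈ H I xs (++⁻ˡ (pos I) as) (left** (neg I) Bs) →
              Holds∀∈ H J xs (++⁻ʳ (pos I) as) (right** (neg I) Bs) → Holds∀∈ H (I ∧ᴵ J) xs as Bs
    ∧ᴵ-∀∈-I {as} Bs p q = Holds∀∈-I λ w ms → ∧ᴵ-I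
      (Holds-cast refl (map-++⁻ˡ _ (pos I) as) refl (Holds∀∈-E (Holds∀∈-up w p)
        (Mem-cast refl (sym (map-left** _ (neg I) Bs)) (Mem-left (neg I) ms))))
      (Holds-cast refl (map-++⁻ʳ _ (pos I) as) refl (Holds∀∈-E (Holds∀∈-up w q)
        (Mem-cast refl (sym (map-right** _ (neg I) Bs)) (Mem-right (neg I) ms))))

    -- Challenges to a conjunction are pairs, so if a set on the left were empty the bounded
    -- hypothesis would say nothing about `J`. The member `cs` of the left bounds completes each
    -- challenge to `J` to such a pair.
    ∧ᴵ-∀∈-E₂ : ∀ {as Bs cs} → Holds∀∈ H (I ∧ᴵ J) xs as Bs → Mem H cs (left** (neg I) Bs) →
               Holds∀∈ H J xs (++⁻ʳ (pos I) as) (right** (neg I) Bs)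
    ∧ᴵ-∀∈-E₂ {as} {Bs} {cs} p m =
      Holds∀∈-I λ w {bs} ms → Holds-cast refl (sym (map-++⁻ʳ _ (pos I) as)) (++⁻ʳ-++⁺ (cs ⟪ w ⟫) bs)
      (∧ᴵ-E₂ (Holds∀∈-E (Holds∀∈-up w p) (Mem-++ (neg I) (Bs ⟪ w ⟫)
        (Mem-cast refl (map-left** _ (neg I) Bs) (Mem-up w m))
        (Mem-cast refl (map-right** _ (neg I) Bs) ms))))

  infix 4 _⊩_

  -- For closed s and t, T proves ∀b∈s d a ⟨I⟩ᵃ_b → ⟨J⟩ᵗᵃ_d; s and t are given as terms in the variables a and d.
  record _⊩_ {Φ} (I J : Interp Φ) : Set where
    field
      wit   : WTms (pos I) (pos J)
      bnd   : WTms (neg J ++ pos I) (neg I **)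
      valid : ∀ {Δ} {H : List (Fm Δ)} {xs : Sub Φ Δ} {as ds} →
              Holds∀∈ H I xs as (evT (++⁺ ds as) bnd) → Holds H J xs (evT as wit) ds

  open _⊩_

  evT-++ : ∀ {Δ P N R} (η : Tms Δ R) (us : WTms R N) (vs : WTms R P) {ρs} (ts : WTms (N ++ P) ρs) →
           evT η (ts [ ++⁺ us vs ]ʷ) ≡ evT (++⁺ (evT η us) (evT η vs)) ts
  evT-++ η us vs ts = trans (evT-[] η (++⁺ us vs) ts) (cong (λ ζ → evT ζ ts) (map-++⁺ (ev η) us vs))

  ⊩-refl : ∀ {Φ} {I : Interp Φ} → I ⊩ I
  ⊩-refl {I = I} = record
    { wit   = W.ids
    ; bnd   = singles (varsˡ (neg I))
    ; valid = λ {_} {_} {_} {as} {ds} p → Holds-cast refl (sym (evT-ids as)) refl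
        (Holds∀∈-E p (Mem-cast (evT-varsˡ ds as) refl (Mem-singles (++⁺ ds as) (varsˡ (neg I)))))
    }

  -- For a challenge `ds` to `K`, the sets `S` are what `g` asks of `J` at the witness computed by
  -- `f`. For each challenge to `J` from `S`, the sets `R` are what `f` asks of `I`. Collecting `R`
  -- over all of `S` answers all these requests with one tuple of sets.
  ⊩-trans : ∀ {Φ} {I J K : Interp Φ} → I ⊩ J → J ⊩ K → I ⊩ K
  ⊩-trans {Φ} {I} {J} {K} f g = record
    { wit   = wit g [ wit f ]ʷ
    ; bnd   = ⋃s (neg J) (neg I) S R
    ; valid = λ {_} {H} {xs} {as} {ds} p → Holds-cast refl (sym (evT-[] as (wit f) (wit g))) refl
        (valid g (Holds∀∈-I λ w {bs} ms → Holds-cast refl (sym (subT-evT (θ w) as (wit f))) refl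
          (valid f (Holds∀∈-mono
            (⊑-cast (R-eq ds as w bs) (sym (subT-evT (θ w) (++⁺ ds as) (⋃s (neg J) (neg I) S R)))
              (⊑-⋃s ((++⁺ ds as) ⟪ w ⟫) (neg J) (neg I) S R
                (Mem-cast refl (trans (cong (_⟪ w ⟫) (sym (S-eq ds as))) (subT-evT (θ w) (++⁺ ds as) S)) ms)))
            (Holds∀∈-up w p)))))
    }
    where
    S : WTms (neg K ++ pos I) (neg J **)
    S = bnd g [ ++⁺ (varsˡ (neg K)) (wit f [ varsʳ (neg K) ]ʷ) ]ʷ

    R : WTms (neg J ++ neg K ++ pos I) (neg I **)
    R = bnd f [ ++⁺ (varsˡ (neg J)) (varsʳ (neg K) [ varsʳ (neg J) ]ʷ) ]ʷ

    S-eq : ∀ {Δ} (ds : Tms Δ (neg K)) (as : Tms Δ (pos I)) →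
           evT (++⁺ ds as) S ≡ evT (++⁺ ds (evT as (wit f))) (bnd g)
    S-eq ds as = trans (evT-++ (++⁺ ds as) (varsˡ (neg K)) (wit f [ varsʳ (neg K) ]ʷ) (bnd g))
      (cong₂ (λ u v → evT (++⁺ u v) (bnd g)) (evT-varsˡ ds as)
        (trans (evT-[] (++⁺ ds as) (varsʳ (neg K)) (wit f)) (cong (λ ζ → evT ζ (wit f)) (evT-varsʳ ds as))))

    R-eq : ∀ {Δ Ξ} {H : List (Fm Δ)} {H′ : List (Fm Ξ)} (ds : Tms Δ (neg K)) (as : Tms Δ (pos I)) (w : H ⟶ H′) bs →
           evT (++⁺ bs ((++⁺ ds as) ⟪ w ⟫)) R ≡ evT (++⁺ bs (as ⟪ w ⟫)) (bnd f)
    R-eq ds as w bs = trans (evT-++ _ (varsˡ (neg J)) (varsʳ (neg K) [ varsʳ (neg J) ]ʷ) (bnd f))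
      (cong₂ (λ u v → evT (++⁺ u v) (bnd f)) (evT-varsˡ bs ((++⁺ ds as) ⟪ w ⟫))
        (trans (evT-[] _ (varsʳ (neg J)) (varsʳ (neg K)))
          (trans (cong (λ ζ → evT ζ (varsʳ (neg K))) (evT-varsʳ bs ((++⁺ ds as) ⟪ w ⟫)))
            (trans (sym (subT-evT (θ w) (++⁺ ds as) (varsʳ (neg K)))) (cong (_⟪ w ⟫) (evT-varsʳ ds as))))))

  evT-left : ∀ {Δ} P {Q} (as : Tms Δ (P ++ Q)) → evT as (varsˡ P) ≡ ++⁻ˡ P as
  evT-left P as = trans (map-++⁻ˡ (ev as) P W.ids) (cong (++⁻ˡ P) (evT-ids as))

  evT-right : ∀ {Δ} P {Q} (as : Tms Δ (P ++ Q)) → evT as (varsʳ P) ≡ ++⁻ʳ P as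
  evT-right P as = trans (map-++⁻ʳ (ev as) P W.ids) (cong (++⁻ʳ P) (evT-ids as))

  -- A challenge to `I` must be completed to a challenge to the pair; any element will do for the
  -- half belonging to `J`, hence the defaults.
  ∧-fst : ∀ {Φ} (I J : Interp Φ) → I ∧ᴵ J ⊩ I
  ∧-fst I J = record
    { wit   = varsˡ (pos I)
    ; bnd   = singles (++⁺ (varsˡ (neg I)) (defaults (neg J)))
    ; valid = λ {_} {_} {_} {as} {ds} p → Holds-cast refl (sym (evT-left (pos I) as))
        (trans (cong (++⁻ˡ (neg I)) (map-++⁺ (ev (++⁺ ds as)) (varsˡ (neg I)) (defaults (neg J))))
          (trans (++⁻ˡ-++⁺ _ _) (evT-varsˡ ds as)))
        (∧ᴵ-E₁ (Holds∀∈-E p (Mem-singles (++⁺ ds as) (++⁺ (varsˡ (neg I)) (defaults (neg J))))))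
    }

  ∧-snd : ∀ {Φ} (I J : Interp Φ) → I ∧ᴵ J ⊩ J
  ∧-snd I J = record
    { wit   = varsʳ (pos I)
    ; bnd   = singles (++⁺ (defaults (neg I)) (varsˡ (neg J)))
    ; valid = λ {_} {_} {_} {as} {ds} p → Holds-cast refl (sym (evT-right (pos I) as))
        (trans (cong (++⁻ʳ (neg I)) (map-++⁺ (ev (++⁺ ds as)) (defaults (neg I)) (varsˡ (neg J))))
          (trans (++⁻ʳ-++⁺ (evT (++⁺ ds as) (defaults (neg I))) _) (evT-varsˡ ds as)))
        (∧ᴵ-E₂ (Holds∀∈-E p (Mem-singles (++⁺ ds as) (++⁺ (defaults (neg I)) (varsˡ (neg J))))))
    }

  -- Both arguments put challenges to the same `I`. The union keeps them all, where an
  -- interpretation with single challenges would have to decide which of two refutes `I`.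
  ∧-pair : ∀ {Φ} {I J K : Interp Φ} → I ⊩ J → I ⊩ K → I ⊩ J ∧ᴵ K
  ∧-pair {I = I} {J} {K} f g = record
    { wit   = ++⁺ (wit f) (wit g)
    ; bnd   = unions (neg I) B C
    ; valid = λ {_} {_} {_} {as} {ds} p → ∧ᴵ-I
        (Holds-cast refl (sym (trans (cong (++⁻ˡ (pos J)) (map-++⁺ (ev as) (wit f) (wit g)))
          (++⁻ˡ-++⁺ (evT as (wit f)) (evT as (wit g))))) refl
          (valid f (Holds∀∈-mono (⊑-cast (B-eq ds as) refl (⊑-unionsˡ (++⁺ ds as) (neg I) B C)) p)))
        (Holds-cast refl (sym (trans (cong (++⁻ʳ (pos J)) (map-++⁺ (ev as) (wit f) (wit g)))
          (++⁻ʳ-++⁺ (evT as (wit f)) (evT as (wit g))))) refl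
          (valid g (Holds∀∈-mono (⊑-cast (C-eq ds as) refl (⊑-unionsʳ (++⁺ ds as) (neg I) B C)) p)))
    }
    where
    N = neg J ++ neg K
    B = bnd f [ ++⁺ (++⁻ˡ (neg J) (varsˡ N)) (varsʳ N) ]ʷ
    C = bnd g [ ++⁺ (++⁻ʳ (neg J) (varsˡ N)) (varsʳ N) ]ʷ

    B-eq : ∀ {Δ} (ds : Tms Δ N) (as : Tms Δ (pos I)) → evT (++⁺ ds as) B ≡ evT (++⁺ (++⁻ˡ (neg J) ds) as) (bnd f)
    B-eq ds as = trans (evT-++ (++⁺ ds as) (++⁻ˡ (neg J) (varsˡ N)) (varsʳ N) (bnd f))
      (cong₂ (λ u v → evT (++⁺ u v) (bnd f))
      (trans (map-++⁻ˡ (ev (++⁺ ds as)) (neg J) (varsˡ N)) (cong (++⁻ˡ (neg J)) (evT-varsˡ ds as))) (evT-varsʳ ds as))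

    C-eq : ∀ {Δ} (ds : Tms Δ N) (as : Tms Δ (pos I)) → evT (++⁺ ds as) C ≡ evT (++⁺ (++⁻ʳ (neg J) ds) as) (bnd g)
    C-eq ds as = trans (evT-++ (++⁺ ds as) (++⁻ʳ (neg J) (varsˡ N)) (varsʳ N) (bnd g))
      (cong₂ (λ u v → evT (++⁺ u v) (bnd g))
      (trans (map-++⁻ʳ (ev (++⁺ ds as)) (neg J) (varsˡ N)) (cong (++⁻ʳ (neg J)) (evT-varsˡ ds as))) (evT-varsʳ ds as))

  ∧-map : ∀ {Φ} (I J : Interp Φ) {K} → J ⊩ K → I ∧ᴵ J ⊩ I ∧ᴵ K
  ∧-map I J f = ∧-pair (∧-fst I J) (⊩-trans (∧-snd I J) f)

  ∧-mapˡ : ∀ {Φ} (I J : Interp Φ) {K} → I ⊩ K → I ∧ᴵ J ⊩ K ∧ᴵ J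
  ∧-mapˡ I J f = ∧-pair (⊩-trans (∧-fst I J) f) (∧-snd I J)

  -- A challenge to `J →ᴵ K` consists of a witness `a` for `J` and a challenge `d` to `K`. The
  -- `J`-half of `bnd f`, abstracted over both, becomes the bounding functional of the implication;
  -- the `I`-half remains a bound, with `a` read off from the challenge. The substitution in `B`
  -- reorders the variables, since `bnd f` expects `d` before `a`.
  curry : ∀ {Φ} (I J K : Interp Φ) → J ∧ᴵ I ⊩ K → I ⊩ J →ᴵ K
  curry I J K f = record
    { wit   = ++⁺ F G
    ; bnd   = B
    ; valid = λ {_} {_} {_} {as} {ds} p →
        let a = ++⁻ˡ (pos J) ds
            d = ++⁻ʳ (pos J) ds
            wits = map-++⁺ (ev as) F G
        in →ᴵ-I λ q → Holds-≋ ≋-refl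
          (≋-trans (≋-sym (βT (pos J) (pos K) as a (wit f)))
            (≋-reflexive (cong (λ u → app (pos J) (pos K) u a)
              (sym (trans (cong (++⁻ˡ (pos J ⇛ pos K)) wits) (++⁻ˡ-++⁺ (evT as F) (evT as G)))))))
          ≋-refl
          (valid f (∧ᴵ-∀∈-I (evT (++⁺ d (++⁺ a as)) (bnd f))
            (Holds∀∈-cast refl (sym (++⁻ˡ-++⁺ a as)) refl
              -- The hypothesis is bounded by `G` applied to `a` and then to `d`. Two uses of `βT`,
              -- one per block of abstractions, identify this with the `J`-half of `bnd f`.
              (Holds∀∈-≋
                (≋-trans (≋-reflexive (sym (map-left** (ev (++⁺ d (++⁺ a as))) (neg J) (bnd f))))
                  (≋-trans (≋-sym (βT (neg K) (neg J **) (++⁺ a as) d (left** (neg J) (bnd f))))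
                    (app-cong (neg K) (neg J **) d
                      (≋-trans (≋-sym (βT (pos J) (neg K ⇛ neg J **) as a
                        (lamT (neg K) (neg J **) (left** (neg J) (bnd f)))))
                        (≋-reflexive (cong (λ u → app (pos J) (neg K ⇛ neg J **) u a)
                          (sym (trans (cong (++⁻ʳ (pos J ⇛ pos K)) wits) (++⁻ʳ-++⁺ (evT as F) (evT as G))))))))))
                q))
            (Holds∀∈-cast refl (sym (++⁻ʳ-++⁺ a as))
              (trans (B-eq ds as) (map-right** (ev (++⁺ d (++⁺ a as))) (neg J) (bnd f)))
              (Holds∀∈-weaken there p))))
    }
    where
    F = lamT (pos J) (pos K) (wit f)
    G = lamT (pos J) (neg K ⇛ neg J **) (lamT (neg K) (neg J **) (left** (neg J) (bnd f)))
    N = pos J ++ neg K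
    B = right** (neg J) (bnd f) [ ++⁺ (++⁻ʳ (pos J) (varsˡ N)) (++⁺ (++⁻ˡ (pos J) (varsˡ N)) (varsʳ N)) ]ʷ

    B-eq : ∀ {Δ} (ds : Tms Δ N) (as : Tms Δ (pos I)) →
           evT (++⁺ ds as) B ≡ evT (++⁺ (++⁻ʳ (pos J) ds) (++⁺ (++⁻ˡ (pos J) ds) as)) (right** (neg J) (bnd f))
    B-eq ds as = trans
      (evT-++ η (++⁻ʳ (pos J) (varsˡ N)) (++⁺ (++⁻ˡ (pos J) (varsˡ N)) (varsʳ N)) (right** (neg J) (bnd f)))
      (cong₂ (λ u v → evT (++⁺ u v) (right** (neg J) (bnd f)))
        (trans (map-++⁻ʳ (ev η) (pos J) (varsˡ N)) (cong (++⁻ʳ (pos J)) (evT-varsˡ ds as)))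
        (trans (map-++⁺ (ev η) (++⁻ˡ (pos J) (varsˡ N)) (varsʳ N)) (cong₂ ++⁺
          (trans (map-++⁻ˡ (ev η) (pos J) (varsˡ N)) (cong (++⁻ˡ (pos J)) (evT-varsˡ ds as)))
          (evT-varsʳ ds as))))
      where η = ++⁺ ds as

  -- The implication is challenged only at `a` and the given challenge to `K`, hence the singletons
  -- `S`; `J` is challenged at the sets `V` which the implication itself names. Isolating the
  -- implication requires some member of the bounds for `J`, and `V` is not known to have one; `U`
  -- therefore adds the default singletons.
  eval : ∀ {Φ} (J K : Interp Φ) → (J →ᴵ K) ∧ᴵ J ⊩ K
  eval J K = record
    { wit   = appʷ (pos J) (pos K) (++⁻ˡ F (varsˡ P)) (varsʳ P)
    ; bnd   = pair** N S U
    ; valid = λ {_} {_} {_} {as} {ds} p →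
        let η  = ++⁺ ds as
            a≡ : evT η a ≡ ++⁻ʳ P as
            a≡ = trans (evT-[] η (varsʳ (neg K)) (varsʳ P))
              (trans (cong (λ ζ → evT ζ (varsʳ P)) (evT-varsʳ ds as)) (evT-right P as))
            fg≡ : evT η (varsˡ P [ varsʳ (neg K) ]ʷ) ≡ ++⁻ˡ P as
            fg≡ = trans (evT-[] η (varsʳ (neg K)) (varsˡ P))
              (trans (cong (λ ζ → evT ζ (varsˡ P)) (evT-varsʳ ds as)) (evT-left P as))
            ad≡ = map-++⁺ (ev η) a (varsˡ (neg K))
            S-mem : Mem _ (evT η (++⁺ a (varsˡ (neg K)))) (left** N (evT η (pair** N S U)))
            S-mem = Mem-cast refl (trans (cong (evT η) (sym (left**-pair** N S U)))
              (map-left** (ev η) N (pair** N S U)))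
              (Mem-singles η (++⁺ a (varsˡ (neg K))))
            U-mem : Mem _ (evT η (defaults (neg J))) (right** N (evT η (pair** N S U)))
            U-mem = Mem-cast refl (trans (cong (evT η) (sym (right**-pair** N S U)))
              (map-right** (ev η) N (pair** N S U)))
              (Mem-unionsʳ (neg J) η V (singles (defaults (neg J))) (Mem-singles η (defaults (neg J))))
            p₁ = ∧ᴵ-E₁ (Holds∀∈-E p (Mem-++ N (evT η (pair** N S U)) S-mem U-mem))
            p₂ = ∧ᴵ-∀∈-E₂ p S-mem
            ad-split = trans (++⁻ˡ-++⁺ (evT η (++⁺ a (varsˡ (neg K)))) (evT η (defaults (neg J)))) ad≡
        in Holds-cast refl
             (sym (trans (evT-appʷ as (pos J) (pos K) (++⁻ˡ F (varsˡ P)) (varsʳ P))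
               (cong₂ (app (pos J) (pos K)) (trans (map-++⁻ˡ (ev as) F (varsˡ P))
                 (cong (++⁻ˡ F) (evT-left P as))) (evT-right P as))))
             (trans (++⁻ʳ-++⁺ (evT η a) (evT η (varsˡ (neg K)))) (evT-varsˡ ds as))
             (→ᴵ-E′ (Holds-cast refl refl ad-split p₁) (trans (++⁻ˡ-++⁺ (evT η a) _) a≡)
               (Holds∀∈-mono (⊑-cast
                 (trans (evT-appʷ η (neg K) (neg J **) _ _) (cong₂ (app (neg K) (neg J **))
                   (trans (evT-appʷ η (pos J) (neg K ⇛ neg J **) _ _) (cong₂ (app (pos J) (neg K ⇛ neg J **))
                     (trans (map-++⁻ʳ (ev η) F (varsˡ P [ varsʳ (neg K) ]ʷ)) (cong (++⁻ʳ F) fg≡)) a≡))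
                   (sym (++⁻ʳ-++⁺ (evT η a) _))))
                 (trans (cong (evT η) (sym (right**-pair** N S U))) (map-right** (ev η) N (pair** N S U)))
                 (⊑-unionsˡ η (neg J) V (singles (defaults (neg J))))) p₂))
    }
    where
    F = pos J ⇛ pos K
    P = F ++ (pos J ⇛ neg K ⇛ neg J **)
    N = pos J ++ neg K

    a : WTms (neg K ++ P ++ pos J) (pos J)
    a = varsʳ P [ varsʳ (neg K) ]ʷ

    S : WTms (neg K ++ P ++ pos J) (N **)
    S = singles (++⁺ a (varsˡ (neg K)))

    V U : WTms (neg K ++ P ++ pos J) (neg J **)
    V = appʷ (neg K) (neg J **) (appʷ (pos J) (neg K ⇛ neg J **) (++⁻ʳ F (varsˡ P [ varsʳ (neg K) ]ʷ)) a)
      (varsˡ (neg K))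
    U = unions (neg J) V (singles (defaults (neg J)))

    →ᴵ-E′ : ∀ {Δ} {H : List (Fm Δ)} {xs fg ad a} →
            Holds H (J →ᴵ K) xs fg ad → ++⁻ˡ (pos J) ad ≡ a →
            Holds∀∈ H J xs a (app (neg K) (neg J **) (app (pos J) (neg K ⇛ neg J **) (++⁻ʳ F fg) a)
              (++⁻ʳ (pos J) ad)) →
            Holds H K xs (app (pos J) (pos K) (++⁻ˡ F fg) a) (++⁻ʳ (pos J) ad)
    →ᴵ-E′ h refl q = →ᴵ-E h q

  ⊥-elim : ∀ {Φ} {J : Interp Φ} → pure ⊥̇ ⊩ J
  ⊥-elim {J = J} = record
    { wit = defaults (pos J) ; bnd = [] ; valid = λ p → holds (⊥E (pure-∀∈-E p)) }

  pure-intro : ∀ {Φ} (I : Interp Φ) (A : Fm Φ) → [] ⊢ A → I ⊩ pure A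
  pure-intro I A d = record
    { wit = [] ; bnd = singles (defaults (neg I)) ; valid = λ {_} {_} {xs} p →
        pure-I {A = A} (weaken-[] (⊢-sub xs d)) }

  -- The realizers are kept: containing no variable of the formula, they are already uniform in the
  -- one that gets bound.
  ∀-intro : ∀ {Φ σ} (I : Interp Φ) (J : Interp (σ ∷ Φ)) → substᴵ wk I ⊩ J → I ⊩ ∀ᴵ σ J
  ∀-intro I J f = record
    { wit   = wit f
    ; bnd   = bnd f
    ; valid = λ {_} {_} {xs} {as} {ds} p → ∀ᴵ-I λ w t → Holds-cast refl (sym (subT-evT (θ w) as (wit f))) refl
        (valid f (substᴵ-∀∈-I (Holds∀∈-cast (sym (map-wk t (xs ⟪ w ⟫))) refl
          (trans (subT-evT (θ w) (++⁺ ds as) (bnd f)) (cong (λ ζ → evT ζ (bnd f)) (map-++⁺ (sub (θ w)) ds as)))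
          (Holds∀∈-up w p))))
    }

  -- Neither `∀ᴵ` nor substitution changes the tuple types, so the realizers of the identity fit.
  ∀-elim : ∀ {Φ σ} (J : Interp (σ ∷ Φ)) (t : Tm Φ σ) → ∀ᴵ σ J ⊩ substᴵ (t ∷ ids) J
  ∀-elim {σ = σ} J t = record
    { wit   = wit id
    ; bnd   = bnd id
    ; valid = λ {_} {_} {xs} p → substᴵ-I {I = J} {η = t ∷ ids}
        (Holds-cast (cong (sub xs t ∷_) (sym (map-ids xs))) refl refl (∀ᴵ-E (valid id p) (sub xs t)))
    }
    where
    id : ∀ᴵ σ J ⊩ ∀ᴵ σ J
    id = ⊩-refl

  -- A challenge to `∃ᴵ σ J` is already a tuple of sets of challenges to `J`, hence can itself be
  -- taken as the bound.
  ∃-intro : ∀ {Φ σ} (J : Interp (σ ∷ Φ)) (t : Tm Φ σ) → substᴵ (t ∷ ids) J ⊩ ∃ᴵ σ J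
  ∃-intro J t = record
    { wit   = W.ids
    ; bnd   = varsˡ (neg J **)
    ; valid = λ {_} {_} {xs} {as} {ds} p → ∃ᴵ-I (sub xs t)
        (Holds∀∈-cast (cong (sub xs t ∷_) (map-ids xs)) (sym (evT-ids as)) (evT-varsˡ ds as)
        (substᴵ-∀∈-E {I = J} {η = t ∷ ids} p))
    }

  -- A single object must pass all challenges in `bnd f` at once. So the whole tuple of sets is one
  -- challenge to `∃ᴵ σ J`, and the bound is its singleton; the object itself is obtained inside T
  -- and never enters the realizers.
  ∃-elim : ∀ {Φ σ} (J : Interp (σ ∷ Φ)) (K : Interp Φ) → J ⊩ substᴵ wk K → ∃ᴵ σ J ⊩ K
  ∃-elim J K f = record
    { wit   = wit f
    ; bnd   = singles (bnd f)
    ; valid = λ {_} {_} {xs} {as} {ds} p → holds (∃ᴵ-E (Holds∀∈-E p (Mem-singles (++⁺ ds as) (bnd f))) λ w t q →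
        conv (sym (subF-at K (θ w) xs (evT as (wit f)) ds)) (Holds.derivation
          (Holds-cast (map-wk t (xs ⟪ w ⟫)) (sym (subT-evT (θ w) as (wit f))) refl (substᴵ-E {η = wk}
            (valid f (Holds∀∈-cast refl refl
              (trans (subT-evT (θ w) (++⁺ ds as) (bnd f))
                (cong (λ ζ → evT ζ (bnd f)) (map-++⁺ (sub (θ w)) ds as))) q))))))
    }

  -- The instances of `J` at `s` and at `t` have the same tuple types, so the realizers of the first
  -- projection serve. The equation is read off from the very challenge used for that projection,
  -- whose second half is empty.
  replace : ∀ {Φ σ} (J : Interp (σ ∷ Φ)) (s t : Tm Φ σ) → substᴵ (s ∷ ids) J ∧ᴵ pure (s ≐ t) ⊩ substᴵ (t ∷ ids) J
  replace J s t = record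
    { wit   = varsˡ (pos J)
    ; bnd   = bnd fst
    ; valid = λ {_} {_} {xs} {as} {ds} p →
        let e = pure-E {A = s ≐ t} (∧ᴵ-E₂ {I = substᴵ (s ∷ ids) J} {pure (s ≐ t)}
                  (Holds∀∈-E p (Mem-singles (++⁺ ds as) (++⁺ (varsˡ (neg J)) []))))
        in substᴵ-I {I = J} {η = t ∷ ids} (Holds-≋ (e ∷ ≋-refl) ≋-refl ≋-refl
          (substᴵ-E {I = J} {η = s ∷ ids} (valid fst p)))
    }
    where
    fst : substᴵ (s ∷ ids) J ∧ᴵ pure (s ≐ t) ⊩ substᴵ (s ∷ ids) J
    fst = ∧-fst (substᴵ (s ∷ ids) J) (pure (s ≐ t))

-- Soundness of the uniform interpretation.

module Soundness {L : SourceLanguage} (M : TargetLanguage L) (base : Interpretations.BaseInterpretation M) where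
  private
    module S where
      open Source L public
      open TermLemmas _⇒_ (SourceLanguage.Const L) public
  open TargetLanguage M
  open Target M
  open Tuples M
  open Interpretations M
  open Uniform base
  open TermLemmas {Type} _⇒_ Const
  open InterpretationLemmas M

  ⌈_⌉ˢᵘᵇ : ∀ {Δ Ξ} → S.Sub Δ Ξ → Sub ⌈ Δ ⌉ᶜ ⌈ Ξ ⌉ᶜ
  ⌈ θ ⌉ˢᵘᵇ = map⁺ (All.map ⌈_⌉ᵗ θ)

  ⌈sub⌉ : ∀ {Δ Ξ} (θ : S.Sub Δ Ξ) {σ} (t : S.Tm Δ σ) → ⌈ S.sub θ t ⌉ᵗ ≡ sub ⌈ θ ⌉ˢᵘᵇ ⌈ t ⌉ᵗ
  ⌈sub⌉ θ (S.var x) = sym (trans (lookup-map⁺ {P = Tm _} {h = ⌈_⌉ˢ} (All.map ⌈_⌉ᵗ θ) x) (lookup-map {f = ⌈_⌉ᵗ} θ x))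
  ⌈sub⌉ θ (S.con c) = refl
  ⌈sub⌉ θ (t S.· u) = cong₂ _·_ (⌈sub⌉ θ t) (⌈sub⌉ θ u)

  ⌈ren-there⌉ : ∀ {Δ σ τ} (t : S.Tm Δ σ) → ⌈ S.ren (there {x = τ}) t ⌉ᵗ ≡ ren there ⌈ t ⌉ᵗ
  ⌈ren-there⌉ (S.var x) = refl
  ⌈ren-there⌉ (S.con c) = refl
  ⌈ren-there⌉ (t S.· u) = cong₂ _·_ (⌈ren-there⌉ t) (⌈ren-there⌉ u)

  ⌈map-there⌉ : ∀ {Δ Ξ τ} (θ : S.Sub Δ Ξ) → ⌈ All.map (S.ren (there {x = τ})) θ ⌉ˢᵘᵇ ≡ All.map (ren there) ⌈ θ ⌉ˢᵘᵇ
  ⌈map-there⌉ θ = trans (cong map⁺ (trans (map-∘ θ) (trans (map-cong θ ⌈ren-there⌉) (sym (map-∘ θ)))))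
    (sym (map-map⁺ (ren there) (All.map ⌈_⌉ᵗ θ)))

  ⌈lift⌉ : ∀ {Δ Ξ σ} (θ : S.Sub Δ Ξ) → ⌈ S.lift {σ} θ ⌉ˢᵘᵇ ≡ lift ⌈ θ ⌉ˢᵘᵇ
  ⌈lift⌉ θ = cong (var (here refl) ∷_) (⌈map-there⌉ θ)

  ⌈ids⌉ : ∀ {Δ} → ⌈ S.ids {Δ} ⌉ˢᵘᵇ ≡ ids
  ⌈ids⌉ {[]}    = refl
  ⌈ids⌉ {σ ∷ Δ} = trans (cong ⌈_⌉ˢᵘᵇ (sym S.lift-ids)) (trans (⌈lift⌉ S.ids) (trans (cong lift ⌈ids⌉) lift-ids))

  ⌈wk⌉ : ∀ {Δ σ} → ⌈ S.wk {σ} {Δ} ⌉ˢᵘᵇ ≡ wk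
  ⌈wk⌉ = trans (⌈map-there⌉ S.ids) (cong (All.map (ren there)) ⌈ids⌉)

  -- An identity of interpretations, tuple types included, so an entailment for one side can be
  -- transported to the other without changing realizers. It rests on the interpretation of each
  -- connective commuting with substitution.
  ⟨subF⟩ : ∀ {Δ Ξ} (θ : S.Sub Δ Ξ) (A : S.Fm Δ) → ⟨ S.subF θ A ⟩ ≡ substᴵ ⌈ θ ⌉ˢᵘᵇ ⟨ A ⟩
  ⟨subF⟩ θ (S.rel R ts) = sym (trans (substᴵ-∘ ⌈ θ ⌉ˢᵘᵇ (map⁺ (All.map ⌈_⌉ᵗ ts)) (base R))
    (cong (λ η → substᴵ η (base R))
    (trans (map-map⁺ (sub ⌈ θ ⌉ˢᵘᵇ) (All.map ⌈_⌉ᵗ ts)) (cong map⁺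
      (trans (map-∘ ts) (trans (map-cong ts (λ t → sym (⌈sub⌉ θ t))) (sym (map-∘ ts))))))))
  ⟨subF⟩ θ (s S.≐ t)    = trans (cong₂ (λ u v → pure (u ≐ v)) (⌈sub⌉ θ s) (⌈sub⌉ θ t))
    (sym (substᴵ-pure ⌈ θ ⌉ˢᵘᵇ (⌈ s ⌉ᵗ ≐ ⌈ t ⌉ᵗ)))
  ⟨subF⟩ θ S.⊥̇          = refl
  ⟨subF⟩ θ (A S.∧̇ B)    = trans (cong₂ _∧ᴵ_ (⟨subF⟩ θ A) (⟨subF⟩ θ B)) (sym (substᴵ-∧ ⌈ θ ⌉ˢᵘᵇ ⟨ A ⟩ ⟨ B ⟩))
  ⟨subF⟩ θ (A S.⊃ B)    = trans (cong₂ _→ᴵ_ (⟨subF⟩ θ A) (⟨subF⟩ θ B)) (sym (substᴵ-→ ⌈ θ ⌉ˢᵘᵇ ⟨ A ⟩ ⟨ B ⟩))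
  ⟨subF⟩ θ (S.∀̇ σ A)    = trans (cong (∀ᴵ ⌈ σ ⌉ˢ)
    (trans (⟨subF⟩ (S.lift θ) A) (cong (λ η → substᴵ η ⟨ A ⟩) (⌈lift⌉ θ))))
                            (sym (substᴵ-∀ ⌈ θ ⌉ˢᵘᵇ ⟨ A ⟩))
  ⟨subF⟩ θ (S.∃̇ σ A)    = trans (cong (∃ᴵ ⌈ σ ⌉ˢ)
    (trans (⟨subF⟩ (S.lift θ) A) (cong (λ η → substᴵ η ⟨ A ⟩) (⌈lift⌉ θ))))
                            (sym (substᴵ-∃ ⌈ θ ⌉ˢᵘᵇ ⟨ A ⟩))

  ⟨[]⟩ : ∀ {Δ σ} (A : S.Fm (σ ∷ Δ)) (t : S.Tm Δ σ) → ⟨ A S.[ t ] ⟩ ≡ substᴵ (⌈ t ⌉ᵗ ∷ ids) ⟨ A ⟩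
  ⟨[]⟩ A t = trans (⟨subF⟩ (t ∷ S.ids) A) (cong (λ η → substᴵ (⌈ t ⌉ᵗ ∷ η) ⟨ A ⟩) ⌈ids⌉)

  ⟨wk⟩ : ∀ {Δ σ} (A : S.Fm Δ) → ⟨ S.subF (S.wk {σ}) A ⟩ ≡ substᴵ wk ⟨ A ⟩
  ⟨wk⟩ A = trans (⟨subF⟩ S.wk A) (cong (λ η → substᴵ η ⟨ A ⟩) ⌈wk⌉)

  negᴸ : ∀ {Δ} → List (S.Fm Δ) → List WType
  negᴸ Γ = concatMap (λ B → neg ⟨ B ⟩) Γ

  bodyᴸ : ∀ {Δ} (Γ : List (S.Fm Δ)) → Fm (ext (posᴸ Γ) (negᴸ Γ) ⌈ Δ ⌉ᶜ)
  bodyᴸ []      = ⊤̇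
  bodyᴸ (B ∷ Γ) = body (⟨ B ⟩ ∧ᴵ interp (posᴸ Γ) (negᴸ Γ) (bodyᴸ Γ))

  -- Definitionally the iterated ∧ᴵ, but with posᴸ Γ as types also for variable Γ.
  ⋀ : ∀ {Δ} → List (S.Fm Δ) → Interp ⌈ Δ ⌉ᶜ
  ⋀ Γ = interp (posᴸ Γ) (negᴸ Γ) (bodyᴸ Γ)

  ⋀-wk : ∀ {Δ σ} (Γ : List (S.Fm Δ)) → ⋀ (map (S.subF (S.wk {σ})) Γ) ≡ substᴵ wk (⋀ Γ)
  ⋀-wk []      = refl
  ⋀-wk (B ∷ Γ) = trans (cong₂ _∧ᴵ_ (⟨wk⟩ B) (⋀-wk Γ)) (sym (substᴵ-∧ wk ⟨ B ⟩ (⋀ Γ)))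

  module _ (T : TargetTheory M) where
    open TargetTheory T
    open TargetLogic T
    open Witnesses T
    open Entailment T
    open _⊩_

    ∀*-I : ∀ Φ {Δ} {A : Fm (Φ ++ Δ)} → [] ⊢ A → [] ⊢ ∀* Φ A
    ∀*-I []      d = d
    ∀*-I (σ ∷ Φ) d = ∀*-I Φ (∀I d)

    ∀*-E : ∀ Φ {Δ} (A : Fm (Φ ++ Δ)) → [] ⊢ ∀* Φ A → [] ⊢ A
    ∀*-E []      A d = d
    ∀*-E (σ ∷ Φ) A d = conv
      (trans (subF-lift-[] wk A (var (here refl))) (trans (cong (λ θ → subF θ A) lift-ids) (subF-ids A)))
      (∀E (⊢-sub wk (∀*-E Φ (∀̇ σ A) d)) (var (here refl)))

    closure-I : ∀ {Δ} {A : Fm Δ} → [] ⊢ A → [] ⊢ closure A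
    closure-I {[]}    d = d
    closure-I {σ ∷ Δ} d = closure-I (∀I d)

    -- The closed realizers `t` enter as constants of `W`. They work for all values of the free
    -- variables of `A`, hence for the instance under `θ`. Nothing is asked of `I`, but its bounds
    -- must still be given by some terms, hence the default singletons.
    interpretable : ∀ {Δ Φ} (A : S.Fm Δ) (I : Interp Φ) (θ : Sub ⌈ Δ ⌉ᶜ Φ) → Interpretable T A → I ⊩ substᴵ θ ⟨ A ⟩
    interpretable {Δ} {Φ} A I θ (t , d) = record
      { wit   = All.map W.con t
      ; bnd   = singles (defaults (neg I))
      ; valid = λ {_} {_} {xs} {as} {ds} p → substᴵ-I {η = θ}
          (holds (weaken-[] (conv (eq (All.map (sub xs) θ) ds as)
            (⊢-sub (++⁺ (map⁺ ds) (All.map (sub xs) θ)) open-d))))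
      }
      where
      J = ⟨ A ⟩
      N = ⌈ neg J ⌉*

      open-d : [] ⊢ at J (++⁻ʳ N ids) (closed t) (vars (neg J))
      open-d = ∀*-E N (at J (++⁻ʳ N ids) (closed t) (vars (neg J))) d

      eq : ∀ {Ξ Q} (ys : Sub ⌈ Δ ⌉ᶜ Ξ) (ds : Tms Ξ (neg J)) (as : Tms Ξ Q) →
           subF (++⁺ (map⁺ ds) ys) (at J (++⁻ʳ N ids) (closed t) (vars (neg J)))
             ≡ at J ys (evT as (All.map W.con t)) ds
      eq ys ds as = trans (subF-at J (++⁺ (map⁺ ds) ys) (++⁻ʳ N ids) (closed t) (vars (neg J)))
        (at-cong J (map-wkN (map⁺ ds) ys)
          (trans (map-∘ t) (trans (map-cong t (sub-closed₁ (++⁺ (map⁺ ds) ys))) (sym (map-∘ t))))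
          (subT-vars-++ (neg J) ds ys))

    -- Realizing the rules of the sequent calculus.

    module _ {Th : SourceTheory L} (sound : Sound T Th) where
      open SourceDerivation Th using () renaming (_⊢_ to _⊢ₛ_)
      private module D = SourceDerivation Th

      ⋀-exchange : ∀ {Δ} (Γ : List (S.Fm Δ)) {Γ′ A B} → ⋀ (Γ ++ B ∷ A ∷ Γ′) ⊩ ⋀ (Γ ++ A ∷ B ∷ Γ′)
      ⋀-exchange []      {Γ′} {A} {B} = ∧-pair (⊩-trans (∧-snd ⟨ B ⟩ (⋀ (A ∷ Γ′))) (∧-fst ⟨ A ⟩ (⋀ Γ′)))
        (∧-map ⟨ B ⟩ (⋀ (A ∷ Γ′)) (∧-snd ⟨ A ⟩ (⋀ Γ′)))
      ⋀-exchange (C ∷ Γ) {Γ′} {A} {B} = ∧-map ⟨ C ⟩ (⋀ (Γ ++ B ∷ A ∷ Γ′)) (⋀-exchange Γ)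

      realize : ∀ {Δ} {Γ : List (S.Fm Δ)} {A} → Γ ⊢ₛ A → ⋀ Γ ⊩ ⟨ A ⟩
      realize (D.identity {A})              = ∧-fst ⟨ A ⟩ (⋀ [])
      realize (D.weakening {Γ} {A} d)       = ⊩-trans (∧-snd ⟨ A ⟩ (⋀ Γ)) (realize d)
      realize (D.contraction {Γ} {A} d)     = ⊩-trans (∧-pair (∧-fst ⟨ A ⟩ (⋀ Γ)) ⊩-refl) (realize d)
      realize (D.exchange Γ d)              = ⊩-trans (⋀-exchange Γ) (realize d)
      realize (D.cut d e)                   = ⊩-trans (∧-pair (realize d) ⊩-refl) (realize e)
      realize (D.⊥L {Γ})                    = ⊩-trans (∧-fst (pure ⊥̇) (⋀ Γ)) ⊥-elim
      realize (D.∧L₁ {Γ} {A} {B} d)         = ⊩-trans (∧-mapˡ (⟨ A ⟩ ∧ᴵ ⟨ B ⟩) (⋀ Γ) (∧-fst ⟨ A ⟩ ⟨ B ⟩)) (realize d)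
      realize (D.∧L₂ {Γ} {A} {B} d)         = ⊩-trans (∧-mapˡ (⟨ A ⟩ ∧ᴵ ⟨ B ⟩) (⋀ Γ) (∧-snd ⟨ A ⟩ ⟨ B ⟩)) (realize d)
      realize (D.∧R d e)                    = ∧-pair (realize d) (realize e)
      realize (D.⊃L {Γ} {A} {B} d e)        = ⊩-trans (∧-pair
        (⊩-trans (∧-map (⟨ A ⟩ →ᴵ ⟨ B ⟩) (⋀ Γ) (realize d)) (eval ⟨ A ⟩ ⟨ B ⟩)) (∧-snd (⟨ A ⟩ →ᴵ ⟨ B ⟩) (⋀ Γ)))
          (realize e)
      realize (D.⊃R {Γ} {A} {B} d)          = curry (⋀ Γ) ⟨ A ⟩ ⟨ B ⟩ (realize d)
      realize (D.∀L {Γ} {σ} {A} {C} t d)    = ⊩-trans (∧-mapˡ (∀ᴵ ⌈ σ ⌉ˢ ⟨ A ⟩) (⋀ Γ) (∀-elim ⟨ A ⟩ ⌈ t ⌉ᵗ))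
        (subst (λ I → I ∧ᴵ ⋀ Γ ⊩ ⟨ C ⟩) (⟨[]⟩ A t) (realize d))
      realize (D.∀R {Γ} {A = A} d)          = ∀-intro (⋀ Γ) ⟨ A ⟩ (subst (_⊩ ⟨ A ⟩) (⋀-wk Γ) (realize d))
      -- `∃-elim` admits no side formulas, so `Γ` is curried into the conclusion, where it is a
      -- weakened formula as `∃-elim` demands, and `eval` applies the resulting implication to `Γ`
      -- afterwards.
      realize (D.∃L {Γ} {σ} {A} {C} d)      = ⊩-trans (∧-mapˡ (∃ᴵ ⌈ σ ⌉ˢ ⟨ A ⟩) (⋀ Γ) (∃-elim ⟨ A ⟩ (⋀ Γ →ᴵ ⟨ C ⟩)
        (subst (⟨ A ⟩ ⊩_) (sym (substᴵ-→ wk (⋀ Γ) ⟨ C ⟩)) (curry ⟨ A ⟩ Γ′ C′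
          (⊩-trans (∧-pair (∧-snd Γ′ ⟨ A ⟩) (∧-fst Γ′ ⟨ A ⟩))
            (subst₂ (λ I J → ⟨ A ⟩ ∧ᴵ I ⊩ J) (⋀-wk Γ) (⟨wk⟩ C) (realize d)))))))
        (eval (⋀ Γ) ⟨ C ⟩)
        where
        Γ′ = substᴵ wk (⋀ Γ)
        C′ = substᴵ wk ⟨ C ⟩
      realize (D.∃R {Γ} {A = A} t d)        = ⊩-trans (subst (⋀ Γ ⊩_) (⟨[]⟩ A t) (realize d)) (∃-intro ⟨ A ⟩ ⌈ t ⌉ᵗ)
      realize (D.≐-refl {σ})                = ∀-intro (⋀ []) (pure (v ≐ v)) (pure-intro (pure ⊤̇) (v ≐ v) ≐-refl)
        where
        v = var {σ = ⌈ σ ⌉ˢ} (here refl)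
      -- Both sides of the replacement are instances of the one interpretation `⟨ A ⟩` at its first
      -- variable, which is the situation of `replace`.
      realize (D.≐-repl {σ} {A} _)          = ∀-intro (⋀ []) (∀ᴵ ⌈ σ ⌉ˢ (Aˣ=y →ᴵ Aʸ)) (∀-intro (pure ⊤̇) (Aˣ=y →ᴵ Aʸ)
        (curry (pure ⊤̇) Aˣ=y Aʸ (⊩-trans (∧-fst Aˣ=y (pure ⊤̇))
          (subst₂ (λ I J → I ∧ᴵ pure (⌈ x ⌉ᵗ ≐ ⌈ y ⌉ᵗ) ⊩ J) (sym (⟨[]⟩ A x)) (sym (⟨[]⟩ A y))
            (replace ⟨ A ⟩ ⌈ x ⌉ᵗ ⌈ y ⌉ᵗ)))))
        where
        x = S.var (there (here refl))
        y = S.var (here refl)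
        Aˣ=y = ⟨ A S.[ x ] ⟩ ∧ᴵ pure (⌈ x ⌉ᵗ ≐ ⌈ y ⌉ᵗ)
        Aʸ = ⟨ A S.[ y ] ⟩
      realize (D.Π-eq x y)                  = pure-intro (⋀ []) _ (srcΠ-eq _ _ ⌈ x ⌉ᵗ ⌈ y ⌉ᵗ)
      realize (D.Σ-eq x y z)                = pure-intro (⋀ []) _ (srcΣ-eq _ _ _ ⌈ x ⌉ᵗ ⌈ y ⌉ᵗ ⌈ z ⌉ᵗ)
      realize (D.axiom {A = A} a θ)         =
        subst (⋀ [] ⊩_) (sym (⟨subF⟩ θ A)) (interpretable A (⋀ []) ⌈ θ ⌉ˢᵘᵇ (sound a))

    -- From open witnessing terms to closed ones.

    components : ∀ {P : WType → Set} {Δ} (Γ : List (S.Fm Δ)) → All P (negᴸ Γ **) → All (λ B → All P (neg ⟨ B ⟩ **)) Γ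
    components []      us = []
    components (B ∷ Γ) us = left** (neg ⟨ B ⟩) us ∷ components Γ (right** (neg ⟨ B ⟩) us)

    -- `F` stands for the closed bounds applied to witnesses and challenges. They agree with the
    -- open terms only up to provable equality, so the passage from separate premises to their
    -- conjunction also exchanges the bounds.
    premises-⋀ : ∀ {Δ Ξ Q} {H : List (Fm Ξ)} {xs : Sub ⌈ Δ ⌉ᶜ Ξ} (η : Tms Ξ Q)
                 (F : ∀ B → WTms Q (neg ⟨ B ⟩ **) → Tms Ξ (neg ⟨ B ⟩ **)) → (∀ B us → H ⊢ evT η us ≋ F B us) →
                 (Γ : List (S.Fm Δ)) (as : Tms Ξ (posᴸ Γ)) (us : WTms Q (negᴸ Γ **)) →
                 H ⊢ premises xs Γ as (All.map (λ {B} → F B) (components Γ us)) → Holds∀∈ H (⋀ Γ) xs as (evT η us)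
    premises-⋀ η F h []      []      us d = pure-∀∈-I d
    premises-⋀ η F h (B ∷ Γ) as us d = ∧ᴵ-∀∈-I (evT η us)
      (Holds∀∈-≋ (≋-trans (≋-reflexive (sym (map-left** (ev η) (neg ⟨ B ⟩) us))) (h B (left** (neg ⟨ B ⟩) us)))
        (holds∀∈ (∧E₁ d)))
      (Holds∀∈-cast refl refl (map-right** (ev η) (neg ⟨ B ⟩) us)
        (premises-⋀ η F h Γ (++⁻ʳ (pos ⟨ B ⟩) as) (right** (neg ⟨ B ⟩) us) (∧E₂ d)))

    closed-evT : ∀ {Δ ρs} (ts : WTms [] ρs) → closed {Δ} (evT [] ts) ≡ evT [] ts
    closed-evT ts = trans (map-∘ ts) (map-cong ts λ t → trans (ren≡sub (λ ()) (ev [] t)) (sub-ev [] [] t))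

    -- The substitution by `varsˡ P` puts the terms into the context `P ++ []`, as `lamT` requires;
    -- abstracting all of `P` then leaves no variables.
    abstract₁ : ∀ P {ρs} → WTms P ρs → Tms [] (P ⇛ ρs)
    abstract₁ P {ρs} ts = evT [] (lamT P ρs (ts [ varsˡ P ]ʷ))

    app-abstract₁ : ∀ {Δ} {H : List (Fm Δ)} P {ρs} (as : Tms Δ P) (ts : WTms P ρs) →
                    H ⊢ app P ρs (closed (abstract₁ P ts)) as ≋ evT as ts
    app-abstract₁ P {ρs} as ts = ≋-trans
      (≋-reflexive (cong (λ fs → app P ρs fs as) (closed-evT (lamT P ρs (ts [ varsˡ P ]ʷ)))))
      (≋-trans (βT P ρs [] as (ts [ varsˡ P ]ʷ))
        (≋-reflexive (trans (evT-[] (++⁺ as []) (varsˡ P) ts) (cong (λ η → evT η ts) (evT-varsˡ as [])))))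

    abstract₂ : ∀ P N {ρs} → WTms (N ++ P) ρs → Tms [] (P ⇛ N ⇛ ρs)
    abstract₂ P N {ρs} ts = abstract₁ P (lamT N ρs ts)

    app-abstract₂ : ∀ {Δ} {H : List (Fm Δ)} P N {ρs} (as : Tms Δ P) (ds : Tms Δ N) (ts : WTms (N ++ P) ρs) →
                    H ⊢ app N ρs (app P (N ⇛ ρs) (closed (abstract₂ P N ts)) as) ds ≋ evT (++⁺ ds as) ts
    app-abstract₂ P N {ρs} as ds ts =
      ≋-trans (app-cong N ρs ds (app-abstract₁ P as (lamT N ρs ts))) (βT N ρs as ds ts)

    sequent : ∀ {Δ} (Γ : List (S.Fm Δ)) (A : S.Fm Δ) → ⋀ Γ ⊩ ⟨ A ⟩ →
              Σ[ s ∈ All (λ B → Tms [] (posᴸ Γ ⇛ neg ⟨ A ⟩ ⇛ neg ⟨ B ⟩ **)) Γ ]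
              Σ[ t ∈ Tms [] (posᴸ Γ ⇛ pos ⟨ A ⟩) ]
                [] ⊢ SequentFormula T Γ A s t
    sequent {Δ} Γ A f = All.map (abstract₂ P N) (components Γ (bnd f)) , abstract₁ P (wit f) ,
      closure-I (∀*-I ⌈ P ⌉* (∀*-I ⌈ N ⌉* (⊃I (Holds.derivation
        (Holds-≋ ≋-refl (≋-sym (app-abstract₁ P a (wit f))) ≋-refl
          (valid f (premises-⋀ (++⁺ d a) F (λ B us → ≋-sym (app-abstract₂ P N a d us)) Γ a (bnd f)
            -- In `SequentFormula` the bounds arise by mapping over `s`, itself a map over
            -- `components`; the two maps are fused into the single `F`.
            (conv (cong (premises (baseVars P N) Γ a) (map-∘ (components Γ (bnd f)))) (hyp (here refl))))))))))
      where
      P = posᴸ Γ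
      N = neg ⟨ A ⟩

      a : Tms (ext P N ⌈ Δ ⌉ᶜ) P
      a = posVars P N

      d : Tms (ext P N ⌈ Δ ⌉ᶜ) N
      d = negVars P N

      F : ∀ B → WTms (N ++ P) (neg ⟨ B ⟩ **) → Tms (ext P N ⌈ Δ ⌉ᶜ) (neg ⟨ B ⟩ **)
      F B us = app N (neg ⟨ B ⟩ **) (app P (N ⇛ neg ⟨ B ⟩ **) (closed (abstract₂ P N us)) a) d

    -- For empty `Γ` there are no witnesses to depend on, so `wit f` is already closed and needs no
    -- abstraction; the remaining premise is the provable `⊤̇`.
    theorem-interpretable : ∀ {Δ} (A : S.Fm Δ) → ⋀ [] ⊩ ⟨ A ⟩ → Interpretable T A
    theorem-interpretable {Δ} A f = evT [] (wit f) , ∀*-I ⌈ neg ⟨ A ⟩ ⌉* (Holds.derivation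
      (Holds-cast {I = ⟨ A ⟩} {xs = xs} {bs = vars (neg ⟨ A ⟩)} refl (sym (closed-evT (wit f))) refl
        (valid f (pure-∀∈-I (⊃I (hyp (here refl)))))))
      where
      xs : Sub ⌈ Δ ⌉ᶜ (⌈ neg ⟨ A ⟩ ⌉* ++ ⌈ Δ ⌉ᶜ)
      xs = ++⁻ʳ ⌈ neg ⟨ A ⟩ ⌉* ids

theorem2p9 : (L : SourceLanguage) (M : TargetLanguage L)
    (S : SourceTheory L) (T : TargetTheory M)
    (base : Interpretations.BaseInterpretation M) →
    let open Interpretations M
        open Uniform base
        open Tuples M
        open SourceDerivation S renaming (_⊢_ to _⊢ₛ_)
        open TargetTheory T renaming (_⊢_ to _⊢ₜ_) in
    Sound T S →
    (∀ {Δ} (Γ : List (Source.Fm L Δ)) (A : Source.Fm L Δ) → Γ ⊢ₛ A →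
       Σ[ s ∈ All (λ B → Tms [] (posᴸ Γ ⇛ neg ⟨ A ⟩ ⇛ neg ⟨ B ⟩ **)) Γ ]
       Σ[ t ∈ Tms [] (posᴸ Γ ⇛ pos ⟨ A ⟩) ]
         [] ⊢ₜ SequentFormula T Γ A s t)
    × (∀ {Δ} (A : Source.Fm L Δ) → [] ⊢ₛ A → Interpretable T A)
theorem2p9 L M S T base sound =
  (λ Γ A d → sequent T Γ A (realize T {S} sound d)) ,
  (λ A d → theorem-interpretable T A (realize T {S} sound d))
  where open Soundness M base
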